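{- For any $\epsilon>0$, there is a two-sided adaptive algorithm for $\epsilon$-testing size-$s$ Boolean Circuit with respect to the uniform distribution that makes $\tilde O(s^2/\epsilon)$ queries.
   Context: Boolean functions $f:\{0,1\}^n\to\{0,1\}$ are accessed through a membership-query oracle that returns $f(x)$ for a queried $x$. $f$ is $\epsilon$-far from a class $C$ (with respect to the uniform distribution) if $\Pr_{x}[f(x)\neq g(x)]\ge\epsilon$ for every $g\in C$, with $x$ uniform on $\{0,1\}^n$. A two-sided adaptive algorithm for $\epsilon$-testing $C$ is a randomized algorithm that, given $\epsilon$ and membership-query access to an arbitrary $f$ (and able to draw uniform random strings), chooses queries possibly adaptively, accepts with probability at least $2/3$ if $f\in C$, and rejects with probability at least $2/3$ if $f$ is $\epsilon$-far from every function in $C$. $\tilde O(T)$ means $O(T\cdot\mathrm{poly}(\log T))$. A Boolean circuit is a rooted directed acyclic graph whose internal nodes are labeled AND, OR or NOT, AND/OR gates having arbitrary fan-in, and every directed path from the root ends at one of the nodes $x_1,\dots,x_n,0,1$; size-$s$ Boolean Circuit is the class of Boolean circuits with at most $s$ gates. -}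

module Defs where

open import Data.Bool using (Bool; true; false; not; _∧_; _∨_; _xor_; if_then_else_)
open import Data.Nat as ℕ using (ℕ; zero; suc; _⊔_)
open import Data.Nat.Logarithm using (⌈log₂_⌉)
open import Data.Fin using (Fin)
open import Data.Vec using (Vec; []; _∷_; _∷ʳ_; lookup)
open import Data.List using (List; []; _∷_; map; concatMap)
open import Data.Nat.ListAction using (sum)
open import Data.Bool.ListAction using (all; any)
open import Data.Sum using (_⊎_; inj₁; inj₂)
open import Data.Product using (Σ; _×_; _,_)
open import Data.Integer using (+_)
open import Data.Rational using (ℚ; _+_; _*_; _≤_; _<_; ½; 0ℚ; _/_; 1/_; positive; ceiling)
open import Data.Rational.Properties using (pos⇒nonZero)
open import Relation.Binary.PropositionalEquality using (_≡_)

Input : ℕ → Set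
Input n = Vec Bool n

BoolFn : ℕ → Set
BoolFn n = Input n → Bool

allInputs : (n : ℕ) → List (Input n)
allInputs zero    = [] ∷ []
allInputs (suc n) = concatMap (λ x → (false ∷ x) ∷ (true ∷ x) ∷ []) (allInputs n)

-- number of inputs x with f x ≠ g x  (so Pr_x[f x ≠ g x] = disagree f g / 2^n)
disagree : ∀ {n} → BoolFn n → BoolFn n → ℕ
disagree {n} f g = sum (map (λ x → if f x xor g x then 1 else 0) (allInputs n))

-- Boolean circuits as DAGs in topological order (straight-line programs).
-- A wire available to the m-th gate is: an input variable x_i,
-- a constant 0/1, or the output of an earlier gate j < m.

Wire : ℕ → ℕ → Set
Wire n m = Fin n ⊎ (Bool ⊎ Fin m)

data Gate (n m : ℕ) : Set where
  AND : List (Wire n m) → Gate n m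
  OR  : List (Wire n m) → Gate n m
  NOT : Wire n m → Gate n m

data Gates (n : ℕ) : ℕ → Set where
  []  : Gates n 0
  _▷_ : ∀ {m} → Gates n m → Gate n m → Gates n (suc m)

record Circuit (n m : ℕ) : Set where
  constructor circuit
  field
    gates : Gates n m
    root  : Wire n m

wireVal : ∀ {n m} → Input n → Vec Bool m → Wire n m → Bool
wireVal x vs (inj₁ i)        = lookup x i
wireVal x vs (inj₂ (inj₁ b)) = b
wireVal x vs (inj₂ (inj₂ j)) = lookup vs j

gateVal : ∀ {n m} → Input n → Vec Bool m → Gate n m → Bool
gateVal x vs (AND ws) = all (wireVal x vs) ws
gateVal x vs (OR ws)  = any (wireVal x vs) ws
gateVal x vs (NOT w)  = not (wireVal x vs w)

gateVals : ∀ {n m} → Gates n m → Input n → Vec Bool m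
gateVals []       x = []
gateVals (gs ▷ g) x = let vs = gateVals gs x in vs ∷ʳ gateVal x vs g

eval : ∀ {n m} → Circuit n m → BoolFn n
eval (circuit gs r) x = wireVal x (gateVals gs x) r

InSizeCircuit : ∀ {n} → ℕ → BoolFn n → Set
InSizeCircuit {n} s f = Σ ℕ λ m → m ℕ.≤ s × Σ (Circuit n m) λ C → ∀ x → f x ≡ eval C x

-- f is ε-far from size-s Boolean Circuit:
-- Pr_x[f x ≠ g x] ≥ ε, i.e. disagree f g ≥ ε · 2^n, for every g in the class
FarFromSizeCircuit : ∀ {n} → ℕ → ℚ → BoolFn n → Set
FarFromSizeCircuit {n} s ε f =
  ∀ m → m ℕ.≤ s → (C : Circuit n m) → ε * (+ (2 ℕ.^ n) / 1) ≤ (+ disagree f (eval C) / 1)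

-- Randomized adaptive membership-query algorithms, as finite trees.
-- coin: flip a fair random bit;  query x: ask the oracle for f x.

data Alg (n : ℕ) : Set where
  accept reject : Alg n
  coin  : (Bool → Alg n) → Alg n
  query : Input n → (Bool → Alg n) → Alg n

acceptProb : ∀ {n} → Alg n → BoolFn n → ℚ
acceptProb accept      f = + 1 / 1
acceptProb reject      f = 0ℚ
acceptProb (coin k)    f = ½ * (acceptProb (k false) f + acceptProb (k true) f)
acceptProb (query x k) f = acceptProb (k (f x)) f

rejectProb : ∀ {n} → Alg n → BoolFn n → ℚ
rejectProb accept      f = 0ℚ
rejectProb reject      f = + 1 / 1
rejectProb (coin k)    f = ½ * (rejectProb (k false) f + rejectProb (k true) f)
rejectProb (query x k) f = rejectProb (k (f x)) f

queries : ∀ {n} → Alg n → ℕ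
queries accept      = 0
queries reject      = 0
queries (coin k)    = queries (k false) ⊔ queries (k true)
queries (query x k) = suc (queries (k false) ⊔ queries (k true))

twoThirds : ℚ
twoThirds = + 2 / 3

T : ℕ → (ε : ℚ) → 0ℚ < ε → ℚ
T s ε ε>0 = (+ (s ℕ.* s) / 1) * (1/ ε) {{pos⇒nonZero ε {{positive ε>0}}}}

ceilℕ : ℚ → ℕ
ceilℕ q = Data.Integer.∣ ceiling q ∣
  where import Data.Integer

SoftOBound : (c k : ℕ) → ℚ → ℚ
SoftOBound c k t = (+ c / 1) * t * (+ ((1 ℕ.+ ⌈log₂ ceilℕ t ⌉) ℕ.^ k) / 1)

module Submission where

-- Split the variables at random into R blocks. A gate reading many variables is almost always
-- equal to its controlling value, so a size-s circuit f is, up to a negligible error, determined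
-- by Õ(s) variables, and these fall into different blocks; only log R, not log n, queries are then
-- spent on finding the block of a relevant variable, by binary search between two block-constant
-- inputs on which f differs. Fixing all other blocks as in the witness found there turns f into a
-- dictator (or anti-dictator) of the block, which yields the hidden variable of any input x by
-- self-correction. As a function of the found blocks f is again a size-s circuit, hence one of
-- 2^Õ(s²) candidates, and Õ(s²/ε) random samples determine a candidate c that is close to it.
-- The tester accepts if f(x) = c(hidden variables of x) on O(1/ε) uniform inputs x.
--
-- Soundness does not depend on how c and the witnesses were found: dictator tests enforce that what
-- is decoded really is a variable of x, so passing the last test means that f is close to c with
-- variables substituted for its inputs, which is a circuit of the same size.

open import Defs
open import Data.Bool using (Bool; true; false; not; _∧_; _∨_; _xor_; if_then_else_) renaming (T to IsTrue)
import Data.Bool.Properties as Boolₚ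
open import Data.Bool.ListAction using (all; any)
open import Data.Nat as ℕ using (ℕ; zero; suc; _≥_)
import Data.Nat.Properties as ℕₚ
import Data.Nat.DivMod as ℕ/
import Data.Nat.Solver
open import Data.Nat.Logarithm using (⌈log₂_⌉; ⌈log₂⌉-mono-≤; ⌈log₂⌈n/2⌉⌉≡⌈log₂n⌉∸1; ⌈log₂2^n⌉≡n)
open import Data.Nat.ListAction using (sum)
open import Data.Integer as ℤ using () renaming (+_ to pos)
import Data.Integer.Properties as ℤₚ
import Data.Integer.DivMod as ℤ/
open import Data.Fin as Fin using (Fin)
import Data.Fin.Properties as Finₚ
open import Data.List as List using (List; []; _∷_; _++_; length; concatMap; cartesianProductWith)
import Data.List.Properties as Listₚ
open import Data.List.Membership.Propositional using (_∈_)
import Data.List.Membership.Propositional.Properties as ∈ₚ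
import Data.List.Membership.DecPropositional as DecMem
open import Data.List.Relation.Unary.Any as Any using (Any; here; there)
open import Data.Vec as Vec using (Vec; []; _∷_; lookup; replicate; tabulate; _[_]≔_; _∷ʳ_)
import Data.Vec.Properties as Vecₚ
open import Data.Vec.Relation.Binary.Pointwise.Inductive using (Pointwise; []; _∷_)
open import Data.Rational as ℚ using (ℚ; mkℚ; _+_; _*_; _-_; -_; _≤_; _<_; ½; 0ℚ; 1ℚ; _/_; 1/_; positive; toℚᵘ; ↥_; ↧_)
import Data.Rational.Properties as ℚₚ
import Data.Rational.Unnormalised as ℚᵘ
import Data.Rational.Unnormalised.Properties as ℚᵘₚ
open import Data.Rational.Solver using (module +-*-Solver)
open import Data.Product using (Σ; _×_; _,_; proj₁; proj₂)
open import Data.Sum as Sum using (_⊎_; inj₁; inj₂; [_,_]′)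
import Data.Sum.Properties as Sumₚ
open import Data.Empty using (⊥; ⊥-elim)
open import Function using (id; _∘_; module Equivalence)
open import Relation.Nullary using (Dec; yes; no; does)
open import Relation.Nullary.Decidable using (from-yes; _×-dec_)
open import Relation.Unary using (Decidable)
open import Relation.Binary.PropositionalEquality using (_≡_; _≢_; refl; sym; trans; cong; cong₂; subst; module ≡-Reasoning)
open +-*-Solver using (solve; _:=_; _:+_; _:*_; _:-_; con)

private module ℕsolve = Data.Nat.Solver.+-*-Solver

-- A circuit is only close to a junta, whereas the search queries f on block-constant inputs, which
-- may be a negligible part of the cube: closeness under the uniform distribution alone says nothing
-- there. This dictates the form of `NearJunta`: its exceptional set `bad` is itself determined by
-- the relevant variables `U`. Once the blocks separate `U`, a function of `U` has the same mean
-- over block-constant inputs as over all inputs (`M-spread`), so `bad` stays rare; off `bad`,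
-- stability is pointwise and applies to the two particular inputs at which the binary search stops.
--
-- The rate s²/ε comes from p = Õ(s) stages of q = O(p/ε) attempts. If the unfound blocks still
-- matter with probability r, all q attempts fail with probability (1 - r)^q, and r(1 - r)^q ≤ 1/q
-- for every r. The stages thus leave an expected error of about p/q, which has to be small against
-- the O(1/ε) final samples.
--
-- Probabilities are exact iterated means. Linearity, union bounds and Bernoulli's inequality take
-- the place of concentration bounds. Completeness spends 1/18 on each of six failure events.

-- Inequalities and indicators in ℚ

≤-by : ∀ {p q} → 0ℚ ≤ q - p → p ≤ q
≤-by {p} {q} h = begin
  p             ≡⟨ sym (ℚₚ.+-identityˡ p) ⟩
  0ℚ + p        ≤⟨ ℚₚ.+-monoˡ-≤ p h ⟩
  (q - p) + p   ≡⟨ solve 2 (λ p q → (q :- p) :+ p := q) refl p q ⟩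
  q             ∎
  where open ℚₚ.≤-Reasoning

0≤- : ∀ {p q} → p ≤ q → 0ℚ ≤ q - p
0≤- {p} {q} h = begin
  0ℚ     ≡⟨ sym (ℚₚ.+-inverseʳ p) ⟩
  p - p  ≤⟨ ℚₚ.+-monoˡ-≤ (- p) h ⟩
  q - p  ∎
  where open ℚₚ.≤-Reasoning

*-monoˡ : ∀ {a b} c → 0ℚ ≤ c → a ≤ b → c * a ≤ c * b
*-monoˡ c c≥0 h = ℚₚ.*-monoˡ-≤-nonNeg c {{ℚ.nonNegative c≥0}} h

*-monoʳ : ∀ {a b} c → 0ℚ ≤ c → a ≤ b → a * c ≤ b * c
*-monoʳ c c≥0 h = ℚₚ.*-monoʳ-≤-nonNeg c {{ℚ.nonNegative c≥0}} h

0≤+ : ∀ {p q} → 0ℚ ≤ p → 0ℚ ≤ q → 0ℚ ≤ p + q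
0≤+ = ℚₚ.+-mono-≤

0≤* : ∀ {p q} → 0ℚ ≤ p → 0ℚ ≤ q → 0ℚ ≤ p * q
0≤* {p} {q} hp hq = begin
  0ℚ      ≡⟨ sym (ℚₚ.*-zeroʳ p) ⟩
  p * 0ℚ  ≤⟨ *-monoˡ p hp hq ⟩
  p * q   ∎
  where open ℚₚ.≤-Reasoning

*-mono : ∀ {a b c d} → 0ℚ ≤ a → 0ℚ ≤ d → a ≤ b → c ≤ d → a * c ≤ b * d
*-mono {a} {b} {c} {d} a≥0 d≥0 ab cd = ℚₚ.≤-trans (*-monoˡ a a≥0 cd) (*-monoʳ d d≥0 ab)

0≤½ : 0ℚ ≤ ½
0≤½ = from-yes (0ℚ ℚₚ.≤? ½)

0≤1 : 0ℚ ≤ 1ℚ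
0≤1 = from-yes (0ℚ ℚₚ.≤? 1ℚ)

≤+ˡ : ∀ {p q} → 0ℚ ≤ q → p ≤ q + p
≤+ˡ {p} {q} h = ℚₚ.≤-trans (ℚₚ.≤-reflexive (sym (ℚₚ.+-identityˡ p))) (ℚₚ.+-monoˡ-≤ p h)

≤+ʳ : ∀ {p q} → 0ℚ ≤ q → p ≤ p + q
≤+ʳ {p} {q} h = ℚₚ.≤-trans (ℚₚ.≤-reflexive (sym (ℚₚ.+-identityʳ p))) (ℚₚ.+-monoʳ-≤ p h)

⟦_⟧ : Bool → ℚ
⟦ true ⟧  = 1ℚ
⟦ false ⟧ = 0ℚ

⟦⟧≥0 : ∀ b → 0ℚ ≤ ⟦ b ⟧
⟦⟧≥0 true  = 0≤1
⟦⟧≥0 false = ℚₚ.≤-refl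

⟦⟧≤1 : ∀ b → ⟦ b ⟧ ≤ 1ℚ
⟦⟧≤1 true  = ℚₚ.≤-refl
⟦⟧≤1 false = 0≤1

-- Means over the Boolean cube

-- The mean, unfolding exactly like a tree of coin flips.
M : ∀ n → (Vec Bool n → ℚ) → ℚ
M zero    X = X []
M (suc n) X = ½ * (M n (λ x → X (false ∷ x)) + M n (λ x → X (true ∷ x)))

½-mono : ∀ {a b c d} → a ≤ c → b ≤ d → ½ * (a + b) ≤ ½ * (c + d)
½-mono h k = *-monoˡ ½ 0≤½ (ℚₚ.+-mono-≤ h k)

M-cong : ∀ n {X Y : Vec Bool n → ℚ} → (∀ x → X x ≡ Y x) → M n X ≡ M n Y
M-cong zero    h = h []
M-cong (suc n) h = cong₂ (λ a b → ½ * (a + b)) (M-cong n (λ x → h _)) (M-cong n (λ x → h _))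

M-mono : ∀ n {X Y : Vec Bool n → ℚ} → (∀ x → X x ≤ Y x) → M n X ≤ M n Y
M-mono zero    h = h []
M-mono (suc n) h = ½-mono (M-mono n (λ x → h _)) (M-mono n (λ x → h _))

½-idem : ∀ c → ½ * (c + c) ≡ c
½-idem = solve 1 (λ c → con ½ :* (c :+ c) := c) refl

M-const : ∀ n c → M n (λ _ → c) ≡ c
M-const zero    c = refl
M-const (suc n) c = trans (cong (λ a → ½ * (a + a)) (M-const n c)) (½-idem c)

M-+ : ∀ n (X Y : Vec Bool n → ℚ) → M n (λ x → X x + Y x) ≡ M n X + M n Y
M-+ zero    X Y = refl
M-+ (suc n) X Y = trans
  (cong₂ (λ a b → ½ * (a + b)) (M-+ n (λ x → X (false ∷ x)) (λ x → Y (false ∷ x)))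
                               (M-+ n (λ x → X (true ∷ x)) (λ x → Y (true ∷ x))))
  (solve 4 (λ a b c d → con ½ :* ((a :+ b) :+ (c :+ d)) := con ½ :* (a :+ c) :+ con ½ :* (b :+ d)) refl
     (M n (λ x → X (false ∷ x))) (M n (λ x → Y (false ∷ x)))
     (M n (λ x → X (true ∷ x))) (M n (λ x → Y (true ∷ x))))

M-* : ∀ n c (X : Vec Bool n → ℚ) → M n (λ x → c * X x) ≡ c * M n X
M-* zero    c X = refl
M-* (suc n) c X = trans
  (cong₂ (λ a b → ½ * (a + b)) (M-* n c (λ x → X (false ∷ x))) (M-* n c (λ x → X (true ∷ x))))
  (solve 3 (λ c a b → con ½ :* (c :* a :+ c :* b) := c :* (con ½ :* (a :+ b))) refl c
     (M n (λ x → X (false ∷ x))) (M n (λ x → X (true ∷ x))))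

M-*ʳ : ∀ n (X : Vec Bool n → ℚ) c → M n (λ x → X x * c) ≡ M n X * c
M-*ʳ n X c = trans (M-cong n (λ x → ℚₚ.*-comm (X x) c)) (trans (M-* n c X) (ℚₚ.*-comm c (M n X)))

M-+ˡ : ∀ n c (X : Vec Bool n → ℚ) → M n (λ x → c + X x) ≡ c + M n X
M-+ˡ n c X = trans (M-+ n (λ _ → c) X) (cong (_+ M n X) (M-const n c))

M-+ʳ : ∀ n (X : Vec Bool n → ℚ) c → M n (λ x → X x + c) ≡ M n X + c
M-+ʳ n X c = trans (M-+ n X (λ _ → c)) (cong (M n X +_) (M-const n c))

M-1- : ∀ n (X : Vec Bool n → ℚ) → M n (λ x → 1ℚ - X x) ≡ 1ℚ - M n X
M-1- n X = begin
  M n (λ x → 1ℚ - X x)             ≡⟨ M-cong n (λ x → neg (X x)) ⟩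
  M n (λ x → 1ℚ + (- 1ℚ) * X x)    ≡⟨ M-+ˡ n 1ℚ (λ x → (- 1ℚ) * X x) ⟩
  1ℚ + M n (λ x → (- 1ℚ) * X x)    ≡⟨ cong (1ℚ +_) (M-* n (- 1ℚ) X) ⟩
  1ℚ + (- 1ℚ) * M n X              ≡⟨ sym (neg (M n X)) ⟩
  1ℚ - M n X                       ∎
  where
  open ≡-Reasoning
  neg : ∀ a → 1ℚ - a ≡ 1ℚ + (- 1ℚ) * a
  neg = solve 1 (λ a → con 1ℚ :- a := con 1ℚ :+ con (- 1ℚ) :* a) refl

M-½ : ∀ n (X Y : Vec Bool n → ℚ) → M n (λ x → ½ * (X x + Y x)) ≡ ½ * (M n X + M n Y)
M-½ n X Y = trans (M-* n ½ (λ x → X x + Y x)) (cong (½ *_) (M-+ n X Y))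

M-swap : ∀ m n (X : Vec Bool m → Vec Bool n → ℚ) →
  M m (λ x → M n (λ y → X x y)) ≡ M n (λ y → M m (λ x → X x y))
M-swap zero    n X = refl
M-swap (suc m) n X = trans
  (cong₂ (λ a b → ½ * (a + b)) (M-swap m n (λ x y → X (false ∷ x) y)) (M-swap m n (λ x y → X (true ∷ x) y)))
  (sym (M-½ n (λ y → M m (λ x → X (false ∷ x) y)) (λ y → M m (λ x → X (true ∷ x) y))))

M-nonneg : ∀ n {X : Vec Bool n → ℚ} → (∀ x → 0ℚ ≤ X x) → 0ℚ ≤ M n X
M-nonneg n h = ℚₚ.≤-trans (ℚₚ.≤-reflexive (sym (M-const n 0ℚ))) (M-mono n h)

M-≤ : ∀ n {X : Vec Bool n → ℚ} {c} → (∀ x → X x ≤ c) → M n X ≤ c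
M-≤ n {c = c} h = ℚₚ.≤-trans (M-mono n h) (ℚₚ.≤-reflexive (M-const n c))

M-≤-+ : ∀ n {X Y Z : Vec Bool n → ℚ} → (∀ x → X x ≤ Y x + Z x) → M n X ≤ M n Y + M n Z
M-≤-+ n {Y = Y} {Z} h = ℚₚ.≤-trans (M-mono n h) (ℚₚ.≤-reflexive (M-+ n Y Z))

infixl 6 _⊕_
_⊕_ : ∀ {n} → Vec Bool n → Vec Bool n → Vec Bool n
_⊕_ = Vec.zipWith _xor_

infixl 7 _⊓_
_⊓_ : ∀ {n} → Vec Bool n → Vec Bool n → Vec Bool n
_⊓_ = Vec.zipWith _∧_

-- Translation permutes the cube, so a point `x ⊕ z` with random `z` is uniform whatever `x` is.
-- Self-correction rests on this.
M-⊕ : ∀ n (c : Vec Bool n) (X : Vec Bool n → ℚ) → M n (λ x → X (c ⊕ x)) ≡ M n X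
M-⊕ zero    []          X = refl
M-⊕ (suc n) (false ∷ c) X = cong₂ (λ a b → ½ * (a + b)) (M-⊕ n c (λ x → X (false ∷ x))) (M-⊕ n c (λ x → X (true ∷ x)))
M-⊕ (suc n) (true ∷ c)  X = trans
  (cong₂ (λ a b → ½ * (a + b)) (M-⊕ n c (λ x → X (true ∷ x))) (M-⊕ n c (λ x → X (false ∷ x))))
  (cong (½ *_) (ℚₚ.+-comm (M n (λ x → X (true ∷ x))) (M n (λ x → X (false ∷ x)))))

mix : ∀ {n} → Vec Bool n → Vec Bool n → Vec Bool n → Vec Bool n
mix []          []      []      = []
mix (b ∷ m) (x ∷ xs) (y ∷ ys) = (if b then x else y) ∷ mix m xs ys

lookup-mix : ∀ {n} (m x y : Vec Bool n) i → lookup (mix m x y) i ≡ (if lookup m i then lookup x i else lookup y i)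
lookup-mix (b ∷ m) (x ∷ xs) (y ∷ ys) Fin.zero    = refl
lookup-mix (b ∷ m) (x ∷ xs) (y ∷ ys) (Fin.suc i) = lookup-mix m xs ys i

-- Each coordinate of the mixture is one fresh uniform bit, taken from one of two independent
-- vectors. Hence every single hybrid met in the search is uniformly distributed.
M-mix : ∀ n (m : Vec Bool n) (X : Vec Bool n → ℚ) → M n (λ x → M n (λ y → X (mix m x y))) ≡ M n X
M-mix zero    []      X = refl
M-mix (suc n) (b ∷ m) X = begin
  M (suc n) (λ x → M (suc n) (λ y → X (mix (b ∷ m) x y)))
    ≡⟨ cong₂ (λ p q → ½ * (p + q)) (step false) (step true) ⟩
  ½ * (½ * (A (if b then false else false) + A (if b then false else true))
     + ½ * (A (if b then true else false) + A (if b then true else true)))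
    ≡⟨ fin b ⟩
  ½ * (A false + A true) ∎
  where
  open ≡-Reasoning
  A : Bool → ℚ
  A c = M n (λ x → X (c ∷ x))
  step : ∀ c → M n (λ x → M (suc n) (λ y → X (mix (b ∷ m) (c ∷ x) y)))
             ≡ ½ * (A (if b then c else false) + A (if b then c else true))
  step c = trans
    (M-½ n (λ x → M n (λ y → X ((if b then c else false) ∷ mix m x y)))
           (λ x → M n (λ y → X ((if b then c else true) ∷ mix m x y))))
    (cong₂ (λ p q → ½ * (p + q)) (M-mix n m (λ x → X ((if b then c else false) ∷ x)))
                                 (M-mix n m (λ x → X ((if b then c else true) ∷ x))))
  fin : ∀ b → ½ * (½ * (A (if b then false else false) + A (if b then false else true))
     + ½ * (A (if b then true else false) + A (if b then true else true))) ≡ ½ * (A false + A true)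
  fin false = ½-idem _
  fin true  = cong₂ (λ p q → ½ * (p + q)) (½-idem (A false)) (½-idem (A true))

-- Resampling one coordinate does not change the mean. In `M-spread` this splits off the block of
-- one relevant variable.
M-set : ∀ n i (X : Vec Bool n → ℚ) →
  M n X ≡ ½ * (M n (λ x → X (x [ i ]≔ false)) + M n (λ x → X (x [ i ]≔ true)))
M-set (suc n) Fin.zero X = cong₂ (λ p q → ½ * (p + q)) (sym (½-idem (M n (λ x → X (false ∷ x))))) (sym (½-idem (M n (λ x → X (true ∷ x)))))
M-set (suc n) (Fin.suc i) X = trans
  (cong₂ (λ p q → ½ * (p + q)) (M-set n i (λ x → X (false ∷ x))) (M-set n i (λ x → X (true ∷ x))))
  (solve 4 (λ a b c d → con ½ :* (con ½ :* (a :+ b) :+ con ½ :* (c :+ d)) := con ½ :* (con ½ :* (a :+ c) :+ con ½ :* (b :+ d))) refl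
    (M n (λ x → X (false ∷ (x [ i ]≔ false)))) (M n (λ x → X (false ∷ (x [ i ]≔ true))))
    (M n (λ x → X (true ∷ (x [ i ]≔ false)))) (M n (λ x → X (true ∷ (x [ i ]≔ true)))))

-- Powers, unit fractions and Bernoulli's inequality

infixr 8 _^_
_^_ : ℚ → ℕ → ℚ
p ^ zero  = 1ℚ
p ^ suc n = p * p ^ n

^-nonneg : ∀ {p} → 0ℚ ≤ p → ∀ n → 0ℚ ≤ p ^ n
^-nonneg h zero    = 0≤1
^-nonneg h (suc n) = 0≤* h (^-nonneg h n)

^-≤1 : ∀ {p} → 0ℚ ≤ p → p ≤ 1ℚ → ∀ n → p ^ n ≤ 1ℚ
^-≤1 h k zero    = ℚₚ.≤-refl
^-≤1 {p} h k (suc n) = ℚₚ.≤-trans (*-mono h 0≤1 k (^-≤1 h k n)) (ℚₚ.≤-reflexive (ℚₚ.*-identityˡ 1ℚ))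

^-mono : ∀ {p q} → 0ℚ ≤ p → p ≤ q → ∀ n → p ^ n ≤ q ^ n
^-mono h k zero    = ℚₚ.≤-refl
^-mono h k (suc n) = *-mono h (^-nonneg (ℚₚ.≤-trans h k) n) k (^-mono h k n)

^-+ : ∀ p m n → p ^ (m ℕ.+ n) ≡ p ^ m * p ^ n
^-+ p zero    n = sym (ℚₚ.*-identityˡ (p ^ n))
^-+ p (suc m) n = trans (cong (p *_) (^-+ p m n)) (sym (ℚₚ.*-assoc p (p ^ m) (p ^ n)))

^-* : ∀ p m n → p ^ (n ℕ.* m) ≡ (p ^ m) ^ n
^-* p m zero    = refl
^-* p m (suc n) = trans (^-+ p m (n ℕ.* m)) (cong (p ^ m *_) (^-* p m n))

ι : ℕ → ℚ
ι n = pos n / 1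

inv : (d : ℕ) .{{_ : ℕ.NonZero d}} → ℚ
inv d = pos 1 / d

-- A quotient in ℚ is stuck on a gcd when its numerator is open; in ℚᵘ it is a literal pair. The
-- arithmetic of `ι` and `inv` is therefore checked there and pulled back.
toℚᵘ-ι : ∀ n → toℚᵘ (ι n) ℚᵘ.≃ ℚᵘ.mkℚᵘ (pos n) 0
toℚᵘ-ι n = ℚₚ.toℚᵘ-fromℚᵘ (ℚᵘ.mkℚᵘ (pos n) 0)

toℚᵘ-inv : ∀ d → toℚᵘ (inv (suc d)) ℚᵘ.≃ ℚᵘ.mkℚᵘ (pos 1) d
toℚᵘ-inv d = ℚₚ.toℚᵘ-fromℚᵘ (ℚᵘ.mkℚᵘ (pos 1) d)

ι-+ : ∀ m n → ι (m ℕ.+ n) ≡ ι m + ι n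
ι-+ m n = ℚₚ.toℚᵘ-injective (begin
  toℚᵘ (ι (m ℕ.+ n))                       ≈⟨ toℚᵘ-ι (m ℕ.+ n) ⟩
  ℚᵘ.mkℚᵘ (pos (m ℕ.+ n)) 0                  ≈⟨ ℚᵘ.*≡* (cong (ℤ._* (pos 1)) (trans (ℤₚ.pos-+ m n) (sym (cong₂ ℤ._+_ (ℤₚ.*-identityʳ (pos m)) (ℤₚ.*-identityʳ (pos n)))))) ⟩
  ℚᵘ.mkℚᵘ (pos m) 0 ℚᵘ.+ ℚᵘ.mkℚᵘ (pos n) 0     ≈⟨ ℚᵘₚ.+-cong (toℚᵘ-ι m) (toℚᵘ-ι n) ⟨
  toℚᵘ (ι m) ℚᵘ.+ toℚᵘ (ι n)               ≈⟨ ℚₚ.toℚᵘ-homo-+ (ι m) (ι n) ⟨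
  toℚᵘ (ι m + ι n)                         ∎)
  where open ℚᵘₚ.≃-Reasoning

ι-* : ∀ m n → ι (m ℕ.* n) ≡ ι m * ι n
ι-* m n = ℚₚ.toℚᵘ-injective (begin
  toℚᵘ (ι (m ℕ.* n))                       ≈⟨ toℚᵘ-ι (m ℕ.* n) ⟩
  ℚᵘ.mkℚᵘ (pos (m ℕ.* n)) 0                  ≈⟨ ℚᵘ.*≡* (cong (ℤ._* (pos 1)) (ℤₚ.pos-* m n)) ⟩
  ℚᵘ.mkℚᵘ (pos m) 0 ℚᵘ.* ℚᵘ.mkℚᵘ (pos n) 0     ≈⟨ ℚᵘₚ.*-cong (toℚᵘ-ι m) (toℚᵘ-ι n) ⟨
  toℚᵘ (ι m) ℚᵘ.* toℚᵘ (ι n)               ≈⟨ ℚₚ.toℚᵘ-homo-* (ι m) (ι n) ⟨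
  toℚᵘ (ι m * ι n)                         ∎)
  where open ℚᵘₚ.≃-Reasoning

ι-suc : ∀ n → ι (suc n) ≡ 1ℚ + ι n
ι-suc n = ι-+ 1 n

ι-mono : ∀ {m n} → m ℕ.≤ n → ι m ≤ ι n
ι-mono {m} {n} h = ℚₚ.toℚᵘ-cancel-≤ (ℚᵘₚ.≤-respˡ-≃ (ℚᵘₚ.≃-sym (toℚᵘ-ι m)) (ℚᵘₚ.≤-respʳ-≃ (ℚᵘₚ.≃-sym (toℚᵘ-ι n))
  (ℚᵘ.*≤* (ℤₚ.*-monoʳ-≤-nonNeg (pos 1) (ℤ.+≤+ h)))))

ι-cancel : ∀ {m n} → ι m ≤ ι n → m ℕ.≤ n
ι-cancel {m} {n} h with ℚᵘₚ.≤-respˡ-≃ (toℚᵘ-ι m) (ℚᵘₚ.≤-respʳ-≃ (toℚᵘ-ι n) (ℚₚ.toℚᵘ-mono-≤ h))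
... | ℚᵘ.*≤* k = ℤₚ.drop‿+≤+ (ℤₚ.*-cancelʳ-≤-pos (pos m) (pos n) (pos 1) k)

ι≥0 : ∀ n → 0ℚ ≤ ι n
ι≥0 n = ι-mono {0} {n} ℕ.z≤n

inv≥0 : ∀ d .{{_ : ℕ.NonZero d}} → 0ℚ ≤ inv d
inv≥0 (suc d) = ℚₚ.toℚᵘ-cancel-≤ (ℚᵘₚ.≤-respʳ-≃ (ℚᵘₚ.≃-sym (toℚᵘ-inv d)) (ℚᵘ.*≤* (ℤ.+≤+ ℕ.z≤n)))

ι-inv : ∀ d .{{_ : ℕ.NonZero d}} → ι d * inv d ≡ 1ℚ
ι-inv (suc d) = ℚₚ.toℚᵘ-injective (begin
  toℚᵘ (ι (suc d) * inv (suc d))                ≈⟨ ℚₚ.toℚᵘ-homo-* (ι (suc d)) (inv (suc d)) ⟩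
  toℚᵘ (ι (suc d)) ℚᵘ.* toℚᵘ (inv (suc d))      ≈⟨ ℚᵘₚ.*-cong (toℚᵘ-ι (suc d)) (toℚᵘ-inv d) ⟩
  ℚᵘ.mkℚᵘ (pos (suc d)) 0 ℚᵘ.* ℚᵘ.mkℚᵘ (pos 1) d      ≈⟨ ℚᵘ.*≡* (trans (ℤₚ.*-identityʳ _) (trans (ℤₚ.*-identityʳ _) (sym (trans (ℤₚ.*-identityˡ _) (cong pos (ℕₚ.*-identityˡ (suc d))))))) ⟩
  ℚᵘ.1ℚᵘ                                        ∎)
  where open ℚᵘₚ.≃-Reasoning

ι*inv≤inv : ∀ a b d .{{_ : ℕ.NonZero b}} .{{_ : ℕ.NonZero d}} → a ℕ.* b ℕ.≤ d → ι a * inv d ≤ inv b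
ι*inv≤inv a b d h = begin
  ι a * inv d                     ≡⟨ sym (ℚₚ.*-identityʳ _) ⟩
  ι a * inv d * 1ℚ                ≡⟨ cong (ι a * inv d *_) (sym (ι-inv b)) ⟩
  ι a * inv d * (ι b * inv b)     ≡⟨ solve 4 (λ a d b c → a :* d :* (b :* c) := a :* b :* (d :* c)) refl (ι a) (inv d) (ι b) (inv b) ⟩
  ι a * ι b * (inv d * inv b)     ≡⟨ cong (_* (inv d * inv b)) (sym (ι-* a b)) ⟩
  ι (a ℕ.* b) * (inv d * inv b)   ≤⟨ *-monoʳ (inv d * inv b) (0≤* (inv≥0 d) (inv≥0 b)) (ι-mono h) ⟩
  ι d * (inv d * inv b)           ≡⟨ sym (ℚₚ.*-assoc (ι d) (inv d) (inv b)) ⟩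
  ι d * inv d * inv b             ≡⟨ cong (_* inv b) (ι-inv d) ⟩
  1ℚ * inv b                      ≡⟨ ℚₚ.*-identityˡ _ ⟩
  inv b                           ∎
  where open ℚₚ.≤-Reasoning

≤inv : ∀ {x} c .{{_ : ℕ.NonZero c}} → x * ι c ≤ 1ℚ → x ≤ inv c
≤inv {x} c h = begin
  x                  ≡⟨ sym (ℚₚ.*-identityʳ x) ⟩
  x * 1ℚ             ≡⟨ cong (x *_) (sym (ι-inv c)) ⟩
  x * (ι c * inv c)  ≡⟨ sym (ℚₚ.*-assoc x (ι c) (inv c)) ⟩
  x * ι c * inv c    ≤⟨ *-monoʳ (inv c) (inv≥0 c) h ⟩
  1ℚ * inv c         ≡⟨ ℚₚ.*-identityˡ _ ⟩
  inv c              ∎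
  where open ℚₚ.≤-Reasoning

inv≤1 : ∀ d .{{_ : ℕ.NonZero d}} → inv d ≤ 1ℚ
inv≤1 d@(suc _) = ℚₚ.≤-trans (ℚₚ.≤-reflexive (sym (ℚₚ.*-identityˡ (inv d)))) (ι*inv≤inv 1 1 d (ℕ.s≤s ℕ.z≤n))

½^≡inv : ∀ n .{{_ : ℕ.NonZero (2 ℕ.^ n)}} → ½ ^ n ≡ inv (2 ℕ.^ n)
½^≡inv n = begin
  ½ ^ n                                       ≡⟨ sym (ℚₚ.*-identityʳ _) ⟩
  ½ ^ n * 1ℚ                                  ≡⟨ cong (½ ^ n *_) (sym (ι-inv (2 ℕ.^ n))) ⟩
  ½ ^ n * (ι (2 ℕ.^ n) * inv (2 ℕ.^ n))       ≡⟨ sym (ℚₚ.*-assoc (½ ^ n) (ι (2 ℕ.^ n)) (inv (2 ℕ.^ n))) ⟩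
  ½ ^ n * ι (2 ℕ.^ n) * inv (2 ℕ.^ n)         ≡⟨ cong (_* inv (2 ℕ.^ n)) (go n) ⟩
  1ℚ * inv (2 ℕ.^ n)                          ≡⟨ ℚₚ.*-identityˡ _ ⟩
  inv (2 ℕ.^ n)                               ∎
  where
  open ≡-Reasoning
  go : ∀ n → ½ ^ n * ι (2 ℕ.^ n) ≡ 1ℚ
  go zero    = refl
  go (suc n) = begin
    ½ * ½ ^ n * ι (2 ℕ.* 2 ℕ.^ n)       ≡⟨ cong (½ * ½ ^ n *_) (ι-* 2 (2 ℕ.^ n)) ⟩
    ½ * ½ ^ n * (ι 2 * ι (2 ℕ.^ n))     ≡⟨ solve 2 (λ p m → con ½ :* p :* (con (ι 2) :* m) := p :* m) refl (½ ^ n) (ι (2 ℕ.^ n)) ⟩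
    ½ ^ n * ι (2 ℕ.^ n)                 ≡⟨ go n ⟩
    1ℚ                                  ∎

-- Division-free substitute for (1 - r)^j ≤ e^(-jr). Induction works because (1 - r)(1 + (j+1)r) =
-- (1 + jr) - (j+1)r².
bernoulli : ∀ {r} → 0ℚ ≤ r → r ≤ 1ℚ → ∀ j → (1ℚ - r) ^ j * (1ℚ + ι j * r) ≤ 1ℚ
bernoulli {r} h k zero = ℚₚ.≤-reflexive (solve 1 (λ r → con 1ℚ :* (con 1ℚ :+ con 0ℚ :* r) := con 1ℚ) refl r)
bernoulli {r} h k (suc j) = begin
  (1ℚ - r) * P * (1ℚ + ι (suc j) * r)     ≡⟨ cong (λ z → (1ℚ - r) * P * (1ℚ + z * r)) (ι-suc j) ⟩
  (1ℚ - r) * P * (1ℚ + (1ℚ + ι j) * r)    ≡⟨ solve 3 (λ r p m → (con 1ℚ :- r) :* p :* (con 1ℚ :+ (con 1ℚ :+ m) :* r)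
                                                  := p :* (con 1ℚ :+ m :* r) :- p :* ((con 1ℚ :+ m) :* (r :* r))) refl r P (ι j) ⟩
  P * (1ℚ + ι j * r) - P * ((1ℚ + ι j) * (r * r))
                                          ≤⟨ ≤-by (ℚₚ.≤-trans (0≤* (^-nonneg (0≤- k) j) (0≤* (0≤+ 0≤1 (ι≥0 j)) (0≤* h h)))
                                               (ℚₚ.≤-reflexive (solve 2 (λ a b → b := a :- (a :- b)) refl (P * (1ℚ + ι j * r)) _))) ⟩
  P * (1ℚ + ι j * r)                      ≤⟨ bernoulli h k j ⟩
  1ℚ                                      ∎
  where
  open ℚₚ.≤-Reasoning
  P = (1ℚ - r) ^ j

pow≤inv : ∀ {r} → 0ℚ ≤ r → r ≤ 1ℚ → ∀ j c .{{_ : ℕ.NonZero c}} → ι c ≤ 1ℚ + ι j * r → (1ℚ - r) ^ j ≤ inv c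
pow≤inv h k j c g = ≤inv c (ℚₚ.≤-trans (*-monoˡ _ (^-nonneg (0≤- k) j) g) (bernoulli h k j))

-- Either `r` is small or `q` failures in a row are unlikely, and the product is at most 1/q with no
-- knowledge of `r`. It bounds the error left by blocks that the search fails to find.
r*pow≤inv : ∀ {r} → 0ℚ ≤ r → r ≤ 1ℚ → ∀ q .{{_ : ℕ.NonZero q}} → r * (1ℚ - r) ^ q ≤ inv q
r*pow≤inv {r} h k q = ≤inv q (begin
  r * P * ι q           ≤⟨ ≤+ʳ (^-nonneg (0≤- k) q) ⟩
  r * P * ι q + P       ≡⟨ solve 3 (λ r p q → r :* p :* q :+ p := p :* (con 1ℚ :+ q :* r)) refl r P (ι q) ⟩
  P * (1ℚ + ι q * r)    ≤⟨ bernoulli h k q ⟩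
  1ℚ                    ∎)
  where
  open ℚₚ.≤-Reasoning
  P = (1ℚ - r) ^ q

-- Dictator testing

⊕-assoc : ∀ {n} (x y z : Vec Bool n) → (x ⊕ y) ⊕ z ≡ x ⊕ (y ⊕ z)
⊕-assoc []      []      []      = refl
⊕-assoc (a ∷ x) (b ∷ y) (c ∷ z) = cong₂ _∷_ (Boolₚ.xor-assoc a b c) (⊕-assoc x y z)

⊕-comm : ∀ {n} (x y : Vec Bool n) → x ⊕ y ≡ y ⊕ x
⊕-comm []      []      = refl
⊕-comm (a ∷ x) (b ∷ y) = cong₂ _∷_ (Boolₚ.xor-comm a b) (⊕-comm x y)

⊕-cancel : ∀ {n} (x y : Vec Bool n) → x ⊕ (x ⊕ y) ≡ y
⊕-cancel []          []      = refl
⊕-cancel (false ∷ x) (b ∷ y) = cong (b ∷_) (⊕-cancel x y)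
⊕-cancel (true ∷ x)  (b ∷ y) = cong₂ _∷_ (Boolₚ.not-involutive b) (⊕-cancel x y)

⊕-shuffle : ∀ {n} (x y z : Vec Bool n) → (x ⊕ y) ⊕ (x ⊕ z) ≡ y ⊕ z
⊕-shuffle x y z = begin
  (x ⊕ y) ⊕ (x ⊕ z)   ≡⟨ cong (_⊕ (x ⊕ z)) (⊕-comm x y) ⟩
  (y ⊕ x) ⊕ (x ⊕ z)   ≡⟨ ⊕-assoc y x (x ⊕ z) ⟩
  y ⊕ (x ⊕ (x ⊕ z))   ≡⟨ cong (y ⊕_) (⊕-cancel x z) ⟩
  y ⊕ z               ∎
  where open ≡-Reasoning

⊓-⊕-distribʳ : ∀ {n} (x y z : Vec Bool n) → (x ⊕ y) ⊓ z ≡ (x ⊓ z) ⊕ (y ⊓ z)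
⊓-⊕-distribʳ []      []      []      = refl
⊓-⊕-distribʳ (a ∷ x) (b ∷ y) (c ∷ z) = cong₂ _∷_ (Boolₚ.∧-distribʳ-xor c a b) (⊓-⊕-distribʳ x y z)

⊓-⊕-distribˡ : ∀ {n} (x y z : Vec Bool n) → x ⊓ (y ⊕ z) ≡ (x ⊓ y) ⊕ (x ⊓ z)
⊓-⊕-distribˡ []      []      []      = refl
⊓-⊕-distribˡ (a ∷ x) (b ∷ y) (c ∷ z) = cong₂ _∷_ (Boolₚ.∧-distribˡ-xor a b c) (⊓-⊕-distribˡ x y z)

xor-tri : ∀ a b c → ⟦ a xor c ⟧ ≤ ⟦ a xor b ⟧ + ⟦ b xor c ⟧
xor-tri true  true  true  = ℚₚ.≤ᵇ⇒≤ _
xor-tri true  true  false = ℚₚ.≤ᵇ⇒≤ _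
xor-tri true  false true  = ℚₚ.≤ᵇ⇒≤ _
xor-tri true  false false = ℚₚ.≤ᵇ⇒≤ _
xor-tri false true  true  = ℚₚ.≤ᵇ⇒≤ _
xor-tri false true  false = ℚₚ.≤ᵇ⇒≤ _
xor-tri false false true  = ℚₚ.≤ᵇ⇒≤ _
xor-tri false false false = ℚₚ.≤ᵇ⇒≤ _

xor-sub : ∀ a b → ⟦ a xor b ⟧ ≤ ⟦ a ⟧ + ⟦ b ⟧
xor-sub true  true  = ℚₚ.≤ᵇ⇒≤ _
xor-sub true  false = ℚₚ.≤ᵇ⇒≤ _
xor-sub false true  = ℚₚ.≤ᵇ⇒≤ _
xor-sub false false = ℚₚ.≤ᵇ⇒≤ _

xor-∧ : ∀ a b c d → ⟦ (a ∧ b) xor (c ∧ d) ⟧ ≤ ⟦ a xor c ⟧ + ⟦ b xor d ⟧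
xor-∧ true  b true  d = ≤+ˡ ℚₚ.≤-refl
xor-∧ false b false d = 0≤+ ℚₚ.≤-refl (⟦⟧≥0 (b xor d))
xor-∧ true  b false d = ℚₚ.≤-trans (⟦⟧≤1 (b xor false)) (≤+ʳ (⟦⟧≥0 (b xor d)))
xor-∧ false b true  d = ℚₚ.≤-trans (⟦⟧≤1 d) (≤+ʳ (⟦⟧≥0 (b xor d)))

⟦not⟧ : ∀ a → ⟦ not a ⟧ ≡ 1ℚ - ⟦ a ⟧
⟦not⟧ true  = refl
⟦not⟧ false = refl

small⇒false : ∀ {b p} → ⟦ b ⟧ ≤ p → p < 1ℚ → b ≡ false
small⇒false {false} h k = refl
small⇒false {true}  h k = ⊥-elim (ℚₚ.<-irrefl refl (ℚₚ.≤-<-trans h k))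

xor≡false : ∀ a b → a xor b ≡ false → a ≡ b
xor≡false true  true  h = refl
xor≡false false false h = refl

xor-interchange : ∀ a b c d → (a xor b) xor (c xor d) ≡ (a xor c) xor (b xor d)
xor-interchange a b c d = begin
  (a xor b) xor (c xor d)   ≡⟨ Boolₚ.xor-assoc a b (c xor d) ⟩
  a xor (b xor (c xor d))   ≡⟨ cong (a xor_) (sym (Boolₚ.xor-assoc b c d)) ⟩
  a xor ((b xor c) xor d)   ≡⟨ cong (λ e → a xor (e xor d)) (Boolₚ.xor-comm b c) ⟩
  a xor ((c xor b) xor d)   ≡⟨ cong (a xor_) (Boolₚ.xor-assoc c b d) ⟩
  a xor (c xor (b xor d))   ≡⟨ sym (Boolₚ.xor-assoc a c (b xor d)) ⟩
  (a xor c) xor (b xor d)   ∎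
  where open ≡-Reasoning

IsRingHom : ∀ {n} → (Vec Bool n → Bool) → Set
IsRingHom {n} h = (∀ x y → h (x ⊕ y) ≡ h x xor h y) × (∀ x y → h (x ⊓ y) ≡ h x ∧ h y) × h (replicate n true) ≡ true

⊕-self : ∀ {n} (x : Vec Bool n) → x ⊕ x ≡ replicate n false
⊕-self []          = refl
⊕-self (false ∷ x) = cong (false ∷_) (⊕-self x)
⊕-self (true ∷ x)  = cong (false ∷_) (⊕-self x)

⊕-zeroˡ : ∀ {n} (x : Vec Bool n) → replicate n false ⊕ x ≡ x
⊕-zeroˡ []      = refl
⊕-zeroˡ (a ∷ x) = cong (a ∷_) (⊕-zeroˡ x)

⊓-zeroʳ : ∀ {n} (x : Vec Bool n) → x ⊓ replicate n false ≡ replicate n false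
⊓-zeroʳ []      = refl
⊓-zeroʳ (a ∷ x) = cong₂ _∷_ (Boolₚ.∧-zeroʳ a) (⊓-zeroʳ x)

ringHom⇒lookup : ∀ {n} (h : Vec Bool n → Bool) → IsRingHom h → Σ (Fin n) λ i → ∀ x → h x ≡ lookup x i
ringHom⇒lookup {zero} h (add , _ , one) with () ←
  trans (sym one) (trans (add [] []) (Boolₚ.xor-same (h [])))
ringHom⇒lookup {suc n} h (add , mul , one) = go (h e) refl
  where
  open ≡-Reasoning
  O = replicate n false
  e = true ∷ O
  h0 : h (false ∷ O) ≡ false
  h0 = trans (cong h (sym (⊕-self (false ∷ O)))) (trans (add _ _) (Boolₚ.xor-same (h (false ∷ O))))
  split : ∀ a x → h (a ∷ x) ≡ h (a ∷ O) xor h (false ∷ x)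
  split a x = trans (cong h (sym (cong₂ _∷_ (Boolₚ.xor-identityʳ a) (⊕-zeroˡ x)))) (add (a ∷ O) (false ∷ x))
  go : ∀ b → h e ≡ b → Σ (Fin (suc n)) λ i → ∀ x → h x ≡ lookup x i
  go true he = Fin.zero , λ where
      (true ∷ x)  → trans (side true x) he
      (false ∷ x) → trans (side false x) h0
    where
    side : ∀ a x → h (a ∷ x) ≡ h (a ∷ O)
    side a x = begin
      h (a ∷ x)          ≡⟨ sym (Boolₚ.∧-identityʳ _) ⟩
      h (a ∷ x) ∧ true   ≡⟨ cong (h (a ∷ x) ∧_) (sym he) ⟩
      h (a ∷ x) ∧ h e    ≡⟨ sym (mul (a ∷ x) e) ⟩
      h ((a ∷ x) ⊓ e)    ≡⟨ cong h (cong₂ _∷_ (Boolₚ.∧-identityʳ a) (⊓-zeroʳ x)) ⟩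
      h (a ∷ O)          ∎
  go false he =
    let i , eq = ringHom⇒lookup (λ x → h (false ∷ x))
          ( (λ x y → add (false ∷ x) (false ∷ y))
          , (λ x y → mul (false ∷ x) (false ∷ y))
          , trans (sym (trans (split true (replicate n true)) (cong (_xor h (false ∷ replicate n true)) he))) one)
    in Fin.suc i , λ where
      (true ∷ x)  → trans (split true x) (trans (cong (_xor h (false ∷ x)) he) (eq x))
      (false ∷ x) → eq x

-- β(x,y) = h(x⊓y) + h(x)h(y) is bilinear for additive h, so each of its values is the sum of
-- four of its values at uniformly distributed points: rarely nonzero means identically zero.
near-multiplicative : ∀ {n} (h : Vec Bool n → Bool) → (∀ x y → h (x ⊕ y) ≡ h x xor h y) → ∀ {k} →
  M n (λ x → M n λ y → ⟦ h (x ⊓ y) xor (h x ∧ h y) ⟧) ≤ k → (k + k) + (k + k) < 1ℚ →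
  ∀ x y → h (x ⊓ y) ≡ h x ∧ h y
near-multiplicative {n} h additive mean≤ 4k<1 = multiplicative
  where
  open ℚₚ.≤-Reasoning
  H : Vec Bool n → Vec Bool n → Bool
  H x y = h (x ⊓ y) xor (h x ∧ h y)

  H-addˡ : ∀ x x′ y → H (x ⊕ x′) y ≡ H x y xor H x′ y
  H-addˡ x x′ y rewrite ⊓-⊕-distribʳ x x′ y | additive (x ⊓ y) (x′ ⊓ y) | additive x x′
    | Boolₚ.∧-distribʳ-xor (h y) (h x) (h x′) = xor-interchange (h (x ⊓ y)) (h (x′ ⊓ y)) (h x ∧ h y) (h x′ ∧ h y)

  H-addʳ : ∀ x y y′ → H x (y ⊕ y′) ≡ H x y xor H x y′
  H-addʳ x y y′ rewrite ⊓-⊕-distribˡ x y y′ | additive (x ⊓ y) (x ⊓ y′) | additive y y′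
    | Boolₚ.∧-distribˡ-xor (h x) (h y) (h y′) = xor-interchange (h (x ⊓ y)) (h (x ⊓ y′)) (h x ∧ h y) (h x ∧ h y′)

  multiplicative : ∀ x y → h (x ⊓ y) ≡ h x ∧ h y
  multiplicative a b = xor≡false _ _ (small⇒false (begin
    ⟦ H a b ⟧    ≡⟨ sym (trans (M-cong n λ x → M-const n _) (M-const n _)) ⟩
    M n (λ x → M n λ y → ⟦ H a b ⟧)
      ≤⟨ M-≤-+ n (λ x → M-≤-+ n λ y → ptw x y) ⟩
    M n (λ x → M n λ y → ⟦ H (a ⊕ x) (b ⊕ y) ⟧ + ⟦ H (a ⊕ x) y ⟧) + M n (λ x → M n λ y → ⟦ H x (b ⊕ y) ⟧ + ⟦ H x y ⟧)
      ≤⟨ ℚₚ.+-mono-≤ (M-≤-+ n λ x → M-≤-+ n λ y → ℚₚ.≤-refl) (M-≤-+ n λ x → M-≤-+ n λ y → ℚₚ.≤-refl) ⟩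
    (M n (λ x → M n λ y → ⟦ H (a ⊕ x) (b ⊕ y) ⟧) + M n (λ x → M n λ y → ⟦ H (a ⊕ x) y ⟧))
      + (M n (λ x → M n λ y → ⟦ H x (b ⊕ y) ⟧) + M n (λ x → M n λ y → ⟦ H x y ⟧))
      ≡⟨ cong₂ _+_ (cong₂ _+_ (trans (M-cong n λ x → M-⊕ n b (λ y → ⟦ H (a ⊕ x) y ⟧)) (M-⊕ n a (λ x → M n λ y → ⟦ H x y ⟧)))
                              (M-⊕ n a (λ x → M n λ y → ⟦ H x y ⟧)))
                   (cong (_+ K) (M-cong n λ x → M-⊕ n b (λ y → ⟦ H x y ⟧))) ⟩
    (K + K) + (K + K)  ≤⟨ ℚₚ.+-mono-≤ (ℚₚ.+-mono-≤ mean≤ mean≤) (ℚₚ.+-mono-≤ mean≤ mean≤) ⟩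
    _                  ∎) 4k<1)
    where
    K : ℚ
    K = M n λ x → M n λ y → ⟦ H x y ⟧
    expand : ∀ x y → H a b ≡ (H (a ⊕ x) (b ⊕ y) xor H (a ⊕ x) y) xor (H x (b ⊕ y) xor H x y)
    expand x y rewrite H-addʳ (a ⊕ x) b y | H-addʳ x b y | H-addˡ a x b | H-addˡ a x y =
      lem (H a b) (H x b) (H a y) (H x y)
      where
      lem₁ : ∀ p q → (p xor q) xor q ≡ p
      lem₁ p q = trans (Boolₚ.xor-assoc p q q) (trans (cong (p xor_) (Boolₚ.xor-same q)) (Boolₚ.xor-identityʳ p))
      lem : ∀ p q r s → p ≡ (((p xor q) xor (r xor s)) xor (r xor s)) xor ((q xor s) xor s)
      lem p q r s rewrite lem₁ (p xor q) (r xor s) | lem₁ q s | lem₁ p q = refl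
    ptw : ∀ x y → ⟦ H a b ⟧ ≤ (⟦ H (a ⊕ x) (b ⊕ y) ⟧ + ⟦ H (a ⊕ x) y ⟧) + (⟦ H x (b ⊕ y) ⟧ + ⟦ H x y ⟧)
    ptw x y = ℚₚ.≤-trans (ℚₚ.≤-reflexive (cong ⟦_⟧ (expand x y)))
      (ℚₚ.≤-trans (xor-sub (H (a ⊕ x) (b ⊕ y) xor H (a ⊕ x) y) _)
        (ℚₚ.+-mono-≤ (xor-sub (H (a ⊕ x) (b ⊕ y)) _) (xor-sub (H x (b ⊕ y)) _)))

module Dictator {n : ℕ} (φ : Vec Bool n → Bool) where

  -- The derivative of `φ` in direction `x` at `z`. A dictator and its negation have the same
  -- derivative, namely the hidden coordinate of `x`; a random `z` makes it a self-corrector.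
  D : Vec Bool n → Vec Bool n → Bool
  D x z = φ (x ⊕ z) xor φ z

  -- The linearity test of Blum, Luby and Rubinfeld in affine form, which is invariant under
  -- negating `φ`.
  affineFails : Vec Bool n → Vec Bool n → Vec Bool n → Bool
  affineFails a b c = (φ a xor φ b) xor (φ c xor φ ((a ⊕ b) ⊕ c))

  -- The point `x ⊓ y` is not uniform, so `φ` may be wrong exactly there. Each of the three values
  -- is therefore self-corrected with its own random shift.
  andFails : (x y z₁ z₂ z₃ : Vec Bool n) → Bool
  andFails x y z₁ z₂ z₃ = D (x ⊓ y) z₁ xor (D x z₂ ∧ D y z₃)

  oneFails : Vec Bool n → Bool
  oneFails z = not (D (replicate n true) z)

  affineErr andErr oneErr : ℚ
  affineErr = M n λ a → M n λ b → M n λ c → ⟦ affineFails a b c ⟧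
  andErr = M n λ x → M n λ y → M n λ z₁ → M n λ z₂ → M n λ z₃ → ⟦ andFails x y z₁ z₂ z₃ ⟧
  oneErr = M n λ z → ⟦ oneFails z ⟧

  private
    p : Vec Bool n → ℚ
    p x = M n λ z → ⟦ D x z ⟧

    h : Vec Bool n → Bool
    h x = does (½ ℚₚ.≤? p x)

    err : Vec Bool n → ℚ
    err x = M n λ z → ⟦ D x z xor h x ⟧

    -- The two affine tests share the point `u` and, since (x ⊕ y) ⊕ (x ⊕ z) = y ⊕ z, also their
    -- fourth point. These cancel in the sum of the tests and leave the difference of the two
    -- derivatives.
    D-pair : ∀ x y z u → ⟦ D x y xor D x z ⟧ ≤ ⟦ affineFails (x ⊕ y) (x ⊕ z) u ⟧ + ⟦ affineFails y z u ⟧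
    D-pair x y z u rewrite ⊕-shuffle x y z = begin
        ⟦ (A xor B) xor (C xor D′) ⟧                                 ≡⟨ cong ⟦_⟧ (eq A B C D′ U V) ⟩
        ⟦ ((A xor C) xor (U xor V)) xor ((B xor D′) xor (U xor V)) ⟧ ≤⟨ xor-sub ((A xor C) xor (U xor V)) _ ⟩
        ⟦ (A xor C) xor (U xor V) ⟧ + ⟦ (B xor D′) xor (U xor V) ⟧   ∎
      where
      open ℚₚ.≤-Reasoning
      A = φ (x ⊕ y) ; B = φ y ; C = φ (x ⊕ z) ; D′ = φ z ; U = φ u ; V = φ ((y ⊕ z) ⊕ u)
      canc : ∀ p q w → p xor q ≡ (p xor w) xor (q xor w)
      canc p q w = trans (sym (Boolₚ.xor-identityʳ (p xor q)))
        (trans (cong ((p xor q) xor_) (sym (Boolₚ.xor-same w))) (xor-interchange p q w w))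
      eq : ∀ a b c d u v → (a xor b) xor (c xor d) ≡ ((a xor c) xor (u xor v)) xor ((b xor d) xor (u xor v))
      eq a b c d u v = trans (xor-interchange a b c d) (canc (a xor c) (b xor d) (u xor v))

    pair-err : ∀ x → M n (λ y → M n λ z → ⟦ D x y xor D x z ⟧) ≤ affineErr + affineErr
    pair-err x = begin
      M n (λ y → M n λ z → ⟦ D x y xor D x z ⟧)
        ≡⟨ M-cong n (λ y → M-cong n λ z → sym (M-const n _)) ⟩
      M n (λ y → M n λ z → M n λ u → ⟦ D x y xor D x z ⟧)
        ≤⟨ M-mono n (λ y → M-mono n λ z → M-≤-+ n (D-pair x y z)) ⟩
      M n (λ y → M n λ z → F (x ⊕ y) (x ⊕ z) + F y z)
        ≤⟨ M-≤-+ n (λ y → M-≤-+ n (λ z → ℚₚ.≤-refl)) ⟩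
      M n (λ y → M n λ z → F (x ⊕ y) (x ⊕ z)) + affineErr
        ≡⟨ cong (_+ affineErr) (trans (M-cong n (λ y → M-⊕ n x (F (x ⊕ y)))) (M-⊕ n x (λ y → M n (F y)))) ⟩
      affineErr + affineErr ∎
      where
      open ℚₚ.≤-Reasoning
      F : Vec Bool n → Vec Bool n → ℚ
      F a b = M n λ u → ⟦ affineFails a b u ⟧

    pair-p : ∀ x → M n (λ y → M n λ z → ⟦ D x y xor D x z ⟧) ≡ p x + p x - (p x * p x + p x * p x)
    pair-p x = begin
      M n (λ y → M n λ z → ⟦ D x y xor D x z ⟧)   ≡⟨ M-cong n (λ y → inner (D x y)) ⟩
      M n (λ y → P + (1ℚ - (P + P)) * ⟦ D x y ⟧)  ≡⟨ trans (M-+ˡ n P (λ y → (1ℚ - (P + P)) * ⟦ D x y ⟧)) (cong (P +_) (M-* n (1ℚ - (P + P)) (λ y → ⟦ D x y ⟧))) ⟩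
      P + (1ℚ - (P + P)) * P                      ≡⟨ solve 1 (λ p → p :+ (con 1ℚ :- (p :+ p)) :* p := p :+ p :- (p :* p :+ p :* p)) refl P ⟩
      P + P - (P * P + P * P)                     ∎
      where
      open ≡-Reasoning
      P = p x
      inner : ∀ b → M n (λ z → ⟦ b xor D x z ⟧) ≡ P + (1ℚ - (P + P)) * ⟦ b ⟧
      inner false = solve 1 (λ p → p := p :+ (con 1ℚ :- (p :+ p)) :* con 0ℚ) refl P
      inner true  = begin
        M n (λ z → ⟦ not (D x z) ⟧)       ≡⟨ M-cong n (λ z → ⟦not⟧ (D x z)) ⟩
        M n (λ z → 1ℚ - ⟦ D x z ⟧)        ≡⟨ M-1- n (λ z → ⟦ D x z ⟧) ⟩
        1ℚ - P                            ≡⟨ solve 1 (λ p → con 1ℚ :- p := p :+ (con 1ℚ :- (p :+ p)) :* con 1ℚ) refl P ⟩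
        P + (1ℚ - (P + P)) * 1ℚ           ∎

    -- The error e of the majority bit is at most 1/2, hence e ≤ 2e(1 - e). The right side is the
    -- probability that two independent samples of `D x` differ, which `pair-err` controls.
    err-of : ∀ x (d : Dec (½ ≤ p x)) → M n (λ z → ⟦ D x z xor does d ⟧) ≤ affineErr + affineErr
    err-of x (yes ½≤p) = begin
        M n (λ z → ⟦ D x z xor true ⟧)   ≡⟨ M-cong n (λ z → trans (cong ⟦_⟧ (Boolₚ.xor-comm (D x z) true)) (⟦not⟧ (D x z))) ⟩
        M n (λ z → 1ℚ - ⟦ D x z ⟧)       ≡⟨ M-1- n (λ z → ⟦ D x z ⟧) ⟩
        1ℚ - P                           ≤⟨ ≤-by (ℚₚ.≤-trans (0≤* (0≤+ (0≤- ½≤p) (0≤- ½≤p)) (0≤- p≤1))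
                                              (ℚₚ.≤-reflexive (solve 1 (λ p → ((p :- con ½) :+ (p :- con ½)) :* (con 1ℚ :- p)
                                                 := (p :+ p :- (p :* p :+ p :* p)) :- (con 1ℚ :- p)) refl P))) ⟩
        P + P - (P * P + P * P)          ≡⟨ sym (pair-p x) ⟩
        M n (λ y → M n λ z → ⟦ D x y xor D x z ⟧) ≤⟨ pair-err x ⟩
        affineErr + affineErr            ∎
      where
      open ℚₚ.≤-Reasoning
      P = p x
      p≤1 : P ≤ 1ℚ
      p≤1 = M-≤ n (λ z → ⟦⟧≤1 (D x z))
    err-of x (no ½≰p) = begin
        M n (λ z → ⟦ D x z xor false ⟧)  ≡⟨ M-cong n (λ z → cong ⟦_⟧ (Boolₚ.xor-identityʳ (D x z))) ⟩
        P                                ≤⟨ ≤-by (ℚₚ.≤-trans (0≤* (0≤+ (0≤- p≤½) (0≤- p≤½)) p≥0)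
                                              (ℚₚ.≤-reflexive (solve 1 (λ p → ((con ½ :- p) :+ (con ½ :- p)) :* p
                                                 := (p :+ p :- (p :* p :+ p :* p)) :- p) refl P))) ⟩
        P + P - (P * P + P * P)          ≡⟨ sym (pair-p x) ⟩
        M n (λ y → M n λ z → ⟦ D x y xor D x z ⟧) ≤⟨ pair-err x ⟩
        affineErr + affineErr            ∎
      where
      open ℚₚ.≤-Reasoning
      P = p x
      p≤½ : P ≤ ½
      p≤½ = ℚₚ.<⇒≤ (ℚₚ.≰⇒> ½≰p)
      p≥0 : 0ℚ ≤ P
      p≥0 = M-nonneg n (λ z → ⟦⟧≥0 (D x z))

    err≤ : ∀ x → err x ≤ affineErr + affineErr
    err≤ x = err-of x (½ ℚₚ.≤? p x)

  -- The ring identities for the majority `h` do not mention the random points, so a mean violation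
  -- below 1 excludes any violation. The thresholds serve this: with θ = 1/48 they give 3θ < 1 for
  -- additivity, 4(1/8 + 3θ) = 3/4 for multiplicativity and 1/2 + θ < 1 for the unit. The conclusion
  -- keeps the true `affineErr`, because many bits are decoded at once later and 1/48 each would be
  -- too coarse.
  dictator : affineErr ≤ inv 96 → andErr ≤ inv 8 → oneErr ≤ ½ →
    Σ (Fin n) λ i → ∀ x → M n (λ z → ⟦ D x z xor lookup x i ⟧) ≤ affineErr + affineErr
  dictator aff≤ and≤ one≤ =
    let i , eq = ringHom⇒lookup h (additive , multiplicative , unit)
    in i , λ x → subst (λ b → M n (λ z → ⟦ D x z xor b ⟧) ≤ affineErr + affineErr) (eq x) (err≤ x)
    where
    open ℚₚ.≤-Reasoning
    θ : ℚ
    θ = inv 96 + inv 96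
    err≤θ : ∀ x → err x ≤ θ
    err≤θ x = ℚₚ.≤-trans (err≤ x) (ℚₚ.+-mono-≤ aff≤ aff≤)

    additive : ∀ x y → h (x ⊕ y) ≡ h x xor h y
    additive x y = xor≡false _ _ (small⇒false (begin
      ⟦ h (x ⊕ y) xor (h x xor h y) ⟧       ≡⟨ sym (M-const n _) ⟩
      M n (λ z → ⟦ h (x ⊕ y) xor (h x xor h y) ⟧)
        ≤⟨ M-≤-+ n (λ z → ptw z) ⟩
      err (x ⊕ y) + M n (λ z → ⟦ D x (y ⊕ z) xor h x ⟧ + ⟦ D y z xor h y ⟧)
        ≡⟨ cong (err (x ⊕ y) +_) (trans (M-+ n (λ z → ⟦ D x (y ⊕ z) xor h x ⟧) (λ z → ⟦ D y z xor h y ⟧)) (cong (_+ err y) (M-⊕ n y (λ z → ⟦ D x z xor h x ⟧)))) ⟩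
      err (x ⊕ y) + (err x + err y)         ≤⟨ ℚₚ.+-mono-≤ (err≤θ (x ⊕ y)) (ℚₚ.+-mono-≤ (err≤θ x) (err≤θ y)) ⟩
      θ + (θ + θ)                           ∎) (from-yes ((θ + (θ + θ)) ℚₚ.<? 1ℚ)))
      where
      D-split : ∀ z → D (x ⊕ y) z ≡ D x (y ⊕ z) xor D y z
      D-split z rewrite ⊕-assoc x y z = lem (φ (x ⊕ (y ⊕ z))) (φ (y ⊕ z)) (φ z)
        where
        lem : ∀ a b c → a xor c ≡ (a xor b) xor (b xor c)
        lem a true  true  = sym (trans (Boolₚ.xor-identityʳ _) refl)
        lem true  true  false = refl
        lem false true  false = refl
        lem a false c = cong (_xor c) (sym (Boolₚ.xor-identityʳ a))
      ptw : ∀ z → ⟦ h (x ⊕ y) xor (h x xor h y) ⟧ ≤ ⟦ D (x ⊕ y) z xor h (x ⊕ y) ⟧ + (⟦ D x (y ⊕ z) xor h x ⟧ + ⟦ D y z xor h y ⟧)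
      ptw z = begin
        ⟦ H xor (h x xor h y) ⟧                                            ≤⟨ xor-tri H (D (x ⊕ y) z) _ ⟩
        ⟦ H xor D (x ⊕ y) z ⟧ + ⟦ D (x ⊕ y) z xor (h x xor h y) ⟧          ≡⟨ cong₂ (λ u v → ⟦ u ⟧ + ⟦ v ⟧) (Boolₚ.xor-comm H _)
                                                                                 (trans (cong (_xor (h x xor h y)) (D-split z)) (xor-interchange (D x (y ⊕ z)) (D y z) (h x) (h y))) ⟩
        ⟦ D (x ⊕ y) z xor H ⟧ + ⟦ (D x (y ⊕ z) xor h x) xor (D y z xor h y) ⟧ ≤⟨ ℚₚ.+-monoʳ-≤ ⟦ D (x ⊕ y) z xor H ⟧ (xor-sub (D x (y ⊕ z) xor h x) (D y z xor h y)) ⟩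
        ⟦ D (x ⊕ y) z xor H ⟧ + (⟦ D x (y ⊕ z) xor h x ⟧ + ⟦ D y z xor h y ⟧) ∎
        where
        H = h (x ⊕ y)

    H : Vec Bool n → Vec Bool n → Bool
    H x y = h (x ⊓ y) xor (h x ∧ h y)

    meanH : M n (λ x → M n λ y → ⟦ H x y ⟧) ≤ inv 8 + (θ + (θ + θ))
    meanH = begin
      M n (λ x → M n λ y → ⟦ H x y ⟧)
        ≡⟨ M-cong n (λ x → M-cong n λ y → sym (trans (M-cong n λ z₁ → trans (M-cong n λ z₂ → M-const n _) (M-const n _)) (M-const n _))) ⟩
      M n (λ x → M n λ y → M n λ z₁ → M n λ z₂ → M n λ z₃ → ⟦ H x y ⟧)
        ≤⟨ M-≤-+ n (λ x → M-≤-+ n λ y → M-≤-+ n λ z₁ → M-≤-+ n λ z₂ → M-≤-+ n λ z₃ → ptw x y z₁ z₂ z₃) ⟩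
      andErr + M n (λ x → M n λ y → M n λ z₁ → M n λ z₂ → M n λ z₃ → R x y z₁ z₂ z₃)
        ≤⟨ ℚₚ.+-mono-≤ and≤ (M-≤ n λ x → M-≤ n λ y → rest x y) ⟩
      inv 8 + (θ + (θ + θ)) ∎
      where
      R : (x y z₁ z₂ z₃ : Vec Bool n) → ℚ
      R x y z₁ z₂ z₃ = ⟦ D (x ⊓ y) z₁ xor h (x ⊓ y) ⟧ + (⟦ D x z₂ xor h x ⟧ + ⟦ D y z₃ xor h y ⟧)
      rest : ∀ x y → M n (λ z₁ → M n λ z₂ → M n λ z₃ → R x y z₁ z₂ z₃) ≤ θ + (θ + θ)
      rest x y = begin
        M n (λ z₁ → M n λ z₂ → M n λ z₃ → R x y z₁ z₂ z₃)
          ≡⟨ M-cong n (λ z₁ → trans (M-cong n λ z₂ →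
                trans (M-+ˡ n (e₁ z₁) (λ z₃ → e₂ z₂ + e₃ z₃)) (cong (e₁ z₁ +_) (M-+ˡ n (e₂ z₂) e₃)))
              (trans (M-+ˡ n (e₁ z₁) (λ z₂ → e₂ z₂ + M n e₃)) (cong (e₁ z₁ +_) (M-+ʳ n e₂ (M n e₃))))) ⟩
        M n (λ z₁ → e₁ z₁ + (err x + err y))
          ≡⟨ M-+ʳ n e₁ (err x + err y) ⟩
        err (x ⊓ y) + (err x + err y)   ≤⟨ ℚₚ.+-mono-≤ (err≤θ (x ⊓ y)) (ℚₚ.+-mono-≤ (err≤θ x) (err≤θ y)) ⟩
        θ + (θ + θ)                     ∎
        where
        e₁ e₂ e₃ : Vec Bool n → ℚ
        e₁ z = ⟦ D (x ⊓ y) z xor h (x ⊓ y) ⟧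
        e₂ z = ⟦ D x z xor h x ⟧
        e₃ z = ⟦ D y z xor h y ⟧
      ptw : ∀ x y z₁ z₂ z₃ → ⟦ H x y ⟧ ≤ ⟦ andFails x y z₁ z₂ z₃ ⟧ + R x y z₁ z₂ z₃
      ptw x y z₁ z₂ z₃ = begin
        ⟦ h (x ⊓ y) xor (h x ∧ h y) ⟧            ≤⟨ xor-tri (h (x ⊓ y)) (D (x ⊓ y) z₁) _ ⟩
        ⟦ h (x ⊓ y) xor D (x ⊓ y) z₁ ⟧ + ⟦ D (x ⊓ y) z₁ xor (h x ∧ h y) ⟧
          ≤⟨ ℚₚ.+-mono-≤ (ℚₚ.≤-reflexive (cong ⟦_⟧ (Boolₚ.xor-comm (h (x ⊓ y)) _)))
               (ℚₚ.≤-trans (xor-tri (D (x ⊓ y) z₁) (D x z₂ ∧ D y z₃) (h x ∧ h y)) (ℚₚ.+-monoʳ-≤ ⟦ andFails x y z₁ z₂ z₃ ⟧ (xor-∧ (D x z₂) (D y z₃) (h x) (h y)))) ⟩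
        ⟦ D (x ⊓ y) z₁ xor h (x ⊓ y) ⟧ + (⟦ andFails x y z₁ z₂ z₃ ⟧ + (⟦ D x z₂ xor h x ⟧ + ⟦ D y z₃ xor h y ⟧))
          ≡⟨ solve 3 (λ a b c → a :+ (b :+ c) := b :+ (a :+ c)) refl ⟦ D (x ⊓ y) z₁ xor h (x ⊓ y) ⟧ ⟦ andFails x y z₁ z₂ z₃ ⟧ (⟦ D x z₂ xor h x ⟧ + ⟦ D y z₃ xor h y ⟧) ⟩
        ⟦ andFails x y z₁ z₂ z₃ ⟧ + R x y z₁ z₂ z₃ ∎

    multiplicative : ∀ x y → h (x ⊓ y) ≡ h x ∧ h y
    multiplicative = near-multiplicative h additive meanH
      (from-yes ((((inv 8 + (θ + (θ + θ))) + (inv 8 + (θ + (θ + θ)))) + ((inv 8 + (θ + (θ + θ))) + (inv 8 + (θ + (θ + θ))))) ℚₚ.<? 1ℚ))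

    unit : h (replicate n true) ≡ true
    unit = trans (sym (Boolₚ.not-involutive _)) (cong not (small⇒false {not (h I)} (begin
      ⟦ not (h I) ⟧   ≡⟨ sym (M-const n _) ⟩
      M n (λ z → ⟦ not (h I) ⟧)   ≤⟨ M-≤-+ n (λ z → ptw (h I) (D I z)) ⟩
      oneErr + err I  ≤⟨ ℚₚ.+-mono-≤ one≤ (err≤θ I) ⟩
      ½ + θ           ∎) (from-yes ((½ + θ) ℚₚ.<? 1ℚ))))
      where
      I = replicate n true
      ptw : ∀ a b → ⟦ not a ⟧ ≤ ⟦ not b ⟧ + ⟦ b xor a ⟧
      ptw true  true  = ℚₚ.≤ᵇ⇒≤ _
      ptw true  false = ℚₚ.≤ᵇ⇒≤ _
      ptw false true  = ℚₚ.≤ᵇ⇒≤ _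
      ptw false false = ℚₚ.≤ᵇ⇒≤ _

-- Circuits and substitution

module _ {n n′ : ℕ} (σ : Fin n → Fin n′ ⊎ Bool) where

  substWire : ∀ {m} → Wire n m → Wire n′ m
  substWire (inj₁ i) = [ inj₁ , (λ b → inj₂ (inj₁ b)) ]′ (σ i)
  substWire (inj₂ w) = inj₂ w

  substGate : ∀ {m} → Gate n m → Gate n′ m
  substGate (AND ws) = AND (List.map substWire ws)
  substGate (OR ws)  = OR (List.map substWire ws)
  substGate (NOT w)  = NOT (substWire w)

  substGates : ∀ {m} → Gates n m → Gates n′ m
  substGates []       = []
  substGates (gs ▷ g) = substGates gs ▷ substGate g

  -- Constants are wires, not gates, so the gate count is unchanged. Both directions need this:
  -- completeness restricts f to the found blocks, soundness plugs decoded variables into a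
  -- hypothesis.
  substCircuit : ∀ {m} → Circuit n m → Circuit n′ m
  substCircuit (circuit gs r) = circuit (substGates gs) (substWire r)

  substInput : Input n′ → Input n
  substInput y = tabulate λ i → [ lookup y , id ]′ (σ i)

  module _ (y : Input n′) where

    wireVal-subst : ∀ {m} (vs : Vec Bool m) w → wireVal y vs (substWire w) ≡ wireVal (substInput y) vs w
    wireVal-subst vs (inj₂ (inj₁ b)) = refl
    wireVal-subst vs (inj₂ (inj₂ j)) = refl
    wireVal-subst vs (inj₁ i) rewrite Vecₚ.lookup∘tabulate (λ i → [ lookup y , id ]′ (σ i)) i with σ i
    ... | inj₁ j = refl
    ... | inj₂ b = refl

    gateVal-subst : ∀ {m} (vs : Vec Bool m) g → gateVal y vs (substGate g) ≡ gateVal (substInput y) vs g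
    gateVal-subst vs (AND ws) = go ws
      where
      go : ∀ ws → all (wireVal y vs) (List.map substWire ws) ≡ all (wireVal (substInput y) vs) ws
      go []       = refl
      go (w ∷ ws) = cong₂ _∧_ (wireVal-subst vs w) (go ws)
    gateVal-subst vs (OR ws) = go ws
      where
      go : ∀ ws → any (wireVal y vs) (List.map substWire ws) ≡ any (wireVal (substInput y) vs) ws
      go []       = refl
      go (w ∷ ws) = cong₂ _∨_ (wireVal-subst vs w) (go ws)
    gateVal-subst vs (NOT w) = cong not (wireVal-subst vs w)

    gateVals-subst : ∀ {m} (gs : Gates n m) → gateVals (substGates gs) y ≡ gateVals gs (substInput y)
    gateVals-subst []       = refl
    gateVals-subst (gs ▷ g) rewrite gateVals-subst gs = cong (gateVals gs (substInput y) ∷ʳ_) (gateVal-subst _ g)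

    eval-subst : ∀ {m} (C : Circuit n m) → eval (substCircuit C) y ≡ eval C (substInput y)
    eval-subst (circuit gs r) rewrite gateVals-subst gs = wireVal-subst _ r

-- `allInputs` interleaves the inputs starting with `false` and with `true`; the sum is regrouped by
-- the leading bit, as `M` averages.
ι-disagree : ∀ {n} (f g : BoolFn n) → ι (2 ℕ.^ n) * M n (λ x → ⟦ f x xor g x ⟧) ≡ ι (disagree f g)
ι-disagree {n} f g = go n (λ x → f x xor g x)
  where
  open ≡-Reasoning
  cnt : ∀ {A : Set} → (A → Bool) → List A → ℕ
  cnt p xs = sum (List.map (λ x → if p x then 1 else 0) xs)
  ι-if : ∀ b → ⟦ b ⟧ ≡ ι (if b then 1 else 0)
  ι-if true  = refl
  ι-if false = refl
  split : ∀ {n} (p : Vec Bool (suc n) → Bool) xs →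
    cnt p (concatMap (λ x → (false ∷ x) ∷ (true ∷ x) ∷ []) xs) ≡ cnt (p ∘ (false ∷_)) xs ℕ.+ cnt (p ∘ (true ∷_)) xs
  split p []       = refl
  split p (x ∷ xs) = trans (cong (λ e → a ℕ.+ (b ℕ.+ e)) (split p xs)) (lem a b _ _)
    where
    a = if p (false ∷ x) then 1 else 0
    b = if p (true ∷ x) then 1 else 0
    lem : ∀ a b c d → a ℕ.+ (b ℕ.+ (c ℕ.+ d)) ≡ (a ℕ.+ c) ℕ.+ (b ℕ.+ d)
    lem a b c d = trans (cong (a ℕ.+_) (trans (sym (ℕₚ.+-assoc b c d)) (trans (cong (ℕ._+ d) (ℕₚ.+-comm b c)) (ℕₚ.+-assoc c b d)))) (sym (ℕₚ.+-assoc a c (b ℕ.+ d)))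
  go : ∀ n (p : Vec Bool n → Bool) → ι (2 ℕ.^ n) * M n (λ x → ⟦ p x ⟧) ≡ ι (cnt p (allInputs n))
  go zero p = trans (ℚₚ.*-identityˡ _) (trans (ι-if (p [])) (cong ι (sym (ℕₚ.+-identityʳ (if p [] then 1 else 0)))))
  go (suc n) p = begin
    ι (2 ℕ.* 2 ℕ.^ n) * (½ * (X + Y))        ≡⟨ cong (_* (½ * (X + Y))) (ι-* 2 (2 ℕ.^ n)) ⟩
    ι 2 * ι (2 ℕ.^ n) * (½ * (X + Y))        ≡⟨ solve 3 (λ m x y → con (ι 2) :* m :* (con ½ :* (x :+ y)) := m :* x :+ m :* y) refl (ι (2 ℕ.^ n)) X Y ⟩
    ι (2 ℕ.^ n) * X + ι (2 ℕ.^ n) * Y        ≡⟨ cong₂ _+_ (go n (p ∘ (false ∷_))) (go n (p ∘ (true ∷_))) ⟩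
    ι (cnt (p ∘ (false ∷_)) I) + ι (cnt (p ∘ (true ∷_)) I) ≡⟨ sym (ι-+ (cnt (p ∘ (false ∷_)) I) (cnt (p ∘ (true ∷_)) I)) ⟩
    ι (cnt (p ∘ (false ∷_)) I ℕ.+ cnt (p ∘ (true ∷_)) I)   ≡⟨ cong ι (sym (split p I)) ⟩
    ι (cnt p (allInputs (suc n)))            ∎
    where
    I = allInputs n
    X = M n (λ x → ⟦ p (false ∷ x) ⟧)
    Y = M n (λ x → ⟦ p (true ∷ x) ⟧)

-- Random draws, dictator tests and verification as decision trees

draw : ∀ {n} m → (Vec Bool m → Alg n) → Alg n
draw zero    k = k []
draw (suc m) k = coin λ b → draw m (λ x → k (b ∷ x))

-- P stands for the function f ∘ P, each value of which costs one query to f.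
Probe : ℕ → Set
Probe n = Input n → Input n

-- Procedures are in continuation-passing style: a test maps the algorithm that follows to the
-- combined tree, and a failure rejects at once.
guard : ∀ {n} → Bool → Alg n → Alg n
guard fails k = if fails then reject else k

iterate : ∀ {A : Set} → ℕ → (A → A) → A → A
iterate zero    F a = a
iterate (suc q) F a = F (iterate q F a)

module _ {n : ℕ} where

  affineTest andTest oneTest : Probe n → Alg n → Alg n
  affineTest P k =
    draw n λ a → draw n λ b → draw n λ c →
    query (P a) λ u → query (P b) λ v → query (P c) λ w → query (P ((a ⊕ b) ⊕ c)) λ t →
    guard ((u xor v) xor (w xor t)) k
  andTest P k =
    draw n λ x → draw n λ y → draw n λ z₁ → draw n λ z₂ → draw n λ z₃ →
    query (P ((x ⊓ y) ⊕ z₁)) λ a → query (P z₁) λ b →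
    query (P (x ⊕ z₂)) λ c → query (P z₂) λ d →
    query (P (y ⊕ z₃)) λ e → query (P z₃) λ g →
    guard ((a xor b) xor ((c xor d) ∧ (e xor g))) k
  oneTest P k =
    draw n λ z → query (P (replicate n true ⊕ z)) λ a → query (P z) λ b → guard (not (a xor b)) k

  dictatorTests : ℕ → ∀ {K} → Vec (Probe n) K → Alg n → Alg n
  dictatorTests q []       k = k
  dictatorTests q (P ∷ Ps) k =
    -- The counts 16 and 4 match the thresholds 1/8 and 1/2: 1 + 16/8 = 1 + 4/2 = 3, so by Bernoulli
    -- a larger error leaves acceptance at most 1/3.
    iterate q (affineTest P) (iterate 16 (andTest P) (iterate 4 (oneTest P) (dictatorTests q Ps k)))

  decode : ∀ {K} → Vec (Probe n) K → Input n → (Vec Bool K → Alg n) → Alg n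
  decode []       x k = k []
  decode (P ∷ Ps) x k =
    draw n λ z → query (P (x ⊕ z)) λ a → query (P z) λ b → decode Ps x λ y → k ((a xor b) ∷ y)

  verify : ∀ {K} → Vec (Probe n) K → BoolFn K → Alg n → Alg n
  verify Ps c k = draw n λ x → query x λ a → decode Ps x λ y → guard (a xor c y) k

-- Acceptance and rejection probabilities

module _ {n : ℕ} (f : BoolFn n) where

  acceptProb-draw : ∀ m (k : Vec Bool m → Alg n) → acceptProb (draw m k) f ≡ M m (λ x → acceptProb (k x) f)
  acceptProb-draw zero    k = refl
  acceptProb-draw (suc m) k = cong₂ (λ a b → ½ * (a + b))
    (acceptProb-draw m (λ x → k (false ∷ x))) (acceptProb-draw m (λ x → k (true ∷ x)))

  rejectProb-draw : ∀ m (k : Vec Bool m → Alg n) → rejectProb (draw m k) f ≡ M m (λ x → rejectProb (k x) f)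
  rejectProb-draw zero    k = refl
  rejectProb-draw (suc m) k = cong₂ (λ a b → ½ * (a + b))
    (rejectProb-draw m (λ x → k (false ∷ x))) (rejectProb-draw m (λ x → k (true ∷ x)))

  accept+reject : ∀ A → acceptProb A f + rejectProb A f ≡ 1ℚ
  accept+reject accept      = refl
  accept+reject reject      = refl
  accept+reject (query x k) = accept+reject (k (f x))
  accept+reject (coin k)    = trans
    (solve 4 (λ a b c d → con ½ :* (a :+ b) :+ con ½ :* (c :+ d) := con ½ :* ((a :+ c) :+ (b :+ d))) refl
      (acceptProb (k false) f) (acceptProb (k true) f) (rejectProb (k false) f) (rejectProb (k true) f))
    (cong₂ (λ a b → ½ * (a + b)) (accept+reject (k false)) (accept+reject (k true)))

  acceptProb≥0 : ∀ A → 0ℚ ≤ acceptProb A f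
  acceptProb≥0 accept      = 0≤1
  acceptProb≥0 reject      = ℚₚ.≤-refl
  acceptProb≥0 (query x k) = acceptProb≥0 (k (f x))
  acceptProb≥0 (coin k)    = 0≤* 0≤½ (0≤+ (acceptProb≥0 (k false)) (acceptProb≥0 (k true)))

  rejectProb≥0 : ∀ A → 0ℚ ≤ rejectProb A f
  rejectProb≥0 accept      = ℚₚ.≤-refl
  rejectProb≥0 reject      = 0≤1
  rejectProb≥0 (query x k) = rejectProb≥0 (k (f x))
  rejectProb≥0 (coin k)    = 0≤* 0≤½ (0≤+ (rejectProb≥0 (k false)) (rejectProb≥0 (k true)))

  acceptProb≤1 : ∀ A → acceptProb A f ≤ 1ℚ
  acceptProb≤1 A = ℚₚ.≤-trans (≤+ʳ (rejectProb≥0 A)) (ℚₚ.≤-reflexive (accept+reject A))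

  rejectProb≤1 : ∀ A → rejectProb A f ≤ 1ℚ
  rejectProb≤1 A = ℚₚ.≤-trans (≤+ˡ (acceptProb≥0 A)) (ℚₚ.≤-reflexive (accept+reject A))

  acceptProb-draw≤ : ∀ m (k : Vec Bool m → Alg n) {b} → (∀ x → acceptProb (k x) f ≤ b) → acceptProb (draw m k) f ≤ b
  acceptProb-draw≤ m k h = ℚₚ.≤-trans (ℚₚ.≤-reflexive (acceptProb-draw m k)) (M-≤ m h)

  rejectProb-draw≤ : ∀ m (k : Vec Bool m → Alg n) {b} → (∀ x → rejectProb (k x) f ≤ b) → rejectProb (draw m k) f ≤ b
  rejectProb-draw≤ m k h = ℚₚ.≤-trans (ℚₚ.≤-reflexive (rejectProb-draw m k)) (M-≤ m h)

  acceptProb-guard : ∀ b k → acceptProb (guard b k) f ≡ (1ℚ - ⟦ b ⟧) * acceptProb k f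
  acceptProb-guard true  k = sym (ℚₚ.*-zeroˡ (acceptProb k f))
  acceptProb-guard false k = sym (ℚₚ.*-identityˡ (acceptProb k f))

  -- Fresh randomness makes a test independent of what follows, so it scales the acceptance
  -- probability of every continuation by the same factor, and repetition becomes a power.
  record Filters (F : Alg n → Alg n) (r : ℚ) : Set where
    constructor filters
    field law : ∀ k → acceptProb (F k) f ≡ (1ℚ - r) * acceptProb k f
  open Filters

  filters-draw : ∀ m (F : Vec Bool m → Alg n → Alg n) (r : Vec Bool m → ℚ) →
    (∀ x → Filters (F x) (r x)) → Filters (λ k → draw m (λ x → F x k)) (M m r)
  law (filters-draw m F r h) k = begin
    acceptProb (draw m (λ x → F x k)) f         ≡⟨ acceptProb-draw m (λ x → F x k) ⟩
    M m (λ x → acceptProb (F x k) f)            ≡⟨ M-cong m (λ x → law (h x) k) ⟩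
    M m (λ x → (1ℚ - r x) * acceptProb k f)     ≡⟨ M-*ʳ m (λ x → 1ℚ - r x) (acceptProb k f) ⟩
    M m (λ x → 1ℚ - r x) * acceptProb k f       ≡⟨ cong (_* acceptProb k f) (M-1- m r) ⟩
    (1ℚ - M m r) * acceptProb k f               ∎
    where open ≡-Reasoning

  filters-iterate : ∀ {F r} → Filters F r → ∀ q k → acceptProb (iterate q F k) f ≡ (1ℚ - r) ^ q * acceptProb k f
  filters-iterate h zero    k = sym (ℚₚ.*-identityˡ (acceptProb k f))
  filters-iterate {F} {r} h (suc q) k =
    trans (law h (iterate q F k)) (trans (cong ((1ℚ - r) *_) (filters-iterate h q k)) (sym (ℚₚ.*-assoc (1ℚ - r) ((1ℚ - r) ^ q) (acceptProb k f))))

  iterate≤ : ∀ {F r} → Filters F r → 0ℚ ≤ r → r ≤ 1ℚ → ∀ q k → acceptProb (iterate q F k) f ≤ acceptProb k f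
  iterate≤ {F} {r} h r≥0 r≤1 q k = begin
    acceptProb (iterate q F k) f     ≡⟨ filters-iterate h q k ⟩
    (1ℚ - r) ^ q * acceptProb k f    ≤⟨ *-monoʳ (acceptProb k f) (acceptProb≥0 k) (^-≤1 (0≤- r≤1) 1-r≤1 q) ⟩
    1ℚ * acceptProb k f              ≡⟨ ℚₚ.*-identityˡ (acceptProb k f) ⟩
    acceptProb k f                   ∎
    where
    open ℚₚ.≤-Reasoning
    1-r≤1 : 1ℚ - r ≤ 1ℚ
    1-r≤1 = ≤-by (ℚₚ.≤-trans r≥0 (ℚₚ.≤-reflexive (solve 1 (λ r → r := con 1ℚ :- (con 1ℚ :- r)) refl r)))

  iterate≤inv : ∀ {F r} → Filters F r → 0ℚ ≤ r → r ≤ 1ℚ → ∀ q c .{{_ : ℕ.NonZero c}} → ι c ≤ 1ℚ + ι q * r → ∀ k →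
    acceptProb (iterate q F k) f ≤ inv c
  iterate≤inv {F} {r} h r≥0 r≤1 q c g k = begin
    acceptProb (iterate q F k) f         ≡⟨ filters-iterate h q k ⟩
    (1ℚ - r) ^ q * acceptProb k f        ≤⟨ *-monoˡ ((1ℚ - r) ^ q) (^-nonneg (0≤- r≤1) q) (acceptProb≤1 k) ⟩
    (1ℚ - r) ^ q * 1ℚ                    ≡⟨ ℚₚ.*-identityʳ ((1ℚ - r) ^ q) ⟩
    (1ℚ - r) ^ q                         ≤⟨ pow≤inv r≥0 r≤1 q c g ⟩
    inv c                                ∎
    where open ℚₚ.≤-Reasoning

  module _ (P : Probe n) where
    open Dictator (λ x → f (P x))

    affineTest-filters : Filters (affineTest P) affineErr
    affineTest-filters = filters-draw n _ _ λ a → filters-draw n _ _ λ b → filters-draw n _ _ λ c →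
      filters (acceptProb-guard (affineFails a b c))

    andTest-filters : Filters (andTest P) andErr
    andTest-filters = filters-draw n _ _ λ x → filters-draw n _ _ λ y → filters-draw n _ _ λ z₁ →
      filters-draw n _ _ λ z₂ → filters-draw n _ _ λ z₃ → filters (acceptProb-guard (andFails x y z₁ z₂ z₃))

    oneTest-filters : Filters (oneTest P) oneErr
    oneTest-filters = filters-draw n _ _ λ z → filters (acceptProb-guard (oneFails z))

-- Soundness of dictator tests and verification

module _ {n : ℕ} (f : BoolFn n) where

  Decodes : ℚ → Probe n → Fin n → Set
  Decodes θ P i = ∀ x → M n (λ z → ⟦ Dictator.D (λ x → f (P x)) x z xor lookup x i ⟧) ≤ θ

  decode≤max : ∀ {K} (Ps : Vec (Probe n) K) x (k : Vec Bool K → Alg n) {V} → (∀ y → acceptProb (k y) f ≤ V) →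
    acceptProb (decode Ps x k) f ≤ V
  decode≤max []       x k h = h []
  decode≤max (P ∷ Ps) x k h = acceptProb-draw≤ f n _ (λ z → decode≤max Ps x _ (λ y → h _))

  -- Union bound over the `K` decoded bits: each is wrong with probability at most `θ`, and then
  -- only the maximum `V` of the continuation is known. Keeping `V` instead of 1 lets `verify≤`
  -- remain a multiplicative bound.
  decode≤ : ∀ {θ K} {Ps : Vec (Probe n) K} {is} → Pointwise (Decodes θ) Ps is → ∀ x (k : Vec Bool K → Alg n) {V} →
    (∀ y → acceptProb (k y) f ≤ V) → 0ℚ ≤ V →
    acceptProb (decode Ps x k) f ≤ ι K * θ * V + acceptProb (k (Vec.map (lookup x) is)) f
  decode≤ {θ} [] x k {V} h V≥0 = ℚₚ.≤-reflexive (solve 3 (λ a t v → a := con 0ℚ :* t :* v :+ a) refl (acceptProb (k []) f) θ V)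
  decode≤ {θ} {suc K} {P ∷ Ps} {i ∷ is} (d ∷ ds) x k {V} h V≥0 = begin
    acceptProb (decode (P ∷ Ps) x k) f
      ≡⟨ acceptProb-draw f n _ ⟩
    M n (λ z → acceptProb (decode Ps x (λ y → k (D x z ∷ y))) f)
      ≤⟨ M-mono n ptw ⟩
    M n (λ z → ι K * θ * V + (⟦ D x z xor lookup x i ⟧ * V + A))
      ≡⟨ trans (M-+ˡ n (ι K * θ * V) (λ z → ⟦ D x z xor lookup x i ⟧ * V + A)) (cong (ι K * θ * V +_)
           (trans (M-+ʳ n (λ z → ⟦ D x z xor lookup x i ⟧ * V) A) (cong (_+ A) (M-*ʳ n (λ z → ⟦ D x z xor lookup x i ⟧) V)))) ⟩
    ι K * θ * V + (M n (λ z → ⟦ D x z xor lookup x i ⟧) * V + A)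
      ≤⟨ ℚₚ.+-monoʳ-≤ (ι K * θ * V) (ℚₚ.+-monoˡ-≤ A (*-monoʳ V V≥0 (d x))) ⟩
    ι K * θ * V + (θ * V + A)
      ≡⟨ solve 4 (λ m t v a → m :* t :* v :+ (t :* v :+ a) := (con 1ℚ :+ m) :* t :* v :+ a) refl (ι K) θ V A ⟩
    (1ℚ + ι K) * θ * V + A
      ≡⟨ cong (λ m → m * θ * V + A) (sym (ι-suc K)) ⟩
    ι (suc K) * θ * V + A ∎
    where
    open ℚₚ.≤-Reasoning
    open Dictator (λ x → f (P x)) using (D)
    ys = Vec.map (lookup x) is
    A = acceptProb (k (lookup x i ∷ ys)) f
    switch : ∀ a b → acceptProb (k (a ∷ ys)) f ≤ ⟦ a xor b ⟧ * V + acceptProb (k (b ∷ ys)) f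
    switch true  true  = ℚₚ.≤-reflexive (solve 2 (λ a v → a := con 0ℚ :* v :+ a) refl (acceptProb (k (true ∷ ys)) f) V)
    switch false false = ℚₚ.≤-reflexive (solve 2 (λ a v → a := con 0ℚ :* v :+ a) refl (acceptProb (k (false ∷ ys)) f) V)
    switch true  false = ℚₚ.≤-trans (h (true ∷ ys)) (ℚₚ.≤-trans (ℚₚ.≤-reflexive (sym (ℚₚ.*-identityˡ V))) (≤+ʳ (acceptProb≥0 f (k (false ∷ ys)))))
    switch false true  = ℚₚ.≤-trans (h (false ∷ ys)) (ℚₚ.≤-trans (ℚₚ.≤-reflexive (sym (ℚₚ.*-identityˡ V))) (≤+ʳ (acceptProb≥0 f (k (true ∷ ys)))))
    ptw : ∀ z → acceptProb (decode Ps x (λ y → k (D x z ∷ y))) f ≤ ι K * θ * V + (⟦ D x z xor lookup x i ⟧ * V + A)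
    ptw z = ℚₚ.≤-trans (decode≤ ds x (λ y → k (D x z ∷ y)) (λ y → h _) V≥0)
      (ℚₚ.+-monoʳ-≤ (ι K * θ * V) (switch (D x z) (lookup x i)))

  module _ {θ : ℚ} {K : ℕ} {Ps : Vec (Probe n) K} {is : Vec (Fin n) K} (ds : Pointwise (Decodes θ) Ps is) (small : ι K * θ ≤ ½) (c : BoolFn K) where

    disagreement : ℚ
    disagreement = M n λ x → ⟦ f x xor c (Vec.map (lookup x) is) ⟧

    -- On an input where f differs from the decoded junta, only a decoding error can rescue the run,
    -- with probability at most 1/2; elsewhere the trivial bound suffices.
    verify≤ : ∀ k → acceptProb (verify Ps c k) f ≤ (1ℚ - ½ * disagreement) * acceptProb k f
    verify≤ k = begin
      acceptProb (verify Ps c k) f   ≡⟨ acceptProb-draw f n _ ⟩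
      M n (λ x → acceptProb (decode Ps x (λ y → guard (f x xor c y) k)) f)
        ≤⟨ M-mono n (λ x → ptw x (f x xor c (Vec.map (lookup x) is)) refl) ⟩
      M n (λ x → (1ℚ - ½ * w x) * V)      ≡⟨ M-*ʳ n (λ x → 1ℚ - ½ * w x) V ⟩
      M n (λ x → 1ℚ - ½ * w x) * V        ≡⟨ cong (_* V) (trans (M-1- n (λ x → ½ * w x)) (cong (λ e → 1ℚ - e) (M-* n ½ w))) ⟩
      (1ℚ - ½ * disagreement) * V         ∎
      where
      open ℚₚ.≤-Reasoning
      V = acceptProb k f
      w : Input n → ℚ
      w x = ⟦ f x xor c (Vec.map (lookup x) is) ⟧
      guard≤ : ∀ b → acceptProb (guard b k) f ≤ V
      guard≤ true  = acceptProb≥0 f k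
      guard≤ false = ℚₚ.≤-refl
      ptw : ∀ x b → f x xor c (Vec.map (lookup x) is) ≡ b →
        acceptProb (decode Ps x (λ y → guard (f x xor c y) k)) f ≤ (1ℚ - ½ * ⟦ b ⟧) * V
      ptw x false _ = ℚₚ.≤-trans (decode≤max Ps x _ (λ y → guard≤ (f x xor c y)))
        (ℚₚ.≤-reflexive (solve 1 (λ v → v := (con 1ℚ :- con ½ :* con 0ℚ) :* v) refl V))
      ptw x true wrong = begin
        acceptProb (decode Ps x (λ y → guard (f x xor c y) k)) f
          ≤⟨ decode≤ ds x _ (λ y → guard≤ (f x xor c y)) (acceptProb≥0 f k) ⟩
        ι K * θ * V + acceptProb (guard (f x xor c (Vec.map (lookup x) is)) k) f
          ≡⟨ cong (λ b → ι K * θ * V + acceptProb (guard b k) f) wrong ⟩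
        ι K * θ * V + 0ℚ             ≡⟨ ℚₚ.+-identityʳ (ι K * θ * V) ⟩
        ι K * θ * V                  ≤⟨ *-monoʳ V (acceptProb≥0 f k) small ⟩
        ½ * V                        ≡⟨ solve 1 (λ v → con ½ :* v := (con 1ℚ :- con ½ :* con 1ℚ) :* v) refl V ⟩
        (1ℚ - ½ * 1ℚ) * V            ∎

    iterate-verify≤ : ∀ t k → acceptProb (iterate t (verify Ps c) k) f ≤ (1ℚ - ½ * disagreement) ^ t
    iterate-verify≤ zero    k = acceptProb≤1 f k
    iterate-verify≤ (suc t) k = ℚₚ.≤-trans (verify≤ (iterate t (verify Ps c) k))
      (*-monoˡ (1ℚ - ½ * disagreement) (0≤- ½d≤1) (iterate-verify≤ t k))
      where
      ½d≤1 : ½ * disagreement ≤ 1ℚ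
      ½d≤1 = ℚₚ.≤-trans (*-monoˡ ½ 0≤½ (M-≤ n (λ x → ⟦⟧≤1 (f x xor c (Vec.map (lookup x) is))))) (ℚₚ.≤ᵇ⇒≤ {½ * 1ℚ} {1ℚ} _)

  module _ (P : Probe n) where
    open Dictator (λ x → f (P x))

    affineErr∈ : 0ℚ ≤ affineErr × affineErr ≤ 1ℚ
    affineErr∈ = (M-nonneg n λ a → M-nonneg n λ b → M-nonneg n λ c → ⟦⟧≥0 (affineFails a b c))
               , (M-≤ n λ a → M-≤ n λ b → M-≤ n λ c → ⟦⟧≤1 (affineFails a b c))

    andErr∈ : 0ℚ ≤ andErr × andErr ≤ 1ℚ
    andErr∈ = (M-nonneg n λ x → M-nonneg n λ y → M-nonneg n λ z₁ → M-nonneg n λ z₂ → M-nonneg n λ z₃ → ⟦⟧≥0 (andFails x y z₁ z₂ z₃))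
            , (M-≤ n λ x → M-≤ n λ y → M-≤ n λ z₁ → M-≤ n λ z₂ → M-≤ n λ z₃ → ⟦⟧≤1 (andFails x y z₁ z₂ z₃))

    oneErr∈ : 0ℚ ≤ oneErr × oneErr ≤ 1ℚ
    oneErr∈ = (M-nonneg n λ z → ⟦⟧≥0 (oneFails z)) , (M-≤ n λ z → ⟦⟧≤1 (oneFails z))

    affine≤ : ∀ q k → acceptProb (iterate q (affineTest P) k) f ≤ acceptProb k f
    affine≤ = iterate≤ f (affineTest-filters f P) (proj₁ affineErr∈) (proj₂ affineErr∈)

    and≤ : ∀ q k → acceptProb (iterate q (andTest P) k) f ≤ acceptProb k f
    and≤ = iterate≤ f (andTest-filters f P) (proj₁ andErr∈) (proj₂ andErr∈)

    one≤ : ∀ q k → acceptProb (iterate q (oneTest P) k) f ≤ acceptProb k f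
    one≤ = iterate≤ f (oneTest-filters f P) (proj₁ oneErr∈) (proj₂ oneErr∈)

    tests : ℕ → Alg n → Alg n
    tests q k = iterate q (affineTest P) (iterate 16 (andTest P) (iterate 4 (oneTest P) k))

    tests≤ : ∀ q k → acceptProb (tests q k) f ≤ acceptProb k f
    tests≤ q k = ℚₚ.≤-trans (affine≤ q _) (ℚₚ.≤-trans (and≤ 16 _) (one≤ 4 k))

    -- The case split is on the true error of each test, not on a random outcome. For the affine
    -- test the threshold is 1/h and 1 + 2h/h = 3; below all three thresholds `dictator` applies.
    rejected-or-decodes : ∀ h .{{_ : ℕ.NonZero h}} → 96 ℕ.≤ h → ∀ k →
      acceptProb (tests (2 ℕ.* h) k) f ≤ inv 3 ⊎ Σ (Fin n) (Decodes (inv h + inv h) P)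
    rejected-or-decodes h 96≤h k with affineErr ℚₚ.≤? inv h | andErr ℚₚ.≤? inv 8 | oneErr ℚₚ.≤? ½
    ... | no big | _ | _ = inj₁ (iterate≤inv f (affineTest-filters f P) (proj₁ affineErr∈) (proj₂ affineErr∈) (2 ℕ.* h) 3 (begin
        ι 3                                  ≡⟨⟩
        1ℚ + (1ℚ + 1ℚ) * 1ℚ                  ≡⟨ cong (λ e → 1ℚ + (1ℚ + 1ℚ) * e) (sym (ι-inv h)) ⟩
        1ℚ + (1ℚ + 1ℚ) * (ι h * inv h)       ≡⟨ cong (1ℚ +_) (sym (ℚₚ.*-assoc (1ℚ + 1ℚ) (ι h) (inv h))) ⟩
        1ℚ + (1ℚ + 1ℚ) * ι h * inv h         ≡⟨ cong (λ e → 1ℚ + e * inv h) (sym (ι-* 2 h)) ⟩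
        1ℚ + ι (2 ℕ.* h) * inv h             ≤⟨ ℚₚ.+-monoʳ-≤ 1ℚ (*-monoˡ (ι (2 ℕ.* h)) (ι≥0 (2 ℕ.* h)) (ℚₚ.<⇒≤ (ℚₚ.≰⇒> big))) ⟩
        1ℚ + ι (2 ℕ.* h) * affineErr         ∎) _)
      where open ℚₚ.≤-Reasoning
    ... | yes _ | no big | _ = inj₁ (ℚₚ.≤-trans (affine≤ (2 ℕ.* h) _)
        (iterate≤inv f (andTest-filters f P) (proj₁ andErr∈) (proj₂ andErr∈) 16 3
          (ℚₚ.+-monoʳ-≤ 1ℚ (*-monoˡ {inv 8} (ι 16) (ι≥0 16) (ℚₚ.<⇒≤ (ℚₚ.≰⇒> big)))) _))
    ... | yes _ | yes _ | no big = inj₁ (ℚₚ.≤-trans (affine≤ (2 ℕ.* h) _) (ℚₚ.≤-trans (and≤ 16 _)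
        (iterate≤inv f (oneTest-filters f P) (proj₁ oneErr∈) (proj₂ oneErr∈) 4 3
          (ℚₚ.+-monoʳ-≤ 1ℚ (*-monoˡ {½} (ι 4) (ι≥0 4) (ℚₚ.<⇒≤ (ℚₚ.≰⇒> big)))) k)))
    ... | yes a≤ | yes b≤ | yes c≤ =
      let i , dec = dictator (ℚₚ.≤-trans a≤ inv-h≤) b≤ c≤
      in inj₂ (i , λ x → ℚₚ.≤-trans (dec x) (ℚₚ.+-mono-≤ a≤ a≤))
      where
      inv-h≤ : inv h ≤ inv 96
      inv-h≤ = ℚₚ.≤-trans (ℚₚ.≤-reflexive (sym (ℚₚ.*-identityˡ (inv h)))) (ι*inv≤inv 1 96 h 96≤h)

  dictatorTests≤ : ∀ q {K} (Ps : Vec (Probe n) K) k → acceptProb (dictatorTests q Ps k) f ≤ acceptProb k f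
  dictatorTests≤ q []       k = ℚₚ.≤-refl
  dictatorTests≤ q (P ∷ Ps) k = ℚₚ.≤-trans (tests≤ P q _) (dictatorTests≤ q Ps k)

  dictatorTests-sound : ∀ h .{{_ : ℕ.NonZero h}} → 96 ℕ.≤ h → ∀ {K} (Ps : Vec (Probe n) K) k →
    acceptProb (dictatorTests (2 ℕ.* h) Ps k) f ≤ inv 3
    ⊎ Σ (Vec (Fin n) K) (Pointwise (Decodes (inv h + inv h)) Ps)
  dictatorTests-sound h 96≤h [] k = inj₂ ([] , [])
  dictatorTests-sound h 96≤h (P ∷ Ps) k with rejected-or-decodes P h 96≤h (dictatorTests (2 ℕ.* h) Ps k) | dictatorTests-sound h 96≤h Ps k
  ... | inj₁ rej      | _               = inj₁ rej
  ... | inj₂ (i , d)  | inj₁ rej        = inj₁ (ℚₚ.≤-trans (tests≤ P (2 ℕ.* h) _) rej)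
  ... | inj₂ (i , d)  | inj₂ (is , ds)  = inj₂ (i ∷ is , d ∷ ds)

  -- If all probes decode variables, then `C` with these variables substituted is a circuit of the
  -- allowed size, so f is at distance at least 1/E from it. The bound 4K ≤ h keeps the total
  -- decoding error K · 2/h below 1/2, and the 4E rounds, each failing with probability at least
  -- 1/(2E), give 1 + 4E/(2E) = 3.
  check-sound : ∀ {s} E h .{{_ : ℕ.NonZero E}} .{{_ : ℕ.NonZero h}} →
    (∀ {m} → m ℕ.≤ s → (C : Circuit n m) → inv E ≤ M n (λ x → ⟦ f x xor eval C x ⟧)) →
    96 ℕ.≤ h → ∀ {K} → K ℕ.* 4 ℕ.≤ h → (Ps : Vec (Probe n) K) → ∀ {m} → m ℕ.≤ s → (C : Circuit K m) →
    acceptProb (dictatorTests (2 ℕ.* h) Ps (iterate (4 ℕ.* E) (verify Ps (eval C)) accept)) f ≤ inv 3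
  check-sound E h far 96≤h {K} 4K≤h Ps m≤s C
    with dictatorTests-sound h 96≤h Ps (iterate (4 ℕ.* E) (verify Ps (eval C)) accept)
  ... | inj₁ rej = rej
  ... | inj₂ (is , ds) = ℚₚ.≤-trans (dictatorTests≤ (2 ℕ.* h) Ps _)
      (ℚₚ.≤-trans (iterate-verify≤ ds small (eval C) (4 ℕ.* E) accept)
        (pow≤inv {½ * d} (0≤* 0≤½ d≥0) ½d≤1 (4 ℕ.* E) 3 three))
    where
    open ℚₚ.≤-Reasoning
    small : ι K * (inv h + inv h) ≤ ½
    small = begin
      ι K * (inv h + inv h)             ≡⟨ ℚₚ.*-distribˡ-+ (ι K) (inv h) (inv h) ⟩
      ι K * inv h + ι K * inv h         ≤⟨ ℚₚ.+-mono-≤ (ι*inv≤inv K 4 h 4K≤h) (ι*inv≤inv K 4 h 4K≤h) ⟩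
      inv 4 + inv 4                     ≡⟨⟩
      ½                                 ∎
    σ : Fin K → Fin n ⊎ Bool
    σ l = inj₁ (lookup is l)
    d : ℚ
    d = disagreement ds small (eval C)
    wrong : Input n → Bool
    wrong x = f x xor eval C (Vec.map (lookup x) is)
    lift : ∀ x → eval (substCircuit σ C) x ≡ eval C (Vec.map (lookup x) is)
    lift x = trans (eval-subst σ x C) (cong (eval C) (trans (Vecₚ.tabulate-∘ (lookup x) (lookup is)) (cong (Vec.map (lookup x)) (Vecₚ.tabulate∘lookup is))))
    E≤d : inv E ≤ d
    E≤d = ℚₚ.≤-trans (far m≤s (substCircuit σ C)) (ℚₚ.≤-reflexive (M-cong n (λ x → cong (λ b → ⟦ f x xor b ⟧) (lift x))))
    d≥0 : 0ℚ ≤ d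
    d≥0 = M-nonneg n (λ x → ⟦⟧≥0 (wrong x))
    ½d≤1 : ½ * d ≤ 1ℚ
    ½d≤1 = ℚₚ.≤-trans (*-monoˡ ½ 0≤½ (M-≤ n (λ x → ⟦⟧≤1 (wrong x)))) (ℚₚ.≤ᵇ⇒≤ {½ * 1ℚ} {1ℚ} _)
    three : ι 3 ≤ 1ℚ + ι (4 ℕ.* E) * (½ * d)
    three = begin
      ι 3                                  ≡⟨⟩
      1ℚ + ι 4 * (½ * 1ℚ)                  ≡⟨ cong (λ e → 1ℚ + ι 4 * (½ * e)) (sym (ι-inv E)) ⟩
      1ℚ + ι 4 * (½ * (ι E * inv E))       ≡⟨ solve 2 (λ a b → con 1ℚ :+ con (ι 4) :* (con ½ :* (a :* b)) := con 1ℚ :+ con (ι 4) :* a :* (con ½ :* b)) refl (ι E) (inv E) ⟩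
      1ℚ + ι 4 * ι E * (½ * inv E)         ≡⟨ cong (λ e → 1ℚ + e * (½ * inv E)) (sym (ι-* 4 E)) ⟩
      1ℚ + ι (4 ℕ.* E) * (½ * inv E)       ≤⟨ ℚₚ.+-monoʳ-≤ 1ℚ (*-monoˡ (ι (4 ℕ.* E)) (ι≥0 (4 ℕ.* E)) (*-monoˡ ½ 0≤½ E≤d)) ⟩
      1ℚ + ι (4 ℕ.* E) * (½ * d)           ∎

-- The tester

spread : ∀ {n R} → Vec (Fin R) n → Vec Bool R → Input n
spread π w = Vec.map (lookup w) π

bit : Bool → Fin 2
bit false = Fin.zero
bit true  = Fin.suc Fin.zero

index : ∀ {ρ} → Vec Bool ρ → Fin (2 ℕ.^ ρ)
index []       = Fin.zero
index (b ∷ bs) = Fin.combine (bit b) (index bs)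

drawBlocks : ∀ {n} ρ m → (Vec (Fin (2 ℕ.^ ρ)) m → Alg n) → Alg n
drawBlocks ρ zero    k = k []
drawBlocks ρ (suc m) k = draw ρ λ b → drawBlocks ρ m λ π → k (index b ∷ π)

-- A found block together with an assignment of the blocks at which the function is sensitive to it.
Entry : ℕ → Set
Entry R = Fin R × Vec Bool R

found : ∀ {R K} → Vec (Entry R) K → Fin R → Bool
found []             j = false
found ((b , _) ∷ es) j = does (b Fin.≟ j) ∨ found es j

keep : ∀ {R K} → Vec (Entry R) K → ℕ → Vec Bool R
keep es i = tabulate λ j → found es j ∨ (i ℕ.≤ᵇ Fin.toℕ j)

override : ∀ {R K} → Vec (Entry R) K → Vec Bool K → Vec Bool R → Vec Bool R
override []             []       v = v
override ((b , _) ∷ es) (y ∷ ys) v = override es ys v [ b ]≔ y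

probe : ∀ {n R} → Vec (Fin R) n → Entry R → Probe n
probe π (b , a) x = tabulate λ i → if does (lookup π i Fin.≟ b) then lookup x i else lookup a (lookup π i)

-- Looks for a step i at which f (h i) ≠ f (h (1 + i)), where a is the value of f at h lo.
search : ∀ {n} → ℕ → (lo : ℕ) → (ℕ → Input n) → Bool → (ℕ → Alg n) → Alg n
search zero    lo h a k = k lo
search (suc ρ) lo h a k = query (h (lo ℕ.+ 2 ℕ.^ ρ)) λ b →
  if a xor b then search ρ lo h a k else search ρ (lo ℕ.+ 2 ℕ.^ ρ) h b k

asBlock : ∀ {n} R → ℕ → (Fin R → Alg n) → Alg n
asBlock R i k with i ℕ.<? R
... | yes i<R = k (Fin.fromℕ< i<R)
-- A default: when the end values differ, the search yields an index below `R`; rejecting otherwise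
-- cannot hurt soundness.
... | no _    = reject

-- An Occam learner: any candidate consistent with all samples is returned, since an inaccurate one
-- is unlikely to survive. The list cannot run empty if it contains the restriction of f.
learn : ∀ {n K s} → ℕ → List (Circuit K s) → (Vec Bool K → Input n) → (Circuit K s → Alg n) → Alg n
learn zero    []      pt k = reject
learn zero    (c ∷ _) pt k = k c
learn {K = K} (suc m) cs pt k = draw K λ y → query (pt y) λ a →
    learn m (List.filterᵇ (λ c → not (eval c y xor a)) cs) pt k

-- Found blocks follow `w` throughout; among the others, those numbered below `i` have moved to
-- `w′`. So step 0 is `w`, step `R` refreshes everything unfound, and steps i and i + 1 can differ
-- in block i only.
hybrid : ∀ {R K} → Vec (Entry R) K → (w w′ : Vec Bool R) → ℕ → Vec Bool R
hybrid es w w′ i = mix (keep es i) w w′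

module Find {n : ℕ} (ρ : ℕ) (π : Vec (Fin (2 ℕ.^ ρ)) n) (q : ℕ) where

  private
    R : ℕ
    R = 2 ℕ.^ ρ

  newBlock : ∀ {K} → Vec (Entry R) K → (w w′ : Vec Bool R) → Bool → (Entry R → Alg n) → Alg n
  newBlock es w w′ a k = search ρ 0 (spread π ∘ hybrid es w w′) a λ i → asBlock R i λ b → k (b , hybrid es w w′ i)

  -- p bounds the number of blocks still to be found; each one gets up to q attempts.
  find : (p j : ℕ) → ∀ {K} → Vec (Entry R) K → (∀ K → Vec (Entry R) K → Alg n) → Alg n
  find zero    j       {K} es k = k K es
  find (suc p) zero    {K} es k = k K es
  find (suc p) (suc j) es k = draw R λ w → draw R λ w′ →
    query (spread π (hybrid es w w′ 0)) λ a → query (spread π (hybrid es w w′ R)) λ b →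
    if a xor b then newBlock es w w′ a (λ e → find p q (e ∷ es) k) else find (suc p) j es k

Candidates : ℕ → Set
Candidates s = ∀ K → List (Circuit K s)

module Tester (n s ρ p q m h E : ℕ) (cands : Candidates s) where

  check : ∀ {K} → Vec (Probe n) K → Circuit K s → Alg n
  check Ps C = dictatorTests (2 ℕ.* h) Ps (iterate (4 ℕ.* E) (verify Ps (eval C)) accept)

  learnAndCheck : Vec (Fin (2 ℕ.^ ρ)) n → ∀ K → Vec (Entry (2 ℕ.^ ρ)) K → Alg n
  learnAndCheck π K es = draw (2 ℕ.^ ρ) λ v →
    learn m (cands K) (λ y → spread π (override es y v)) (check (Vec.map (probe π) es))

  tester : Alg n
  tester = drawBlocks ρ n λ π → Find.find ρ π q p q [] (learnAndCheck π)

-- Soundness of the tester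

module _ {n : ℕ} (f : BoolFn n) where

  acceptProb-if≤ : ∀ c {A B : Alg n} {b} → acceptProb A f ≤ b → acceptProb B f ≤ b → acceptProb (if c then A else B) f ≤ b
  acceptProb-if≤ true  hA hB = hA
  acceptProb-if≤ false hA hB = hB

  acceptProb-drawBlocks≤ : ∀ ρ m k {b} → (∀ π → acceptProb (k π) f ≤ b) → acceptProb (drawBlocks ρ m k) f ≤ b
  acceptProb-drawBlocks≤ ρ zero    k h = h []
  acceptProb-drawBlocks≤ ρ (suc m) k h = acceptProb-draw≤ f ρ _ λ b → acceptProb-drawBlocks≤ ρ m _ λ π → h _

  acceptProb-search≤ : ∀ ρ lo h a k {b} → (∀ i → acceptProb (k i) f ≤ b) → acceptProb (search ρ lo h a k) f ≤ b
  acceptProb-search≤ zero    lo h a k g = g lo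
  acceptProb-search≤ (suc ρ) lo h a k g with a xor f (h (lo ℕ.+ 2 ℕ.^ ρ))
  ... | true  = acceptProb-search≤ ρ lo h a k g
  ... | false = acceptProb-search≤ ρ (lo ℕ.+ 2 ℕ.^ ρ) h _ k g

  acceptProb-asBlock≤ : ∀ R i k {b} → 0ℚ ≤ b → (∀ i → acceptProb (k i) f ≤ b) → acceptProb (asBlock R i k) f ≤ b
  acceptProb-asBlock≤ R i k b≥0 g with i ℕ.<? R
  ... | yes i<R = g _
  ... | no _    = b≥0

  acceptProb-learn≤ : ∀ {K s} m (cs : List (Circuit K s)) pt k {b} → 0ℚ ≤ b → (∀ c → acceptProb (k c) f ≤ b) →
    acceptProb (learn m cs pt k) f ≤ b
  acceptProb-learn≤ zero    []      pt k b≥0 g = b≥0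
  acceptProb-learn≤ zero    (c ∷ _) pt k b≥0 g = g c
  acceptProb-learn≤ {K} (suc m) cs  pt k b≥0 g = acceptProb-draw≤ f K _ λ y → acceptProb-learn≤ m _ pt k b≥0 g

  module _ (ρ : ℕ) (π : Vec (Fin (2 ℕ.^ ρ)) n) (q : ℕ) where
    open Find ρ π q

    private
      R : ℕ
      R = 2 ℕ.^ ρ

    acceptProb-find≤ : ∀ p j {K} (es : Vec (Entry R) K) (k : ∀ K → Vec (Entry R) K → Alg n) {b} → 0ℚ ≤ b →
      (∀ K′ → K′ ℕ.≤ p ℕ.+ K → ∀ es → acceptProb (k K′ es) f ≤ b) → acceptProb (find p j es k) f ≤ b
    acceptProb-find≤ zero    j       {K} es k b≥0 g = g K ℕₚ.≤-refl es
    acceptProb-find≤ (suc p) zero    {K} es k b≥0 g = g K (ℕₚ.m≤n+m K (suc p)) es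
    acceptProb-find≤ (suc p) (suc j) {K} es k {b} b≥0 g = acceptProb-draw≤ f R _ λ w → acceptProb-draw≤ f R _ λ w′ →
      acceptProb-if≤ (f (spread π (hybrid es w w′ 0)) xor f (spread π (hybrid es w w′ R)))
        (acceptProb-search≤ ρ 0 _ _ _ λ i → acceptProb-asBlock≤ R i _ b≥0 λ b →
          acceptProb-find≤ p q ((b , hybrid es w w′ i) ∷ es) k b≥0 λ K′ le → g K′ (subst (K′ ℕ.≤_) (ℕₚ.+-suc p K) le))
        (acceptProb-find≤ (suc p) j es k b≥0 g)

  -- The bound on the final check is uniform over partitions, entries and circuits, so it passes
  -- through the random and adaptive choices as a maximum. Of the search only `K ≤ p` is used, to
  -- obtain 4K ≤ h.
  tester-sound : ∀ {s} ρ p q m h E .{{_ : ℕ.NonZero E}} .{{_ : ℕ.NonZero h}} (cands : Candidates s) →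
    96 ℕ.≤ h → p ℕ.* 4 ℕ.≤ h →
    (∀ {m} → m ℕ.≤ s → (C : Circuit n m) → inv E ≤ M n (λ x → ⟦ f x xor eval C x ⟧)) →
    acceptProb (Tester.tester n s ρ p q m h E cands) f ≤ inv 3
  tester-sound {s} ρ p q m h E cands 96≤h 4p≤h far =
    acceptProb-drawBlocks≤ ρ n _ λ π → acceptProb-find≤ ρ π q p q [] _ (inv≥0 3) λ K K≤p es →
      acceptProb-draw≤ f (2 ℕ.^ ρ) _ λ v → acceptProb-learn≤ m (cands K) _ _ (inv≥0 3) λ C →
        check-sound f E h far 96≤h
          (ℕₚ.≤-trans (ℕₚ.*-monoˡ-≤ 4 (subst (K ℕ.≤_) (ℕₚ.+-identityʳ p) K≤p)) 4p≤h)
          (Vec.map (probe π) es) ℕₚ.≤-refl C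

-- Number of queries

record Uses {n} (A : Alg n) (Q : ℕ) : Set where
  constructor uses
  field bound : queries A ℕ.≤ Q
open Uses

module _ {n : ℕ} where

  relax : ∀ {A : Alg n} {Q Q′} → Uses A Q → Q ℕ.≤ Q′ → Uses A Q′
  relax (uses h) le = uses (ℕₚ.≤-trans h le)

  uses-query : ∀ {x} {k : Bool → Alg n} {Q} → (∀ b → Uses (k b) Q) → Uses (query x k) (suc Q)
  uses-query h = uses (ℕ.s≤s (ℕₚ.⊔-lub (bound (h false)) (bound (h true))))

  uses-draw : ∀ m {k : Vec Bool m → Alg n} {Q} → (∀ x → Uses (k x) Q) → Uses (draw m k) Q
  uses-draw zero    h = h []
  uses-draw (suc m) h = uses (ℕₚ.⊔-lub (bound (uses-draw m λ x → h _)) (bound (uses-draw m λ x → h _)))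

  uses-if : ∀ c {A B : Alg n} {Q} → Uses A Q → Uses B Q → Uses (if c then A else B) Q
  uses-if true  hA hB = hA
  uses-if false hA hB = hB

  uses-iterate : ∀ {F : Alg n → Alg n} {a} → (∀ {k Q} → Uses k Q → Uses (F k) (a ℕ.+ Q)) →
    ∀ q {k Q} → Uses k Q → Uses (iterate q F k) (q ℕ.* a ℕ.+ Q)
  uses-iterate h zero        g = g
  uses-iterate {a = a} h (suc q) {Q = Q} g = relax (h (uses-iterate h q g)) (ℕₚ.≤-reflexive (sym (ℕₚ.+-assoc a (q ℕ.* a) Q)))

  uses-guard : ∀ b {k : Alg n} {Q} → Uses k Q → Uses (guard b k) Q
  uses-guard b h = uses-if b (uses ℕ.z≤n) h

  uses-affineTest : ∀ P {k Q} → Uses k Q → Uses (affineTest P k) (4 ℕ.+ Q)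
  uses-affineTest P h = uses-draw n λ a → uses-draw n λ b → uses-draw n λ c →
    uses-query λ u → uses-query λ v → uses-query λ w → uses-query λ t → uses-guard ((u xor v) xor (w xor t)) h

  uses-andTest : ∀ P {k Q} → Uses k Q → Uses (andTest P k) (6 ℕ.+ Q)
  uses-andTest P h = uses-draw n λ x → uses-draw n λ y → uses-draw n λ z₁ → uses-draw n λ z₂ → uses-draw n λ z₃ →
    uses-query λ a → uses-query λ b → uses-query λ c → uses-query λ d → uses-query λ e → uses-query λ g →
    uses-guard ((a xor b) xor ((c xor d) ∧ (e xor g))) h

  uses-oneTest : ∀ P {k Q} → Uses k Q → Uses (oneTest P k) (2 ℕ.+ Q)
  uses-oneTest P h = uses-draw n λ z → uses-query λ a → uses-query λ b → uses-guard (not (a xor b)) h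

  -- 104 is 16 · 6 for the AND tests plus 4 · 2 for the unit tests.
  uses-dictatorTests : ∀ q {K} (Ps : Vec (Probe n) K) {k Q} → Uses k Q →
    Uses (dictatorTests q Ps k) (K ℕ.* (q ℕ.* 4 ℕ.+ 104) ℕ.+ Q)
  uses-dictatorTests q []       h = h
  uses-dictatorTests q {suc K} (P ∷ Ps) {Q = Q} h = relax
    (uses-iterate (uses-affineTest P) q (uses-iterate (uses-andTest P) 16 (uses-iterate (uses-oneTest P) 4 (uses-dictatorTests q Ps h))))
    (ℕₚ.≤-reflexive (trans (sym (ℕₚ.+-assoc (q ℕ.* 4) 104 (B ℕ.+ Q))) (sym (ℕₚ.+-assoc (q ℕ.* 4 ℕ.+ 104) B Q))))
    where B = K ℕ.* (q ℕ.* 4 ℕ.+ 104)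

  uses-decode : ∀ {K} (Ps : Vec (Probe n) K) {x} {k : Vec Bool K → Alg n} {Q} → (∀ y → Uses (k y) Q) →
    Uses (decode Ps x k) (K ℕ.* 2 ℕ.+ Q)
  uses-decode []       h = h []
  uses-decode (P ∷ Ps) h = uses-draw n λ z → uses-query λ a → uses-query λ b → uses-decode Ps λ y → h _

  uses-verify : ∀ {K} (Ps : Vec (Probe n) K) c {k Q} → Uses k Q → Uses (verify Ps c k) (suc (K ℕ.* 2) ℕ.+ Q)
  uses-verify Ps c h = uses-draw n λ x → uses-query λ a → uses-decode Ps λ y → uses-guard (a xor c y) h

  uses-drawBlocks : ∀ ρ m {k Q} → (∀ π → Uses (k π) Q) → Uses (drawBlocks {n} ρ m k) Q
  uses-drawBlocks ρ zero    h = h []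
  uses-drawBlocks ρ (suc m) h = uses-draw ρ λ b → uses-drawBlocks ρ m λ π → h _

  uses-search : ∀ ρ lo h a {k : ℕ → Alg n} {Q} → (∀ i → Uses (k i) Q) → Uses (search ρ lo h a k) (ρ ℕ.+ Q)
  uses-search zero    lo h a g = g lo
  uses-search (suc ρ) lo h a g = uses-query λ b → uses-if (a xor b) (uses-search ρ lo h a g) (uses-search ρ _ h b g)

  uses-asBlock : ∀ R i {k : Fin R → Alg n} {Q} → (∀ b → Uses (k b) Q) → Uses (asBlock R i k) Q
  uses-asBlock R i g with i ℕ.<? R
  ... | yes _ = g _
  ... | no _  = uses ℕ.z≤n

  uses-learn : ∀ {K s} m (cs : List (Circuit K s)) {pt} {k : Circuit K s → Alg n} {Q} → (∀ c → Uses (k c) Q) →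
    Uses (learn m cs pt k) (m ℕ.+ Q)
  uses-learn zero    []      g = uses ℕ.z≤n
  uses-learn zero    (c ∷ _) g = g c
  uses-learn {K} (suc m) cs  g = uses-draw K λ y → uses-query λ a → uses-learn m _ g

  module _ (ρ : ℕ) (π : Vec (Fin (2 ℕ.^ ρ)) n) (q : ℕ) where
    open Find ρ π q

    -- The potential `j + p * q` counts the attempts still possible, each costing two end points and
    -- at most `ρ` search queries. A success replaces the attempts left over by `q` new ones, paid
    -- for by lowering `p`.
    uses-find : ∀ p j {K} (es : Vec (Entry (2 ℕ.^ ρ)) K) {k : ∀ K → Vec (Entry (2 ℕ.^ ρ)) K → Alg n} {Q} →
      (∀ K′ → K′ ℕ.≤ p ℕ.+ K → ∀ es → Uses (k K′ es) Q) → Uses (find p j es k) ((j ℕ.+ p ℕ.* q) ℕ.* (2 ℕ.+ ρ) ℕ.+ Q)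
    uses-find zero    j       {K} es g = relax (g K ℕₚ.≤-refl es) (ℕₚ.m≤n+m _ ((j ℕ.+ 0) ℕ.* (2 ℕ.+ ρ)))
    uses-find (suc p) zero    {K} es g = relax (g K (ℕₚ.m≤n+m K (suc p)) es) (ℕₚ.m≤n+m _ (suc p ℕ.* q ℕ.* (2 ℕ.+ ρ)))
    uses-find (suc p) (suc j) {K} es {k} {Q} g = relax
      (uses-draw (2 ℕ.^ ρ) λ w → uses-draw (2 ℕ.^ ρ) λ w′ → uses-query λ a → uses-query λ b → uses-if (a xor b)
        (uses-search ρ 0 _ a λ i → uses-asBlock (2 ℕ.^ ρ) i λ b → relax
          (uses-find p q ((b , hybrid es w w′ i) ∷ es) (λ K′ le → g K′ (subst (K′ ℕ.≤_) (ℕₚ.+-suc p K) le)))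
          (ℕₚ.+-monoˡ-≤ Q (ℕₚ.*-monoˡ-≤ (2 ℕ.+ ρ) (ℕₚ.m≤n+m (suc p ℕ.* q) j))))
        (relax (uses-find (suc p) j es g) (ℕₚ.m≤n+m _ ρ)))
      (ℕₚ.≤-reflexive (cong (2 ℕ.+_) (sym (ℕₚ.+-assoc ρ ((j ℕ.+ suc p ℕ.* q) ℕ.* (2 ℕ.+ ρ)) Q))))

  queries-tester≤ : ∀ s ρ p q m h E (cands : Candidates s) →
    queries (Tester.tester n s ρ p q m h E cands)
      ℕ.≤ (q ℕ.+ p ℕ.* q) ℕ.* (2 ℕ.+ ρ) ℕ.+ (m ℕ.+ (p ℕ.* (2 ℕ.* h ℕ.* 4 ℕ.+ 104) ℕ.+ 4 ℕ.* E ℕ.* suc (p ℕ.* 2)))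
  queries-tester≤ s ρ p q m h E cands = bound
    (uses-drawBlocks ρ n λ π → uses-find ρ π q p q [] λ K K≤p es →
      uses-draw (2 ℕ.^ ρ) λ v → uses-learn m (cands K) λ C → check-uses (subst (K ℕ.≤_) (ℕₚ.+-identityʳ p) K≤p) (Vec.map (probe π) es) C)
    where
    open Tester n s ρ p q m h E cands
    check-uses : ∀ {K} → K ℕ.≤ p → ∀ Ps C → Uses (check {K} Ps C) (p ℕ.* (2 ℕ.* h ℕ.* 4 ℕ.+ 104) ℕ.+ 4 ℕ.* E ℕ.* suc (p ℕ.* 2))
    check-uses {K} K≤p Ps C = relax
      (uses-dictatorTests (2 ℕ.* h) Ps (uses-iterate (uses-verify Ps (eval C)) (4 ℕ.* E) (uses ℕ.z≤n)))
      (ℕₚ.≤-trans (ℕₚ.≤-reflexive (cong (K ℕ.* (2 ℕ.* h ℕ.* 4 ℕ.+ 104) ℕ.+_) (ℕₚ.+-identityʳ _)))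
        (ℕₚ.+-mono-≤ (ℕₚ.*-monoˡ-≤ (2 ℕ.* h ℕ.* 4 ℕ.+ 104) K≤p) (ℕₚ.*-monoʳ-≤ (4 ℕ.* E) (ℕ.s≤s (ℕₚ.*-monoˡ-≤ 2 K≤p)))))

-- Learning a circuit from samples

n≤2^n : ∀ n → n ℕ.≤ 2 ℕ.^ n
n≤2^n zero    = ℕ.z≤n
n≤2^n (suc n) = ℕₚ.+-mono-≤ (ℕₚ.m^n>0 2 n) (ℕₚ.≤-trans (n≤2^n n) (ℕₚ.m≤m+n (2 ℕ.^ n) 0))

sublists : ∀ {A : Set} → List A → List (List A)
sublists []       = [] ∷ []
sublists (x ∷ xs) = List.map (x ∷_) (sublists xs) ++ sublists xs

length-sublists : ∀ {A : Set} (xs : List A) → length (sublists xs) ≡ 2 ℕ.^ length xs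
length-sublists []       = refl
length-sublists (x ∷ xs) = trans (Listₚ.length-++ (List.map (x ∷_) (sublists xs)))
  (cong₂ ℕ._+_ (trans (Listₚ.length-map (x ∷_) (sublists xs)) (length-sublists xs))
               (trans (length-sublists xs) (sym (ℕₚ.+-identityʳ (2 ℕ.^ length xs)))))

filter∈sublists : ∀ {A : Set} {P : A → Set} (P? : Decidable P) xs → List.filter P? xs ∈ sublists xs
filter∈sublists P? []       = here refl
filter∈sublists P? (x ∷ xs) with does (P? x)
... | true  = ∈ₚ.∈-++⁺ˡ (∈ₚ.∈-map⁺ (x ∷_) (filter∈sublists P? xs))
... | false = ∈ₚ.∈-++⁺ʳ (List.map (x ∷_) (sublists xs)) (filter∈sublists P? xs)

all-⊆ : ∀ {A : Set} (p : A → Bool) xs {ys} → (∀ {x} → x ∈ xs → x ∈ ys) → all p ys ≡ true → all p xs ≡ true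
all-⊆ p []       sub h = refl
all-⊆ p (x ∷ xs) sub h = cong₂ _∧_ (pick (sub (here refl)) h) (all-⊆ p xs (sub ∘ there) h)
  where
  pick : ∀ {ys} → x ∈ ys → all p ys ≡ true → p x ≡ true
  pick {y ∷ ys} (here refl) h with p y
  ... | true = refl
  pick {y ∷ ys} (there m) h with p y
  ... | true = pick m h

any-⊆ : ∀ {A : Set} (p : A → Bool) xs {ys} → (∀ {x} → x ∈ xs → x ∈ ys) → any p xs ≡ true → any p ys ≡ true
any-⊆ p (x ∷ xs) sub h with p x in eq
... | false = any-⊆ p xs (sub ∘ there) h
... | true  = pick (sub (here refl)) eq
  where
  pick : ∀ {x ys} → x ∈ ys → p x ≡ true → any p ys ≡ true
  pick (here refl) e rewrite e = refl
  pick {ys = y ∷ ys} (there m) e rewrite pick m e = Boolₚ.∨-zeroʳ (p y)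

⇔⇒≡ : ∀ {a b} → (a ≡ true → b ≡ true) → (b ≡ true → a ≡ true) → a ≡ b
⇔⇒≡ {true}          f g = sym (f refl)
⇔⇒≡ {false} {true}  f g = g refl
⇔⇒≡ {false} {false} f g = refl

module _ (K m : ℕ) where

  allWires : List (Wire K m)
  allWires = List.map inj₁ (List.allFin K) ++ inj₂ (inj₁ true) ∷ inj₂ (inj₁ false) ∷ List.map (inj₂ ∘ inj₂) (List.allFin m)

  -- Fan-in lists may repeat wires and have any length, but AND and OR see only the set of wires, so
  -- sublists of `allWires` represent every gate up to its value.
  allGates : List (Gate K m)
  allGates = List.map AND (sublists allWires) ++ List.map OR (sublists allWires) ++ List.map NOT allWires

  length-allWires : length allWires ≡ K ℕ.+ m ℕ.+ 2
  length-allWires = begin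
    length allWires
      ≡⟨ Listₚ.length-++ (List.map inj₁ (List.allFin K)) ⟩
    length {A = Wire K m} (List.map inj₁ (List.allFin K)) ℕ.+ (2 ℕ.+ length {A = Wire K m} (List.map (inj₂ ∘ inj₂) (List.allFin m)))
      ≡⟨ cong₂ (λ a b → a ℕ.+ (2 ℕ.+ b)) (trans (Listₚ.length-map inj₁ (List.allFin K)) (Listₚ.length-tabulate id))
                                         (trans (Listₚ.length-map (inj₂ ∘ inj₂) (List.allFin m)) (Listₚ.length-tabulate id)) ⟩
    K ℕ.+ (2 ℕ.+ m)     ≡⟨ cong (K ℕ.+_) (ℕₚ.+-comm 2 m) ⟩
    K ℕ.+ (m ℕ.+ 2)     ≡⟨ sym (ℕₚ.+-assoc K m 2) ⟩
    K ℕ.+ m ℕ.+ 2       ∎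
    where open ≡-Reasoning

  ∈-allWires : ∀ w → w ∈ allWires
  ∈-allWires (inj₁ i)            = ∈ₚ.∈-++⁺ˡ (∈ₚ.∈-map⁺ inj₁ (∈ₚ.∈-allFin i))
  ∈-allWires (inj₂ (inj₁ true))  = ∈ₚ.∈-++⁺ʳ (List.map inj₁ (List.allFin K)) (here refl)
  ∈-allWires (inj₂ (inj₁ false)) = ∈ₚ.∈-++⁺ʳ (List.map inj₁ (List.allFin K)) (there (here refl))
  ∈-allWires (inj₂ (inj₂ j))     = ∈ₚ.∈-++⁺ʳ (List.map inj₁ (List.allFin K)) (there (there (∈ₚ.∈-map⁺ (inj₂ ∘ inj₂) (∈ₚ.∈-allFin j))))

  length-allGates : length allGates ℕ.≤ 2 ℕ.^ (K ℕ.+ m ℕ.+ 4)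
  length-allGates = begin
    length allGates                         ≡⟨ Listₚ.length-++ (List.map AND S) ⟩
    length (List.map AND S) ℕ.+ length (List.map OR S ++ List.map NOT allWires)
      ≡⟨ cong₂ ℕ._+_ (Listₚ.length-map AND S) (Listₚ.length-++ (List.map OR S)) ⟩
    length S ℕ.+ (length (List.map OR S) ℕ.+ length (List.map NOT allWires))
      ≡⟨ cong (length S ℕ.+_) (cong₂ ℕ._+_ (Listₚ.length-map OR S) (Listₚ.length-map NOT allWires)) ⟩
    length S ℕ.+ (length S ℕ.+ length allWires)
      ≡⟨ cong₂ (λ a b → a ℕ.+ (a ℕ.+ b)) (trans (length-sublists allWires) (cong (2 ℕ.^_) length-allWires)) length-allWires ⟩
    N ℕ.+ (N ℕ.+ w)                         ≤⟨ ℕₚ.+-monoʳ-≤ N (ℕₚ.+-monoʳ-≤ N (ℕₚ.≤-trans (n≤2^n w) (ℕₚ.m≤m+n N (N ℕ.+ 0)))) ⟩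
    N ℕ.+ (N ℕ.+ (N ℕ.+ (N ℕ.+ 0)))         ≡⟨ trans (ℕₚ.*-comm 4 N) (sym (ℕₚ.^-distribˡ-+-* 2 w 2)) ⟩
    2 ℕ.^ (w ℕ.+ 2)                         ≡⟨ cong (2 ℕ.^_) (ℕₚ.+-assoc (K ℕ.+ m) 2 2) ⟩
    2 ℕ.^ (K ℕ.+ m ℕ.+ 4)                   ∎
    where
    open ℕₚ.≤-Reasoning
    S = sublists allWires
    w = K ℕ.+ m ℕ.+ 2
    N = 2 ℕ.^ w

allCircuitGates : ∀ K m → List (Gates K m)
allCircuitGates K zero    = [] ∷ []
allCircuitGates K (suc m) = cartesianProductWith _▷_ (allCircuitGates K m) (allGates K m)

allCircuits : ∀ s K → List (Circuit K s)
allCircuits s K = cartesianProductWith circuit (allCircuitGates K s) (allWires K s)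

length-× : ∀ {A B C : Set} (g : A → B → C) xs ys → length (cartesianProductWith g xs ys) ≡ length xs ℕ.* length ys
length-× g []       ys = refl
length-× g (x ∷ xs) ys = trans (Listₚ.length-++ (List.map (g x) ys)) (cong₂ ℕ._+_ (Listₚ.length-map (g x) ys) (length-× g xs ys))

-- Each of the s gates and the root has at most 2^(K+s+4) choices. With K = Õ(s) the exponent is
-- Õ(s²), which the number of learning samples inherits.
length-allCircuits : ∀ s K → length (allCircuits s K) ℕ.≤ 2 ℕ.^ (suc s ℕ.* (K ℕ.+ s ℕ.+ 4))
length-allCircuits s K = begin
  length (allCircuits s K)        ≡⟨ length-× circuit (allCircuitGates K s) (allWires K s) ⟩
  length (allCircuitGates K s) ℕ.* length (allWires K s)
    ≤⟨ ℕₚ.*-mono-≤ (go s ℕₚ.≤-refl) (ℕₚ.≤-trans (ℕₚ.≤-reflexive (length-allWires K s))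
         (ℕₚ.≤-trans (ℕₚ.+-monoʳ-≤ (K ℕ.+ s) (ℕ.s≤s (ℕ.s≤s ℕ.z≤n))) (n≤2^n B))) ⟩
  2 ℕ.^ (s ℕ.* B) ℕ.* 2 ℕ.^ B     ≡⟨ sym (ℕₚ.^-distribˡ-+-* 2 (s ℕ.* B) B) ⟩
  2 ℕ.^ (s ℕ.* B ℕ.+ B)           ≡⟨ cong (2 ℕ.^_) (ℕₚ.+-comm (s ℕ.* B) B) ⟩
  2 ℕ.^ (suc s ℕ.* B)             ∎
  where
  open ℕₚ.≤-Reasoning
  B = K ℕ.+ s ℕ.+ 4
  go : ∀ m → m ℕ.≤ s → length (allCircuitGates K m) ℕ.≤ 2 ℕ.^ (m ℕ.* B)
  go zero    _  = ℕₚ.≤-refl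
  go (suc m) le = begin
    length (allCircuitGates K (suc m))                        ≡⟨ length-× _▷_ (allCircuitGates K m) (allGates K m) ⟩
    length (allCircuitGates K m) ℕ.* length (allGates K m)    ≤⟨ ℕₚ.*-mono-≤ (go m (ℕₚ.<⇒≤ le)) (ℕₚ.≤-trans (length-allGates K m)
                                                                   (ℕₚ.^-monoʳ-≤ 2 (ℕₚ.+-monoˡ-≤ 4 (ℕₚ.+-monoʳ-≤ K (ℕₚ.<⇒≤ le))))) ⟩
    2 ℕ.^ (m ℕ.* B) ℕ.* 2 ℕ.^ B                               ≡⟨ sym (ℕₚ.^-distribˡ-+-* 2 (m ℕ.* B) B) ⟩
    2 ℕ.^ (m ℕ.* B ℕ.+ B)                                     ≡⟨ cong (2 ℕ.^_) (ℕₚ.+-comm (m ℕ.* B) B) ⟩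
    2 ℕ.^ (suc m ℕ.* B)                                       ∎

module _ {K : ℕ} where

  _≟ʷ_ : ∀ {m} (v w : Wire K m) → Dec (v ≡ w)
  _≟ʷ_ = Sumₚ.≡-dec Fin._≟_ (Sumₚ.≡-dec Boolₚ._≟_ Fin._≟_)

  module _ {m : ℕ} where
    open DecMem (_≟ʷ_ {m}) using (_∈?_)

    canonical : List (Wire K m) → List (Wire K m)
    canonical ws = List.filter (_∈? ws) (allWires K m)

    canonical⊆ : ∀ ws {w} → w ∈ canonical ws → w ∈ ws
    canonical⊆ ws w∈ = proj₂ (∈ₚ.∈-filter⁻ (_∈? ws) {xs = allWires K m} w∈)

    ⊆canonical : ∀ ws {w} → w ∈ ws → w ∈ canonical ws
    ⊆canonical ws {w} w∈ = ∈ₚ.∈-filter⁺ (_∈? ws) (∈-allWires K _ w) w∈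

    canonicalGate : Gate K m → Gate K m
    canonicalGate (AND ws) = AND (canonical ws)
    canonicalGate (OR ws)  = OR (canonical ws)
    canonicalGate (NOT w)  = NOT w

    gateVal-canonical : ∀ x vs g → gateVal x vs (canonicalGate g) ≡ gateVal x vs g
    gateVal-canonical x vs (AND ws) = ⇔⇒≡ (all-⊆ _ ws (⊆canonical ws)) (all-⊆ _ (canonical ws) (canonical⊆ ws))
    gateVal-canonical x vs (OR ws)  = ⇔⇒≡ (any-⊆ _ (canonical ws) (canonical⊆ ws)) (any-⊆ _ ws (⊆canonical ws))
    gateVal-canonical x vs (NOT w)  = refl

    canonicalGate∈ : ∀ g → canonicalGate g ∈ allGates K m
    canonicalGate∈ (AND ws) = ∈ₚ.∈-++⁺ˡ (∈ₚ.∈-map⁺ AND (filter∈sublists (_∈? ws) (allWires K m)))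
    canonicalGate∈ (OR ws)  = ∈ₚ.∈-++⁺ʳ (List.map AND (sublists (allWires K m))) (∈ₚ.∈-++⁺ˡ (∈ₚ.∈-map⁺ OR (filter∈sublists (_∈? ws) (allWires K m))))
    canonicalGate∈ (NOT w)  = ∈ₚ.∈-++⁺ʳ (List.map AND (sublists (allWires K m))) (∈ₚ.∈-++⁺ʳ (List.map OR (sublists (allWires K m))) (∈ₚ.∈-map⁺ NOT (∈-allWires K m w)))

  canonicalGates : ∀ {m} → Gates K m → Gates K m
  canonicalGates []       = []
  canonicalGates (gs ▷ g) = canonicalGates gs ▷ canonicalGate g

  gateVals-canonical : ∀ {m} (gs : Gates K m) x → gateVals (canonicalGates gs) x ≡ gateVals gs x
  gateVals-canonical []       x = refl
  gateVals-canonical (gs ▷ g) x rewrite gateVals-canonical gs x = cong (gateVals gs x ∷ʳ_) (gateVal-canonical x _ g)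

  canonicalGates∈ : ∀ {m} (gs : Gates K m) → canonicalGates gs ∈ allCircuitGates K m
  canonicalGates∈ []       = here refl
  canonicalGates∈ (gs ▷ g) = ∈ₚ.∈-cartesianProductWith⁺ _▷_ (canonicalGates∈ gs) (canonicalGate∈ g)

  weakenWire : ∀ {m} → Wire K m → Wire K (suc m)
  weakenWire (inj₁ i)        = inj₁ i
  weakenWire (inj₂ (inj₁ b)) = inj₂ (inj₁ b)
  weakenWire (inj₂ (inj₂ j)) = inj₂ (inj₂ (Fin.inject₁ j))

  -- The enumeration holds circuits with exactly `s` gates. Appending the constant gate `AND []`
  -- leaves all earlier outputs in place.
  padCircuit : ∀ {m s} → m ℕ.≤′ s → Circuit K m → Circuit K s
  padCircuit (ℕ.≤′-reflexive refl) C = C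
  padCircuit (ℕ.≤′-step le) C with padCircuit le C
  ... | circuit gs r = circuit (gs ▷ AND []) (weakenWire r)

  lookup-∷ʳ-inject₁ : ∀ {m} (vs : Vec Bool m) b j → lookup (vs ∷ʳ b) (Fin.inject₁ j) ≡ lookup vs j
  lookup-∷ʳ-inject₁ (v ∷ vs) b Fin.zero    = refl
  lookup-∷ʳ-inject₁ (v ∷ vs) b (Fin.suc j) = lookup-∷ʳ-inject₁ vs b j

  eval-pad : ∀ {m s} (le : m ℕ.≤′ s) (C : Circuit K m) x → eval (padCircuit le C) x ≡ eval C x
  eval-pad (ℕ.≤′-reflexive refl) C x = refl
  eval-pad (ℕ.≤′-step le) C x with padCircuit le C | eval-pad le C x
  ... | circuit gs (inj₁ i)        | ih = ih
  ... | circuit gs (inj₂ (inj₁ b)) | ih = ih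
  ... | circuit gs (inj₂ (inj₂ j)) | ih = trans (lookup-∷ʳ-inject₁ (gateVals gs x) true j) ih

  allCircuits-complete : ∀ {m s} → m ℕ.≤ s → (C : Circuit K m) →
    Σ (Circuit K s) λ c → c ∈ allCircuits s K × (∀ x → eval c x ≡ eval C x)
  allCircuits-complete {s = s} le C =
    circuit (canonicalGates gs) r
    , ∈ₚ.∈-cartesianProductWith⁺ circuit (canonicalGates∈ gs) (∈-allWires K s r)
    , λ x → trans (cong (λ vs → wireVal x vs r) (gateVals-canonical gs x)) (eval-pad (ℕₚ.≤⇒≤′ le) C x)
    where open Circuit (padCircuit (ℕₚ.≤⇒≤′ le) C) renaming (gates to gs; root to r)

-- Inaccurate candidates do not survive sampling

opaque
  -- Opaque, with `exceeds-split` as interface, so that proofs rewrite an atomic Boolean rather than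
  -- a decision procedure on ℚ.
  exceeds : ℚ → ℚ → Bool
  exceeds p q = not (does (p ℚₚ.≤? q))

  exceeds-split : ∀ p q → (exceeds p q ≡ false × p ≤ q) ⊎ (exceeds p q ≡ true × q ≤ p)
  exceeds-split p q = go (p ℚₚ.≤? q)
    where
    go : (d : Dec (p ≤ q)) → (not (does d) ≡ false × p ≤ q) ⊎ (not (does d) ≡ true × q ≤ p)
    go (yes p≤q) = inj₁ (refl , p≤q)
    go (no p≰q)  = inj₂ (refl , ℚₚ.<⇒≤ (ℚₚ.≰⇒> p≰q))

module Learning {n K s : ℕ} (f : BoolFn n) (pt : Vec Bool K → Input n) where

  target : BoolFn K
  target y = f (pt y)

  err : Circuit K s → ℚ
  err c = M K λ y → ⟦ eval c y xor target y ⟧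

  consistent : Vec Bool K → List (Circuit K s) → List (Circuit K s)
  consistent y = List.filterᵇ (λ c → not (eval c y xor target y))

  Computes : Circuit K s → Set
  Computes c = ∀ y → eval c y ≡ target y

  consistent-keeps : ∀ y {cs} → Any Computes cs → Any Computes (consistent y cs)
  consistent-keeps y {c ∷ cs} (here h) rewrite h y | Boolₚ.xor-same (target y) = here h
  consistent-keeps y {c ∷ cs} (there a) with not (eval c y xor target y)
  ... | true  = there (consistent-keeps y a)
  ... | false = consistent-keeps y a

  module _ {δ : ℚ} (0≤δ : 0ℚ ≤ δ) (δ≤1 : δ ≤ 1ℚ) where

    poor : Circuit K s → Bool
    poor c = exceeds (err c) δ

    #poor : List (Circuit K s) → ℚ
    #poor []       = 0ℚ
    #poor (c ∷ cs) = ⟦ poor c ⟧ + #poor cs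

    #poor≥0 : ∀ cs → 0ℚ ≤ #poor cs
    #poor≥0 []       = ℚₚ.≤-refl
    #poor≥0 (c ∷ cs) = 0≤+ (⟦⟧≥0 (poor c)) (#poor≥0 cs)

    #poor≤length : ∀ cs → #poor cs ≤ ι (length cs)
    #poor≤length []       = ℚₚ.≤-refl
    #poor≤length (c ∷ cs) = ℚₚ.≤-trans (ℚₚ.+-mono-≤ (⟦⟧≤1 (poor c)) (#poor≤length cs)) (ℚₚ.≤-reflexive (sym (ι-suc (length cs))))

    -- By linearity of the mean: a candidate of error above δ survives one random sample with
    -- probability at most 1 - δ.
    #poor-consistent : ∀ cs → M K (λ y → #poor (consistent y cs)) ≤ #poor cs * (1ℚ - δ)
    #poor-consistent [] = ℚₚ.≤-reflexive (trans (M-const K 0ℚ) (sym (ℚₚ.*-zeroˡ (1ℚ - δ))))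
    #poor-consistent (c ∷ cs) = begin
      M K (λ y → #poor (consistent y (c ∷ cs)))
        ≡⟨ M-cong K split ⟩
      M K (λ y → ⟦ poor c ⟧ * (1ℚ - wrong y) + #poor (consistent y cs))
        ≡⟨ M-+ K (λ y → ⟦ poor c ⟧ * (1ℚ - wrong y)) (λ y → #poor (consistent y cs)) ⟩
      M K (λ y → ⟦ poor c ⟧ * (1ℚ - wrong y)) + M K (λ y → #poor (consistent y cs))
        ≡⟨ cong (_+ M K (λ y → #poor (consistent y cs))) (trans (M-* K ⟦ poor c ⟧ (λ y → 1ℚ - wrong y)) (cong (⟦ poor c ⟧ *_) (M-1- K wrong))) ⟩
      ⟦ poor c ⟧ * (1ℚ - err c) + M K (λ y → #poor (consistent y cs))
        ≤⟨ ℚₚ.+-mono-≤ survives (#poor-consistent cs) ⟩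
      ⟦ poor c ⟧ * (1ℚ - δ) + #poor cs * (1ℚ - δ)
        ≡⟨ sym (ℚₚ.*-distribʳ-+ (1ℚ - δ) ⟦ poor c ⟧ (#poor cs)) ⟩
      (⟦ poor c ⟧ + #poor cs) * (1ℚ - δ) ∎
      where
      open ℚₚ.≤-Reasoning
      wrong : Vec Bool K → ℚ
      wrong y = ⟦ eval c y xor target y ⟧
      split : ∀ y → #poor (consistent y (c ∷ cs)) ≡ ⟦ poor c ⟧ * (1ℚ - wrong y) + #poor (consistent y cs)
      split y with eval c y xor target y
      ... | true  = solve 2 (λ p r → r := p :* (con 1ℚ :- con 1ℚ) :+ r) refl ⟦ poor c ⟧ (#poor (consistent y cs))
      ... | false = solve 2 (λ p r → p :+ r := p :* (con 1ℚ :- con 0ℚ) :+ r) refl ⟦ poor c ⟧ (#poor (consistent y cs))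
      survives : ⟦ poor c ⟧ * (1ℚ - err c) ≤ ⟦ poor c ⟧ * (1ℚ - δ)
      survives with exceeds-split (err c) δ
      ... | inj₁ (eq , _) rewrite eq = ℚₚ.≤-reflexive (trans (ℚₚ.*-zeroˡ (1ℚ - err c)) (sym (ℚₚ.*-zeroˡ (1ℚ - δ))))
      ... | inj₂ (eq , δ≤) rewrite eq = *-monoˡ 1ℚ 0≤1 (ℚₚ.+-monoʳ-≤ 1ℚ (ℚₚ.neg-antimono-≤ δ≤))

    module _ (k : Circuit K s → Alg n) {A t : ℚ} (0≤A : 0ℚ ≤ A) (0≤t : 0ℚ ≤ t) (k≤ : ∀ c → rejectProb (k c) f ≤ A + t * err c) where

      -- Two invariants meet: an exact candidate is never filtered out, and the expected number of
      -- poor ones shrinks by 1 - δ per sample. In the end the head is accurate, costing t · δ, or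
      -- it is poor and the number of poor candidates, then at least 1, exceeds any rejection
      -- probability.
      rejectProb-learn : ∀ m {cs} → Any Computes cs →
        rejectProb (learn m cs pt k) f ≤ A + t * δ + #poor cs * (1ℚ - δ) ^ m
      rejectProb-learn zero {c ∷ cs} _ = ℚₚ.≤-trans head (ℚₚ.+-monoʳ-≤ (A + t * δ)
          (ℚₚ.≤-trans (≤+ʳ (#poor≥0 cs)) (ℚₚ.≤-reflexive (sym (ℚₚ.*-identityʳ (#poor (c ∷ cs)))))))
        where
        open ℚₚ.≤-Reasoning
        head : rejectProb (k c) f ≤ A + t * δ + ⟦ poor c ⟧
        head with exceeds-split (err c) δ
        ... | inj₁ (eq , ≤δ) rewrite eq = begin
          rejectProb (k c) f       ≤⟨ k≤ c ⟩
          A + t * err c            ≤⟨ ℚₚ.+-monoʳ-≤ A (*-monoˡ t 0≤t ≤δ) ⟩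
          A + t * δ                ≡⟨ sym (ℚₚ.+-identityʳ (A + t * δ)) ⟩
          A + t * δ + 0ℚ           ∎
        ... | inj₂ (eq , _) rewrite eq = ℚₚ.≤-trans (rejectProb≤1 f (k c)) (≤+ˡ (0≤+ 0≤A (0≤* 0≤t 0≤δ)))
      rejectProb-learn (suc m) {cs} any = begin
        rejectProb (learn (suc m) cs pt k) f
          ≡⟨ rejectProb-draw f K _ ⟩
        M K (λ y → rejectProb (learn m (consistent y cs) pt k) f)
          ≤⟨ M-mono K (λ y → rejectProb-learn m (consistent-keeps y any)) ⟩
        M K (λ y → A + t * δ + #poor (consistent y cs) * P)
          ≡⟨ trans (M-+ˡ K (A + t * δ) (λ y → #poor (consistent y cs) * P)) (cong (A + t * δ +_) (M-*ʳ K (λ y → #poor (consistent y cs)) P)) ⟩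
        A + t * δ + M K (λ y → #poor (consistent y cs)) * P
          ≤⟨ ℚₚ.+-monoʳ-≤ (A + t * δ) (*-monoʳ P (^-nonneg (0≤- δ≤1) m) (#poor-consistent cs)) ⟩
        A + t * δ + #poor cs * (1ℚ - δ) * P
          ≡⟨ cong (A + t * δ +_) (ℚₚ.*-assoc (#poor cs) (1ℚ - δ) P) ⟩
        A + t * δ + #poor cs * ((1ℚ - δ) * P) ∎
        where
        open ℚₚ.≤-Reasoning
        P = (1ℚ - δ) ^ m

-- Circuits as near-juntas

infix 4 _∈ᵐ_
_∈ᵐ_ : ∀ {n} → Fin n → Vec Bool n → Set
i ∈ᵐ U = lookup U i ≡ true

Agree : ∀ {n} → Vec Bool n → Vec Bool n → Vec Bool n → Set
Agree U x y = ∀ i → i ∈ᵐ U → lookup x i ≡ lookup y i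

DependsOn : ∀ {n} {A : Set} → Vec Bool n → (Vec Bool n → A) → Set
DependsOn U F = ∀ x y → Agree U x y → F x ≡ F y

InjectiveOn : ∀ {n R} → Vec Bool n → Vec (Fin R) n → Set
InjectiveOn U π = ∀ i j → i ∈ᵐ U → j ∈ᵐ U → lookup π i ≡ lookup π j → i ≡ j

count : ∀ {n} → Vec Bool n → ℕ
count []      = 0
count (b ∷ U) = (if b then 1 else 0) ℕ.+ count U

lookup-spread : ∀ {n R} (π : Vec (Fin R) n) w i → lookup (spread π w) i ≡ lookup w (lookup π i)
lookup-spread π w i = Vecₚ.lookup-map i (lookup w) π

-- The variables of `U` lie in distinct blocks, so on a random block-constant input they are
-- independent uniform bits, and a function of them cannot notice the difference. Induction removes
-- one variable at a time by resampling its block.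
M-spread : ∀ {n R} (U : Vec Bool n) (π : Vec (Fin R) n) (F : Vec Bool n → ℚ) → DependsOn U F → InjectiveOn U π →
  M R (λ w → F (spread π w)) ≡ M n F
M-spread {R = R} [] [] F dep inj = M-const R (F [])
M-spread {suc n} {R} (false ∷ U) (b ∷ π) F dep inj = begin
  M R (λ w → F (lookup w b ∷ spread π w))        ≡⟨ M-cong R (λ w → dep _ (false ∷ spread π w) λ { (Fin.suc i) _ → refl }) ⟩
  M R (λ w → F (false ∷ spread π w))             ≡⟨ M-spread U π (F ∘ (false ∷_)) (λ x y ag → dep _ _ λ { (Fin.suc i) m → ag i m })
                                                      (λ i j mi mj eq → Finₚ.suc-injective (inj (Fin.suc i) (Fin.suc j) mi mj eq)) ⟩
  M n (F ∘ (false ∷_))                           ≡⟨ sym (½-idem _) ⟩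
  ½ * (M n (F ∘ (false ∷_)) + M n (F ∘ (false ∷_)))  ≡⟨ cong (λ e → ½ * (M n (F ∘ (false ∷_)) + e)) (M-cong n (λ x → dep _ _ λ { (Fin.suc i) _ → refl })) ⟩
  M (suc n) F                                    ∎
  where open ≡-Reasoning
M-spread {suc n} {R} (true ∷ U) (b ∷ π) F dep inj = begin
  M R (λ w → F (lookup w b ∷ spread π w))
    ≡⟨ M-set R b (λ w → F (lookup w b ∷ spread π w)) ⟩
  ½ * (M R (λ w → F (lookup (w [ b ]≔ false) b ∷ spread π (w [ b ]≔ false))) + M R (λ w → F (lookup (w [ b ]≔ true) b ∷ spread π (w [ b ]≔ true))))
    ≡⟨ cong₂ (λ p q → ½ * (p + q)) (half false) (half true) ⟩
  M (suc n) F ∎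
  where
  open ≡-Reasoning
  same : ∀ v w → Agree (true ∷ U) (lookup (w [ b ]≔ v) b ∷ spread π (w [ b ]≔ v)) (v ∷ spread π w)
  same v w Fin.zero    _ = Vecₚ.lookup∘update b w v
  same v w (Fin.suc i) m = begin
    lookup (spread π (w [ b ]≔ v)) i      ≡⟨ lookup-spread π (w [ b ]≔ v) i ⟩
    lookup (w [ b ]≔ v) (lookup π i)      ≡⟨ Vecₚ.lookup∘update′ (λ eq → Finₚ.0≢1+n (sym (inj (Fin.suc i) Fin.zero m refl eq))) w v ⟩
    lookup w (lookup π i)                 ≡⟨ sym (lookup-spread π w i) ⟩
    lookup (spread π w) i                 ∎
  half : ∀ v → M R (λ w → F (lookup (w [ b ]≔ v) b ∷ spread π (w [ b ]≔ v))) ≡ M n (F ∘ (v ∷_))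
  half v = trans (M-cong R (λ w → dep _ _ (same v w)))
    (M-spread U π (F ∘ (v ∷_)) (λ x y ag → dep _ _ λ { Fin.zero _ → refl ; (Fin.suc i) m → ag i m })
      (λ i j mi mj eq → Finₚ.suc-injective (inj (Fin.suc i) (Fin.suc j) mi mj eq)))

infixl 6 _∪_
_∪_ : ∀ {n} → Vec Bool n → Vec Bool n → Vec Bool n
_∪_ = Vec.zipWith _∨_

∈-∪ˡ : ∀ {n} {U V : Vec Bool n} {i} → i ∈ᵐ U → i ∈ᵐ (U ∪ V)
∈-∪ˡ {U = U} {V} {i} m rewrite Vecₚ.lookup-zipWith _∨_ i U V | m = refl

∈-∪ʳ : ∀ {n} {U V : Vec Bool n} {i} → i ∈ᵐ V → i ∈ᵐ (U ∪ V)
∈-∪ʳ {U = U} {V} {i} m rewrite Vecₚ.lookup-zipWith _∨_ i U V | m = Boolₚ.∨-zeroʳ (lookup U i)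

count-∪ : ∀ {n} (U V : Vec Bool n) → count (U ∪ V) ℕ.≤ count U ℕ.+ count V
count-∪ []          []          = ℕ.z≤n
count-∪ (true ∷ U)  (false ∷ V) = ℕ.s≤s (count-∪ U V)
count-∪ (true ∷ U)  (true ∷ V)  = ℕ.s≤s (ℕₚ.≤-trans (count-∪ U V) (ℕₚ.+-monoʳ-≤ (count U) (ℕₚ.n≤1+n (count V))))
count-∪ (false ∷ U) (false ∷ V) = count-∪ U V
count-∪ (false ∷ U) (true ∷ V)  = ℕₚ.≤-trans (ℕ.s≤s (count-∪ U V)) (ℕₚ.≤-reflexive (sym (ℕₚ.+-suc (count U) (count V))))

count-replicate-false : ∀ n → count (replicate n false) ≡ 0
count-replicate-false zero    = refl
count-replicate-false (suc n) = count-replicate-false n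

singleton : ∀ {n} → Fin n → Vec Bool n
singleton {n} i = replicate n false [ i ]≔ true

count-singleton : ∀ {n} (i : Fin n) → count (singleton i) ≡ 1
count-singleton {suc n} Fin.zero    = cong suc (count-replicate-false n)
count-singleton {suc n} (Fin.suc i) = count-singleton i

truncate : ∀ {n} → ℕ → Vec Bool n → Vec Bool n
truncate zero    U           = replicate _ false
truncate (suc W) []          = []
truncate (suc W) (true ∷ U)  = true ∷ truncate W U
truncate (suc W) (false ∷ U) = false ∷ truncate (suc W) U

count-truncate : ∀ {n} W (U : Vec Bool n) → count (truncate W U) ℕ.≤ W
count-truncate {n} zero    U       = ℕₚ.≤-reflexive (count-replicate-false n)
count-truncate (suc W) []          = ℕ.z≤n
count-truncate (suc W) (true ∷ U)  = ℕ.s≤s (count-truncate W U)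
count-truncate (suc W) (false ∷ U) = count-truncate (suc W) U

truncate⊆ : ∀ {n} W (U : Vec Bool n) i → i ∈ᵐ truncate W U → i ∈ᵐ U
truncate⊆ zero    U           i           m rewrite Vecₚ.lookup-replicate i false with () ← m
truncate⊆ (suc W) (true ∷ U)  Fin.zero    m = refl
truncate⊆ (suc W) (true ∷ U)  (Fin.suc i) m = truncate⊆ W U i m
truncate⊆ (suc W) (false ∷ U) (Fin.suc i) m = truncate⊆ (suc W) U i m

truncate-full : ∀ {n} W (U : Vec Bool n) → count (truncate W U) ≡ W ⊎ truncate W U ≡ U
truncate-full {n} zero U = inj₁ (count-replicate-false n)
truncate-full (suc W) []          = inj₂ refl
truncate-full (suc W) (true ∷ U)  with truncate-full W U
... | inj₁ eq = inj₁ (cong suc eq)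
... | inj₂ eq = inj₂ (cong (true ∷_) eq)
truncate-full (suc W) (false ∷ U) with truncate-full (suc W) U
... | inj₁ eq = inj₁ eq
... | inj₂ eq = inj₂ (cong (false ∷_) eq)

constOn : ∀ {n} → Vec Bool n → Bool → Vec Bool n → Bool
constOn []          v []      = true
constOn (false ∷ U) v (x ∷ xs) = constOn U v xs
constOn (true ∷ U)  v (x ∷ xs) = not (x xor v) ∧ constOn U v xs

M-constOn : ∀ {n} (U : Vec Bool n) v → M n (λ x → ⟦ constOn U v x ⟧) ≡ ½ ^ count U
M-constOn []          v = refl
M-constOn (false ∷ U) v = trans (½-idem _) (M-constOn U v)
M-constOn {suc n} (true ∷ U)  true = trans
  (cong₂ (λ a b → ½ * (a + b)) (M-const n 0ℚ) (M-constOn U true)) (cong (½ *_) (ℚₚ.+-identityˡ (½ ^ count U)))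
M-constOn {suc n} (true ∷ U)  false = trans
  (cong₂ (λ a b → ½ * (a + b)) (M-constOn U false) (M-const n 0ℚ)) (cong (½ *_) (ℚₚ.+-identityʳ (½ ^ count U)))

constOn-dep : ∀ {n} (U : Vec Bool n) v → DependsOn U (constOn U v)
constOn-dep []          v []       []       ag = refl
constOn-dep (false ∷ U) v (x ∷ xs) (y ∷ ys) ag = constOn-dep U v xs ys (ag ∘ Fin.suc)
constOn-dep (true ∷ U)  v (x ∷ xs) (y ∷ ys) ag =
  cong₂ (λ a b → not (a xor v) ∧ b) (ag Fin.zero refl) (constOn-dep U v xs ys (ag ∘ Fin.suc))

¬constOn : ∀ {n} (U : Vec Bool n) v x → constOn U v x ≡ false → Σ (Fin n) λ i → i ∈ᵐ U × lookup x i ≡ not v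
¬constOn []          v [] ()
¬constOn (false ∷ U) v (x ∷ xs) h = let i , m , e = ¬constOn U v xs h in Fin.suc i , m , e
¬constOn (true ∷ U)  true  (false ∷ xs) h = Fin.zero , refl , refl
¬constOn (true ∷ U)  true  (true ∷ xs)  h = let i , m , e = ¬constOn U true xs h in Fin.suc i , m , e
¬constOn (true ∷ U)  false (true ∷ xs)  h = Fin.zero , refl , refl
¬constOn (true ∷ U)  false (false ∷ xs) h = let i , m , e = ¬constOn U false xs h in Fin.suc i , m , e

all-false : ∀ {A : Set} (p : A → Bool) {w ws} → w ∈ ws → p w ≡ false → all p ws ≡ false
all-false p (here refl) e rewrite e = refl
all-false p {ws = v ∷ ws} (there m) e rewrite all-false p m e = Boolₚ.∧-zeroʳ (p v)

any-true : ∀ {A : Set} (p : A → Bool) {w ws} → w ∈ ws → p w ≡ true → any p ws ≡ true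
any-true p (here refl) e rewrite e = refl
any-true p {ws = v ∷ ws} (there m) e rewrite any-true p m e = Boolₚ.∨-zeroʳ (p v)

all-cong : ∀ {A : Set} {p q : A → Bool} ws → (∀ {w} → w ∈ ws → p w ≡ q w) → all p ws ≡ all q ws
all-cong []       h = refl
all-cong (w ∷ ws) h = cong₂ _∧_ (h (here refl)) (all-cong ws (h ∘ there))

any-cong : ∀ {A : Set} {p q : A → Bool} ws → (∀ {w} → w ∈ ws → p w ≡ q w) → any p ws ≡ any q ws
any-cong []       h = refl
any-cong (w ∷ ws) h = cong₂ _∨_ (h (here refl)) (any-cong ws (h ∘ there))

∨-false : ∀ {a b} → a ∨ b ≡ false → a ≡ false × b ≡ false
∨-false {false} {false} _ = refl , refl

⟦∨⟧ : ∀ a b → ⟦ a ∨ b ⟧ ≤ ⟦ a ⟧ + ⟦ b ⟧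
⟦∨⟧ true  b = ≤+ʳ (⟦⟧≥0 b)
⟦∨⟧ false b = ≤+ˡ ℚₚ.≤-refl

-- A gate reading W or more variables has its controlling value on all but a 2^-W fraction of the
-- inputs; marking W of its variables is enough to see this, and other gates have all of theirs marked.
module Marking (n W : ℕ) where

  wireVars : ∀ {m} → Wire n m → Vec Bool n
  wireVars (inj₁ i) = singleton i
  wireVars (inj₂ _) = replicate n false

  vars : ∀ {m} → List (Wire n m) → Vec Bool n
  vars []       = replicate n false
  vars (w ∷ ws) = wireVars w ∪ vars ws

  ∈-wireVars : ∀ {m} (w : Wire n m) i → i ∈ᵐ wireVars w → w ≡ inj₁ i
  ∈-wireVars (inj₂ _) i h rewrite Vecₚ.lookup-replicate i false with () ← h
  ∈-wireVars (inj₁ j) i h with i Fin.≟ j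
  ... | yes refl = refl
  ... | no i≢j rewrite Vecₚ.lookup∘update′ i≢j (replicate n false) true | Vecₚ.lookup-replicate i false with () ← h

  ∈-vars⁻ : ∀ {m} (ws : List (Wire n m)) i → i ∈ᵐ vars ws → inj₁ i ∈ ws
  ∈-vars⁻ []       i h rewrite Vecₚ.lookup-replicate i false with () ← h
  ∈-vars⁻ (w ∷ ws) i h with lookup (wireVars w) i in eq
  ... | true  = here (sym (∈-wireVars w i eq))
  ... | false = there (∈-vars⁻ ws i (trans (sym (trans (Vecₚ.lookup-zipWith _∨_ i (wireVars w) (vars ws)) (cong (_∨ lookup (vars ws) i) eq))) h))

  ∈-vars⁺ : ∀ {m} {ws : List (Wire n m)} {i} → inj₁ i ∈ ws → i ∈ᵐ vars ws
  ∈-vars⁺ {ws = w ∷ ws} {i} (here refl) = ∈-∪ˡ {U = singleton i} {vars ws} (Vecₚ.lookup∘update i (replicate n false) true)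
  ∈-vars⁺ {ws = w ∷ ws} {i} (there m)   = ∈-∪ʳ {U = wireVars w} {vars ws} (∈-vars⁺ m)

  marked : ∀ {m} → Gate n m → Vec Bool n
  marked (AND ws) = truncate W (vars ws)
  marked (OR ws)  = truncate W (vars ws)
  marked (NOT w)  = wireVars w

  -- All marked variables take the non-controlling value, which is `true` for AND and `false` for
  -- OR. The count test exempts gates with fewer than `W` variables: these are fully marked and
  -- cause no error.
  badGate : ∀ {m} → Gate n m → Vec Bool n → Bool
  badGate (AND ws) x = (count (truncate W (vars ws)) ℕ.≡ᵇ W) ∧ constOn (truncate W (vars ws)) true x
  badGate (OR ws)  x = (count (truncate W (vars ws)) ℕ.≡ᵇ W) ∧ constOn (truncate W (vars ws)) false x
  badGate (NOT w)  x = false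

  markedGates : ∀ {m} → Gates n m → Vec Bool n
  markedGates []       = replicate n false
  markedGates (gs ▷ g) = markedGates gs ∪ marked g

  badGates : ∀ {m} → Gates n m → Vec Bool n → Bool
  badGates []       x = false
  badGates (gs ▷ g) x = badGates gs x ∨ badGate g x

  wireVal-agree : ∀ {m x y} (vs : Vec Bool m) w → Agree (wireVars w) x y → wireVal x vs w ≡ wireVal y vs w
  wireVal-agree vs (inj₁ i) ag = ag i (Vecₚ.lookup∘update i (replicate n false) true)
  wireVal-agree vs (inj₂ (inj₁ b)) ag = refl
  wireVal-agree vs (inj₂ (inj₂ j)) ag = refl

  wireVals-agree : ∀ {m x y} (vs : Vec Bool m) ws → Agree (vars ws) x y → ∀ {w} → w ∈ ws → wireVal x vs w ≡ wireVal y vs w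
  wireVals-agree vs ws ag {inj₁ i} m = ag i (∈-vars⁺ m)
  wireVals-agree vs ws ag {inj₂ (inj₁ b)} m = refl
  wireVals-agree vs ws ag {inj₂ (inj₂ j)} m = refl

  open ≡-Reasoning

  -- If all variables of the gate are marked, both values are computed from the same data. Otherwise
  -- goodness of `x` yields a marked variable at the controlling value; `y` agrees with `x` on it,
  -- so both values are forced.
  gateVal-agree : ∀ {m x y} (vs : Vec Bool m) g → badGate g x ≡ false → Agree (marked g) x y → gateVal x vs g ≡ gateVal y vs g
  gateVal-agree vs (NOT w) good ag = cong not (wireVal-agree vs w ag)
  gateVal-agree {x = x} {y} vs (AND ws) good ag with truncate-full W (vars ws)
  ... | inj₂ eq = all-cong ws (wireVals-agree vs ws (subst (λ U → Agree U x y) eq ag))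
  ... | inj₁ eq =
    let i , m , xᵢ = ¬constOn (truncate W (vars ws)) true x
          (trans (cong (_∧ constOn (truncate W (vars ws)) true x) (sym (Boolₚ.T-≡ .Equivalence.to (ℕₚ.≡⇒≡ᵇ _ _ eq)))) good)
        w∈ = ∈-vars⁻ ws i (truncate⊆ W (vars ws) i m)
    in trans (all-false (wireVal x vs) w∈ xᵢ) (sym (all-false (wireVal y vs) w∈ (trans (sym (ag i m)) xᵢ)))
  gateVal-agree {x = x} {y} vs (OR ws) good ag with truncate-full W (vars ws)
  ... | inj₂ eq = any-cong ws (wireVals-agree vs ws (subst (λ U → Agree U x y) eq ag))
  ... | inj₁ eq =
    let i , m , xᵢ = ¬constOn (truncate W (vars ws)) false x
          (trans (cong (_∧ constOn (truncate W (vars ws)) false x) (sym (Boolₚ.T-≡ .Equivalence.to (ℕₚ.≡⇒≡ᵇ _ _ eq)))) good)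
        w∈ = ∈-vars⁻ ws i (truncate⊆ W (vars ws) i m)
    in trans (any-true (wireVal x vs) w∈ xᵢ) (sym (any-true (wireVal y vs) w∈ (trans (sym (ag i m)) xᵢ)))

  gateVals-agree : ∀ {m x y} (gs : Gates n m) → badGates gs x ≡ false → Agree (markedGates gs) x y → gateVals gs x ≡ gateVals gs y
  gateVals-agree []       good ag = refl
  gateVals-agree {x = x} {y} (gs ▷ g) good ag
    rewrite gateVals-agree {x = x} {y} gs (proj₁ (∨-false good)) (λ i m → ag i (∈-∪ˡ {U = markedGates gs} {marked g} m))
    = cong (gateVals gs y ∷ʳ_) (gateVal-agree _ g (proj₂ (∨-false good)) (λ i m → ag i (∈-∪ʳ {U = markedGates gs} {marked g} m)))

  badGate-dep : ∀ {m} (g : Gate n m) → DependsOn (marked g) (badGate g)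
  badGate-dep (AND ws) x y ag = cong (_ ∧_) (constOn-dep (truncate W (vars ws)) true x y ag)
  badGate-dep (OR ws)  x y ag = cong (_ ∧_) (constOn-dep (truncate W (vars ws)) false x y ag)
  badGate-dep (NOT w)  x y ag = refl

  badGates-dep : ∀ {m} (gs : Gates n m) → DependsOn (markedGates gs) (badGates gs)
  badGates-dep []       x y ag = refl
  badGates-dep (gs ▷ g) x y ag = cong₂ _∨_
    (badGates-dep gs x y (λ i m → ag i (∈-∪ˡ {U = markedGates gs} {marked g} m)))
    (badGate-dep g x y (λ i m → ag i (∈-∪ʳ {U = markedGates gs} {marked g} m)))

  rarely-constOn : ∀ U v → M n (λ x → ⟦ (count U ℕ.≡ᵇ W) ∧ constOn U v x ⟧) ≤ ½ ^ W
  rarely-constOn U v with count U ℕ.≡ᵇ W in eq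
  ... | false = ℚₚ.≤-trans (ℚₚ.≤-reflexive (M-const n 0ℚ)) (^-nonneg 0≤½ W)
  ... | true  = ℚₚ.≤-reflexive (trans (M-constOn U v) (cong (½ ^_) (ℕₚ.≡ᵇ⇒≡ (count U) W (Boolₚ.T-≡ .Equivalence.from eq))))

  M-badGate : ∀ {m} (g : Gate n m) → M n (λ x → ⟦ badGate g x ⟧) ≤ ½ ^ W
  M-badGate (AND ws) = rarely-constOn (truncate W (vars ws)) true
  M-badGate (OR ws)  = rarely-constOn (truncate W (vars ws)) false
  M-badGate (NOT w)  = ℚₚ.≤-trans (ℚₚ.≤-reflexive (M-const n 0ℚ)) (^-nonneg 0≤½ W)

  M-badGates : ∀ {m} (gs : Gates n m) → M n (λ x → ⟦ badGates gs x ⟧) ≤ ι m * ½ ^ W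
  M-badGates []       = ℚₚ.≤-reflexive (trans (M-const n 0ℚ) (sym (ℚₚ.*-zeroˡ (½ ^ W))))
  M-badGates (_▷_ {m} gs g) = ℚₚ.≤-trans (M-≤-+ n (λ x → ⟦∨⟧ (badGates gs x) (badGate g x)))
    (ℚₚ.≤-trans (ℚₚ.+-mono-≤ (M-badGates gs) (M-badGate g)) (ℚₚ.≤-reflexive
      (trans (solve 2 (λ m p → m :* p :+ p := (con 1ℚ :+ m) :* p) refl (ι m) (½ ^ W)) (cong (_* ½ ^ W) (sym (ι-suc m))))))

  count-wireVars : ∀ {m} (w : Wire n m) → count (wireVars w) ℕ.≤ 1
  count-wireVars (inj₁ i) = ℕₚ.≤-reflexive (count-singleton i)
  count-wireVars (inj₂ _) = ℕₚ.≤-trans (ℕₚ.≤-reflexive (count-replicate-false n)) ℕ.z≤n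

  count-marked : 1 ℕ.≤ W → ∀ {m} (g : Gate n m) → count (marked g) ℕ.≤ W
  count-marked 1≤W (AND ws) = count-truncate W (vars ws)
  count-marked 1≤W (OR ws)  = count-truncate W (vars ws)
  count-marked 1≤W (NOT w)  = ℕₚ.≤-trans (count-wireVars w) 1≤W

  count-markedGates : 1 ℕ.≤ W → ∀ {m} (gs : Gates n m) → count (markedGates gs) ℕ.≤ m ℕ.* W
  count-markedGates 1≤W []       = ℕₚ.≤-reflexive (count-replicate-false n)
  count-markedGates 1≤W (_▷_ {m} gs g) = ℕₚ.≤-trans (count-∪ (markedGates gs) (marked g))
    (ℕₚ.≤-trans (ℕₚ.+-mono-≤ (count-markedGates 1≤W gs) (count-marked 1≤W g)) (ℕₚ.≤-reflexive (ℕₚ.+-comm (m ℕ.* W) W)))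

record NearJunta {n} (f : BoolFn n) (k : ℕ) (β : ℚ) : Set where
  field
    U        : Vec Bool n
    bad      : Vec Bool n → Bool
    size     : count U ℕ.≤ k
    bad-dep  : DependsOn U bad
    M-bad    : M n (λ x → ⟦ bad x ⟧) ≤ β
    stable   : ∀ {x y} → bad x ≡ false → Agree U x y → f x ≡ f y

-- Every gate contributes at most `W` marked variables and a bad set of measure at most 2^-W. The
-- extra 1 is for the root wire, which may itself be a variable.
circuit-nearJunta : ∀ {n m s} W → 1 ℕ.≤ W → m ℕ.≤ s → (C : Circuit n m) {f : BoolFn n} → (∀ x → f x ≡ eval C x) →
  NearJunta f (suc (s ℕ.* W)) (ι s * ½ ^ W)
circuit-nearJunta {n} {m} {s} W 1≤W m≤s (circuit gs r) {f} f≡ = record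
  { U       = markedGates gs ∪ wireVars r
  ; bad     = badGates gs
  ; size    = ℕₚ.≤-trans (count-∪ (markedGates gs) (wireVars r))
                (ℕₚ.≤-trans (ℕₚ.+-mono-≤ (ℕₚ.≤-trans (count-markedGates 1≤W gs) (ℕₚ.*-monoˡ-≤ W m≤s)) (count-wireVars r))
                  (ℕₚ.≤-reflexive (ℕₚ.+-comm (s ℕ.* W) 1)))
  ; bad-dep = λ x y ag → badGates-dep gs x y (λ i m → ag i (∈-∪ˡ {U = markedGates gs} {wireVars r} m))
  ; M-bad   = ℚₚ.≤-trans (M-badGates gs) (*-monoʳ (½ ^ W) (^-nonneg 0≤½ W) (ι-mono m≤s))
  ; stable  = λ {x} {y} good ag → trans (f≡ x) (trans
      (trans (cong (λ vs → wireVal x vs r) (gateVals-agree gs good (λ i m → ag i (∈-∪ˡ {U = markedGates gs} {wireVars r} m))))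
             (wireVal-agree (gateVals gs y) r (λ i m → ag i (∈-∪ʳ {U = markedGates gs} {wireVars r} m))))
      (sym (f≡ y)))
  }
  where open Marking n W

-- Exact probes pass every dictator test

module _ {n : ℕ} (f : BoolFn n) where

  -- The bit `κ` admits anti-dictators; it cancels in the derivative `D`.
  Exact : Probe n → Fin n → Set
  Exact P u = Σ Bool λ κ → ∀ x → f (P x) ≡ lookup x u xor κ

  rejectProb-guard≤ : ∀ {b} k {e} → b ≡ false → rejectProb k f ≤ e → rejectProb (guard b k) f ≤ e
  rejectProb-guard≤ k refl h = h

  rejectProb-iterate≤ : ∀ {F : Alg n → Alg n} {e} → (∀ k → rejectProb (F k) f ≤ e + rejectProb k f) →
    ∀ q k → rejectProb (iterate q F k) f ≤ ι q * e + rejectProb k f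
  rejectProb-iterate≤ {e = e} h zero k = ℚₚ.≤-reflexive (solve 2 (λ e r → r := con 0ℚ :* e :+ r) refl e (rejectProb k f))
  rejectProb-iterate≤ {F} {e} h (suc q) k = begin
    rejectProb (F (iterate q F k)) f            ≤⟨ h (iterate q F k) ⟩
    e + rejectProb (iterate q F k) f            ≤⟨ ℚₚ.+-monoʳ-≤ e (rejectProb-iterate≤ h q k) ⟩
    e + (ι q * e + rejectProb k f)              ≡⟨ solve 3 (λ e m r → e :+ (m :* e :+ r) := (con 1ℚ :+ m) :* e :+ r) refl e (ι q) (rejectProb k f) ⟩
    (1ℚ + ι q) * e + rejectProb k f             ≡⟨ cong (λ m → m * e + rejectProb k f) (sym (ι-suc q)) ⟩
    ι (suc q) * e + rejectProb k f              ∎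
    where open ℚₚ.≤-Reasoning

  iterate-certain : ∀ {F : Alg n → Alg n} → (∀ k {e} → rejectProb k f ≤ e → rejectProb (F k) f ≤ e) →
    ∀ q k {e} → rejectProb k f ≤ e → rejectProb (iterate q F k) f ≤ e
  iterate-certain h zero    k g = g
  iterate-certain h (suc q) k g = h _ (iterate-certain h q k g)

  module _ {P : Probe n} {u : Fin n} (exact : Exact P u) where
    open Dictator (λ x → f (P x))

    private
      κ = proj₁ exact
      φ≡ = proj₂ exact

    lookup-⊕ : ∀ (x y : Vec Bool n) → lookup (x ⊕ y) u ≡ lookup x u xor lookup y u
    lookup-⊕ x y = Vecₚ.lookup-zipWith _xor_ u x y

    D-exact : ∀ x z → D x z ≡ lookup x u
    D-exact x z rewrite φ≡ (x ⊕ z) | φ≡ z | lookup-⊕ x z = lem (lookup x u) (lookup z u) κ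
      where
      lem : ∀ a b c → ((a xor b) xor c) xor (b xor c) ≡ a
      lem a b c = trans (cong (_xor (b xor c)) (Boolₚ.xor-assoc a b c))
        (trans (Boolₚ.xor-assoc a (b xor c) (b xor c)) (trans (cong (a xor_) (Boolₚ.xor-same (b xor c))) (Boolₚ.xor-identityʳ a)))

    affine-passes : ∀ a b c → affineFails a b c ≡ false
    affine-passes a b c rewrite φ≡ a | φ≡ b | φ≡ c | φ≡ ((a ⊕ b) ⊕ c) | lookup-⊕ (a ⊕ b) c | lookup-⊕ a b =
      lem (lookup a u) (lookup b u) (lookup c u) κ
      where
      lem : ∀ a b c k → ((a xor k) xor (b xor k)) xor ((c xor k) xor (((a xor b) xor c) xor k)) ≡ false
      lem a b c k = trans (cong₂ _xor_
          (trans (xor-interchange a k b k) (trans (cong ((a xor b) xor_) (Boolₚ.xor-same k)) (Boolₚ.xor-identityʳ (a xor b))))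
          (trans (xor-interchange c k ((a xor b) xor c) k) (trans (cong₂ _xor_ (trans (cong (c xor_) (Boolₚ.xor-comm (a xor b) c))
             (trans (sym (Boolₚ.xor-assoc c c (a xor b))) (cong (_xor (a xor b)) (Boolₚ.xor-same c)))) (Boolₚ.xor-same k)) (Boolₚ.xor-identityʳ (a xor b)))))
        (Boolₚ.xor-same (a xor b))

    and-passes : ∀ x y z₁ z₂ z₃ → andFails x y z₁ z₂ z₃ ≡ false
    and-passes x y z₁ z₂ z₃ rewrite D-exact (x ⊓ y) z₁ | D-exact x z₂ | D-exact y z₃ | Vecₚ.lookup-zipWith _∧_ u x y =
      Boolₚ.xor-same (lookup x u ∧ lookup y u)

    one-passes : ∀ z → oneFails z ≡ false
    one-passes z rewrite D-exact (replicate n true) z | Vecₚ.lookup-replicate u true = refl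

    tests-pass : ∀ q k {e} → rejectProb k f ≤ e →
      rejectProb (iterate q (affineTest P) (iterate 16 (andTest P) (iterate 4 (oneTest P) k))) f ≤ e
    tests-pass q k h =
      iterate-certain {affineTest P} (λ k g → rejectProb-draw≤ f n _ λ a → rejectProb-draw≤ f n _ λ b → rejectProb-draw≤ f n _ λ c →
        rejectProb-guard≤ k (affine-passes a b c) g) q _
      (iterate-certain {andTest P} (λ k g → rejectProb-draw≤ f n _ λ x → rejectProb-draw≤ f n _ λ y →
        rejectProb-draw≤ f n _ λ z₁ → rejectProb-draw≤ f n _ λ z₂ → rejectProb-draw≤ f n _ λ z₃ →
        rejectProb-guard≤ k (and-passes x y z₁ z₂ z₃) g) 16 _
      (iterate-certain {oneTest P} (λ k g → rejectProb-draw≤ f n _ λ z → rejectProb-guard≤ k (one-passes z) g) 4 k h))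

  dictatorTests-pass : ∀ q {K} {Ps : Vec (Probe n) K} {us : Vec (Fin n) K} → Pointwise Exact Ps us → ∀ k {e} → rejectProb k f ≤ e →
    rejectProb (dictatorTests q Ps k) f ≤ e
  dictatorTests-pass q []       k h = h
  dictatorTests-pass q (e ∷ es) k h = tests-pass e q _ (dictatorTests-pass q es k h)

  decode-exact : ∀ {K} {Ps : Vec (Probe n) K} {us : Vec (Fin n) K} → Pointwise Exact Ps us → ∀ x k {e} →
    rejectProb (k (Vec.map (lookup x) us)) f ≤ e → rejectProb (decode Ps x k) f ≤ e
  decode-exact []       x k h = h
  decode-exact {Ps = P ∷ Ps} {us = u ∷ us} (e ∷ es) x k h = rejectProb-draw≤ f n _ λ z →
    decode-exact es x _ (subst (λ a → rejectProb (k (a ∷ Vec.map (lookup x) us)) f ≤ _) (sym (D-exact e x z)) h)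

  module _ {K : ℕ} {Ps : Vec (Probe n) K} {us : Vec (Fin n) K} (exact : Pointwise Exact Ps us) (c : BoolFn K) where

    verify-error : ℚ
    verify-error = M n λ x → ⟦ f x xor c (Vec.map (lookup x) us) ⟧

    rejectProb-verify≤ : ∀ k → rejectProb (verify Ps c k) f ≤ verify-error + rejectProb k f
    rejectProb-verify≤ k = begin
      rejectProb (verify Ps c k) f     ≡⟨ rejectProb-draw f n _ ⟩
      M n (λ x → rejectProb (decode Ps x (λ y → guard (f x xor c y) k)) f)
        ≤⟨ M-mono n (λ x → decode-exact exact x _ (guard≤ (f x xor c (Vec.map (lookup x) us)))) ⟩
      M n (λ x → ⟦ f x xor c (Vec.map (lookup x) us) ⟧ + rejectProb k f)
        ≡⟨ M-+ʳ n (λ x → ⟦ f x xor c (Vec.map (lookup x) us) ⟧) (rejectProb k f) ⟩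
      verify-error + rejectProb k f    ∎
      where
      open ℚₚ.≤-Reasoning
      guard≤ : ∀ b → rejectProb (guard b k) f ≤ ⟦ b ⟧ + rejectProb k f
      guard≤ true  = ≤+ʳ (rejectProb≥0 f k)
      guard≤ false = ≤+ˡ ℚₚ.≤-refl

    -- Dictator tests pass with certainty and decoding is exact, so only genuine disagreement
    -- remains, by a union bound over the `t` samples.
    check-complete : ∀ q t → rejectProb (dictatorTests q Ps (iterate t (verify Ps c) accept)) f ≤ ι t * verify-error
    check-complete q t = dictatorTests-pass q exact _
      (ℚₚ.≤-trans (rejectProb-iterate≤ {verify Ps c} rejectProb-verify≤ t accept) (ℚₚ.≤-reflexive (ℚₚ.+-identityʳ (ι t * verify-error))))

-- Completeness

found-true : ∀ {R K} {es : Vec (Entry R) K} {b a} → found ((b , a) ∷ es) b ≡ true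
found-true {b = b} with b Fin.≟ b
... | yes _ = refl
... | no ≢  = ⊥-elim (≢ refl)

keep-end : ∀ {R K} (es : Vec (Entry R) K) j → lookup (keep es R) j ≡ found es j
keep-end {R} es j = trans (Vecₚ.lookup∘tabulate _ j) (trans (cong (found es j ∨_) (≰ᵇ (Finₚ.toℕ<n j))) (Boolₚ.∨-identityʳ (found es j)))
  where
  ≰ᵇ : ∀ {m k} → m ℕ.< k → (k ℕ.≤ᵇ m) ≡ false
  ≰ᵇ {m} {k} lt with k ℕ.≤ᵇ m in eq
  ... | false = refl
  ... | true  = ⊥-elim (ℕₚ.<⇒≱ lt (ℕₚ.≤ᵇ⇒≤ k m (subst IsTrue (sym eq) _)))

lookup-ext : ∀ {n} {x y : Vec Bool n} → (∀ i → lookup x i ≡ lookup y i) → x ≡ y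
lookup-ext {x = []}     {[]}     h = refl
lookup-ext {x = a ∷ xs} {b ∷ ys} h = cong₂ _∷_ (h Fin.zero) (lookup-ext (h ∘ Fin.suc))

readAt : ∀ {R K} → Vec (Entry R) K → Vec Bool R → Vec Bool K
readAt es w = spread (Vec.map proj₁ es) w

lookup-override : ∀ {R K} (es : Vec (Entry R) K) w v j →
  lookup (override es (readAt es w) v) j ≡ (if found es j then lookup w j else lookup v j)
lookup-override []             w v j = refl
lookup-override ((b , a) ∷ es) w v j with b Fin.≟ j
... | yes refl = Vecₚ.lookup∘update b (override es (readAt es w) v) (lookup w b)
... | no b≢j   = trans (Vecₚ.lookup∘update′ (b≢j ∘ sym) (override es (readAt es w) v) (lookup w b)) (lookup-override es w v j)

-- The point of contact between learning and search: a learning sample is a last hybrid, with `w` on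
-- the found blocks and the fixed `v` elsewhere. The quantity that the search makes small is thus
-- also the loss from learning only a restriction.
override≡hybrid : ∀ {R K} (es : Vec (Entry R) K) w v → override es (readAt es w) v ≡ hybrid es w v R
override≡hybrid {R} es w v = lookup-ext λ j → trans (lookup-override es w v j)
  (sym (trans (lookup-mix (keep es R) w v j) (cong (λ b → if b then lookup w j else lookup v j) (keep-end es j))))

locate : ∀ {R K} → Vec (Entry R) K → Vec Bool R → Fin R → Fin K ⊎ Bool
locate []             v j = inj₂ (lookup v j)
locate ((b , _) ∷ es) v j = if does (b Fin.≟ j) then inj₁ Fin.zero else Sum.map Fin.suc id (locate es v j)

locate-override : ∀ {R K} (es : Vec (Entry R) K) y v j →
  [ lookup y , id ]′ (locate es v j) ≡ lookup (override es y v) j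
locate-override []             []      v j = refl
locate-override ((b , a) ∷ es) (t ∷ y) v j with b Fin.≟ j
... | yes refl = sym (Vecₚ.lookup∘update b (override es y v) t)
... | no b≢j   = trans (lem (locate es v j)) (trans (locate-override es y v j) (sym (Vecₚ.lookup∘update′ (b≢j ∘ sym) (override es y v) t)))
  where
  lem : ∀ w → [ lookup (t ∷ y) , id ]′ (Sum.map Fin.suc id w) ≡ [ lookup y , id ]′ w
  lem (inj₁ i) = refl
  lem (inj₂ b) = refl

-- Variables in found blocks become inputs and all others constants read off `v`; substitution adds
-- no gate, so the result has a representative in the enumeration.
restriction-learnable : ∀ {n R K m s} (π : Vec (Fin R) n) (es : Vec (Entry R) K) v {f : BoolFn n} → m ℕ.≤ s → (C : Circuit n m) →
  (∀ x → f x ≡ eval C x) → Any (Learning.Computes f (λ y → spread π (override es y v))) (allCircuits s K)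
restriction-learnable {n} {K = K} π es v {f} m≤s C f≡ =
  let c , c∈ , c≡ = allCircuits-complete m≤s (substCircuit σ C)
  in Any.map (λ { refl y → trans (c≡ y) (trans (eval-subst σ y C) (trans (cong (eval C) (point y)) (sym (f≡ _)))) }) c∈
  where
  σ : Fin n → Fin K ⊎ Bool
  σ i = locate es v (lookup π i)
  point : ∀ y → substInput σ y ≡ spread π (override es y v)
  point y = lookup-ext λ i → trans (Vecₚ.lookup∘tabulate _ i) (trans (locate-override es y v (lookup π i)) (sym (lookup-spread π (override es y v) i)))

module Separated {n : ℕ} (f : BoolFn n) {k : ℕ} {β : ℚ} (nj : NearJunta f k β) {R : ℕ} (π : Vec (Fin R) n)
                 (separated : InjectiveOn (NearJunta.U nj) π) where
  open NearJunta nj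

  -- A genuine junta that equals f off `bad`. Zero is an arbitrary filling for the variables outside
  -- `U`.
  core : BoolFn n
  core x = f (U ⊓ x)

  agree-⊓ : ∀ x → Agree U x (U ⊓ x)
  agree-⊓ x i i∈ rewrite Vecₚ.lookup-zipWith _∧_ i U x | i∈ = refl

  core-dep : DependsOn U core
  core-dep x y ag = cong f (lookup-ext λ i → trans (Vecₚ.lookup-zipWith _∧_ i U x)
    (trans (lem i (lookup U i) refl) (sym (Vecₚ.lookup-zipWith _∧_ i U y))))
    where
    lem : ∀ i b → lookup U i ≡ b → b ∧ lookup x i ≡ b ∧ lookup y i
    lem i true  i∈ = ag i i∈
    lem i false _  = refl

  f-core : ∀ x → bad x ≡ false → f x ≡ core x
  f-core x good = stable good (agree-⊓ x)

  f-xor-core : ∀ x → ⟦ f x xor core x ⟧ ≤ ⟦ bad x ⟧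
  f-xor-core x = go (bad x) refl
    where
    go : ∀ b → bad x ≡ b → ⟦ f x xor core x ⟧ ≤ ⟦ b ⟧
    go true  _    = ⟦⟧≤1 (f x xor core x)
    go false good = ℚₚ.≤-reflexive (cong ⟦_⟧ (trans (cong (_xor core x) (f-core x good)) (Boolₚ.xor-same (core x))))

  -- The invariant of the search. Freshness keeps the found blocks distinct, which makes the bits
  -- read from them independent and uniform.
  data Sound : ∀ {K} → Vec (Entry R) K → Vec (Fin n) K → Set where
    []  : Sound [] []
    new : ∀ {K b a u} {es : Vec (Entry R) K} {us} → u ∈ᵐ U → lookup π u ≡ b → found es b ≡ false →
          Exact f (probe π (b , a)) u → Sound es us → Sound ((b , a) ∷ es) (u ∷ us)

  -- The probability that refreshing all unfound blocks is noticed: both the success rate of the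
  -- next attempt and the loss if the search stops now. Using `core` in place of f makes it vanish
  -- exactly once all relevant blocks are found.
  residue : ∀ {K} → Vec (Entry R) K → ℚ
  residue es = M R λ w → M R λ w′ → ⟦ core (spread π w) xor core (spread π (hybrid es w w′ R)) ⟧

  residue≥0 : ∀ {K} (es : Vec (Entry R) K) → 0ℚ ≤ residue es
  residue≥0 es = M-nonneg R λ w → M-nonneg R λ w′ → ⟦⟧≥0 (core (spread π w) xor core (spread π (hybrid es w w′ R)))

  residue≤1 : ∀ {K} (es : Vec (Entry R) K) → residue es ≤ 1ℚ
  residue≤1 es = M-≤ R λ w → M-≤ R λ w′ → ⟦⟧≤1 (core (spread π w) xor core (spread π (hybrid es w w′ R)))

  M-bad-spread : M R (λ w → ⟦ bad (spread π w) ⟧) ≤ β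
  M-bad-spread = ℚₚ.≤-trans (ℚₚ.≤-reflexive (M-spread U π (λ x → ⟦ bad x ⟧) (λ x y ag → cong ⟦_⟧ (bad-dep x y ag)) separated)) M-bad

  M-bad-hybrid : ∀ {K} (es : Vec (Entry R) K) i → M R (λ w → M R λ w′ → ⟦ bad (spread π (hybrid es w w′ i)) ⟧) ≤ β
  M-bad-hybrid es i = ℚₚ.≤-trans (ℚₚ.≤-reflexive (M-mix R (keep es i) (λ w → ⟦ bad (spread π w) ⟧))) M-bad-spread

  found-lookup : ∀ {K} (es : Vec (Entry R) K) i → found es (lookup (Vec.map proj₁ es) i) ≡ true
  found-lookup ((b , a) ∷ es) Fin.zero    = found-true {es = es} {b} {a}
  found-lookup ((b , a) ∷ es) (Fin.suc i) rewrite found-lookup es i = Boolₚ.∨-zeroʳ _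

  blocks-injective : ∀ {K} {es : Vec (Entry R) K} {us} → Sound es us → ∀ i j →
    lookup (Vec.map proj₁ es) i ≡ lookup (Vec.map proj₁ es) j → i ≡ j
  blocks-injective (new _ _ _ _ s) Fin.zero    Fin.zero    eq = refl
  blocks-injective (new {es = es} _ _ fresh _ s) Fin.zero (Fin.suc j) eq
    with () ← trans (sym fresh) (trans (cong (found es) eq) (found-lookup es j))
  blocks-injective (new {es = es} _ _ fresh _ s) (Fin.suc i) Fin.zero eq
    with () ← trans (sym fresh) (trans (cong (found es) (sym eq)) (found-lookup es i))
  blocks-injective (new _ _ _ _ s) (Fin.suc i) (Fin.suc j) eq = cong Fin.suc (blocks-injective s i j eq)

  exacts : ∀ {K} {es : Vec (Entry R) K} {us} → Sound es us → Pointwise (Exact f) (Vec.map (probe π) es) us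
  exacts []              = []
  exacts (new _ _ _ e s) = e ∷ exacts s

  read-agree : ∀ {K} {es : Vec (Entry R) K} {us} → Sound es us → ∀ x y → Agree U x y → Vec.map (lookup x) us ≡ Vec.map (lookup y) us
  read-agree []               x y ag = refl
  read-agree (new u∈ _ _ _ s) x y ag = cong₂ _∷_ (ag _ u∈) (read-agree s x y ag)

  read-spread : ∀ {K} {es : Vec (Entry R) K} {us} → Sound es us → ∀ w → Vec.map (lookup (spread π w)) us ≡ readAt es w
  read-spread []                       w = refl
  read-spread (new {u = u} _ eq _ _ s) w = cong₂ _∷_ (trans (lookup-spread π w u) (cong (lookup w) eq)) (read-spread s w)

  module _ {K : ℕ} {es : Vec (Entry R) K} {us : Vec (Fin n) K} (sound : Sound es us) where

    module L {s : ℕ} (v : Vec Bool R) = Learning {s = s} f (λ y → spread π (override es y v))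

    offset : Vec Bool R → ℚ
    offset v = M R λ w → ⟦ core (spread π w) xor core (spread π (hybrid es w v R)) ⟧ + ⟦ bad (spread π (hybrid es w v R)) ⟧

    offset≥0 : ∀ v → 0ℚ ≤ offset v
    offset≥0 v = M-nonneg R λ w → 0≤+ (⟦⟧≥0 (core (spread π w) xor core (spread π (hybrid es w v R)))) (⟦⟧≥0 (bad (spread π (hybrid es w v R))))

    M-offset : M R offset ≤ residue es + β
    M-offset = begin
      M R offset                    ≡⟨ M-swap R R (λ v w → Q w v + B w v) ⟩
      M R (λ w → M R λ v → Q w v + B w v)
        ≤⟨ M-≤-+ R (λ w → M-≤-+ R λ v → ℚₚ.≤-refl) ⟩
      residue es + M R (λ w → M R λ v → B w v)   ≤⟨ ℚₚ.+-monoʳ-≤ (residue es) (M-bad-hybrid es R) ⟩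
      residue es + β                ∎
      where
      open ℚₚ.≤-Reasoning
      Q B : Vec Bool R → Vec Bool R → ℚ
      Q w v = ⟦ core (spread π w) xor core (spread π (hybrid es w v R)) ⟧
      B w v = ⟦ bad (spread π (hybrid es w v R)) ⟧

    -- Triangle inequality along f, `core`, `core` with the unfound blocks set to `v`, f at that
    -- same point, and `C`. The first link costs `β`, the next two make up `offset v`, the last is
    -- the learning error. After the first link everything depends on `U` only, so the mean moves to
    -- block-constant inputs.
    verify-error≤ : ∀ {s} v (C : Circuit K s) → verify-error f (exacts sound) (eval C) ≤ β + (offset v + L.err v C)
    verify-error≤ v C = begin
      M n (λ x → ⟦ f x xor c (Vec.map (lookup x) us) ⟧)
        ≤⟨ M-≤-+ n (λ x → ℚₚ.≤-trans (xor-tri (f x) (core x) _) (ℚₚ.+-monoˡ-≤ (F x) (f-xor-core x))) ⟩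
      M n (λ x → ⟦ bad x ⟧) + M n F
        ≤⟨ ℚₚ.+-mono-≤ M-bad (ℚₚ.≤-reflexive (sym (M-spread U π F F-dep separated))) ⟩
      β + M R (λ w → F (spread π w))
        ≤⟨ ℚₚ.+-monoʳ-≤ β (M-≤-+ R ptw) ⟩
      β + (offset v + M R (λ w → E (readAt es w)))
        -- `M-spread` again, with the found blocks, which are distinct, in the role of the partition
        -- map on `K` variables.
        ≡⟨ cong (λ e → β + (offset v + e)) (M-spread (replicate K true) (Vec.map proj₁ es) E
             (λ x y ag → cong E (lookup-ext λ i → ag i (Vecₚ.lookup-replicate i true)))
             (λ i j _ _ → blocks-injective sound i j)) ⟩
      β + (offset v + L.err v C) ∎
      where
      open ℚₚ.≤-Reasoning
      c = eval C
      F : Vec Bool n → ℚ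
      F x = ⟦ core x xor c (Vec.map (lookup x) us) ⟧
      F-dep : DependsOn U F
      F-dep x y ag = cong₂ (λ a r → ⟦ a xor c r ⟧) (core-dep x y ag) (read-agree sound x y ag)
      E : Vec Bool K → ℚ
      E y = ⟦ c y xor L.target {s = 0} v y ⟧
      ptw : ∀ w → F (spread π w) ≤
        (⟦ core (spread π w) xor core (spread π (hybrid es w v R)) ⟧ + ⟦ bad (spread π (hybrid es w v R)) ⟧) + E (readAt es w)
      ptw w = begin
        ⟦ core (spread π w) xor c (Vec.map (lookup (spread π w)) us) ⟧
          ≡⟨ cong (λ r → ⟦ core (spread π w) xor c r ⟧) (read-spread sound w) ⟩
        ⟦ core (spread π w) xor c r ⟧
          ≤⟨ xor-tri (core (spread π w)) (core h) (c r) ⟩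
        ⟦ core (spread π w) xor core h ⟧ + ⟦ core h xor c r ⟧
          ≤⟨ ℚₚ.+-monoʳ-≤ ⟦ core (spread π w) xor core h ⟧ (xor-tri (core h) (f h) (c r)) ⟩
        ⟦ core (spread π w) xor core h ⟧ + (⟦ core h xor f h ⟧ + ⟦ f h xor c r ⟧)
          ≡⟨ sym (ℚₚ.+-assoc ⟦ core (spread π w) xor core h ⟧ ⟦ core h xor f h ⟧ ⟦ f h xor c r ⟧) ⟩
        (⟦ core (spread π w) xor core h ⟧ + ⟦ core h xor f h ⟧) + ⟦ f h xor c r ⟧
          ≤⟨ ℚₚ.+-mono-≤ (ℚₚ.+-monoʳ-≤ ⟦ core (spread π w) xor core h ⟧
               (ℚₚ.≤-trans (ℚₚ.≤-reflexive (cong ⟦_⟧ (Boolₚ.xor-comm (core h) (f h)))) (f-xor-core h)))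
               (ℚₚ.≤-reflexive (cong ⟦_⟧ (trans (Boolₚ.xor-comm (f h) (c r)) (cong (λ z → c r xor f (spread π z)) (sym (override≡hybrid es w v)))))) ⟩
        (⟦ core (spread π w) xor core h ⟧ + ⟦ bad h ⟧) + E r ∎
        where
        r = readAt es w
        h = spread π (hybrid es w v R)

module _ {n : ℕ} (f : BoolFn n) {k : ℕ} {β : ℚ} (nj : NearJunta f k β) {s ρ : ℕ} (π : Vec (Fin (2 ℕ.^ ρ)) n)
         (separated : InjectiveOn (NearJunta.U nj) π) where
  open Separated f nj π separated

  -- For a fixed `v` the offset may be large; only its mean over `v` is at most residue plus `β`,
  -- which is why `v` is drawn. This `β` and the one of `verify-error≤` make up `β + β`.
  learnAndCheck-complete : ∀ p q m h E {δ} → 0ℚ ≤ δ → δ ≤ 1ℚ → 0ℚ ≤ β → ∀ {m₀} → m₀ ℕ.≤ s → (C : Circuit n m₀) → (∀ x → f x ≡ eval C x) →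
    ∀ {K} {es : Vec (Entry (2 ℕ.^ ρ)) K} {us} → Sound es us → K ℕ.≤ p →
    rejectProb (Tester.learnAndCheck n s ρ p q m h E (allCircuits s) π K es) f
      ≤ (ι (4 ℕ.* E) * (β + β) + ι (4 ℕ.* E) * δ + ι (2 ℕ.^ (suc s ℕ.* (p ℕ.+ s ℕ.+ 4))) * (1ℚ - δ) ^ m) + ι (4 ℕ.* E) * residue es
  learnAndCheck-complete p q m h E {δ} δ≥0 δ≤1 β≥0 m₀≤s C f≡ {K} {es} sound K≤p = begin
    rejectProb (learnAndCheck π K es) f
      ≡⟨ rejectProb-draw f R _ ⟩
    M R (λ v → rejectProb (learn m (allCircuits s K) (λ y → spread π (override es y v)) (check (Vec.map (probe π) es))) f)
      ≤⟨ M-mono R each ⟩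
    M R (λ v → t * (β + offset sound v) + t * δ + N * P)
      ≡⟨ M-cong R (λ v → solve 5 (λ t b o d np → t :* (b :+ o) :+ t :* d :+ np := (t :* b :+ t :* d :+ np) :+ t :* o) refl t β (offset sound v) δ (N * P)) ⟩
    M R (λ v → (t * β + t * δ + N * P) + t * offset sound v)
      ≡⟨ trans (M-+ˡ R (t * β + t * δ + N * P) (λ v → t * offset sound v)) (cong (t * β + t * δ + N * P +_) (M-* R t (offset sound))) ⟩
    (t * β + t * δ + N * P) + t * M R (offset sound)
      ≤⟨ ℚₚ.+-monoʳ-≤ (t * β + t * δ + N * P) (*-monoˡ t t≥0 (M-offset sound)) ⟩
    (t * β + t * δ + N * P) + t * (residue es + β)
      ≡⟨ solve 5 (λ t b r d np → (t :* b :+ t :* d :+ np) :+ t :* (r :+ b) := (t :* (b :+ b) :+ t :* d :+ np) :+ t :* r) refl t β (residue es) δ (N * P) ⟩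
    (t * (β + β) + t * δ + N * P) + t * residue es ∎
    where
    open ℚₚ.≤-Reasoning
    open Tester n s ρ p q m h E (allCircuits s)
    R = 2 ℕ.^ ρ
    t = ι (4 ℕ.* E)
    t≥0 : 0ℚ ≤ t
    t≥0 = ι≥0 (4 ℕ.* E)
    N = ι (2 ℕ.^ (suc s ℕ.* (p ℕ.+ s ℕ.+ 4)))
    P = (1ℚ - δ) ^ m
    each : ∀ v → rejectProb (learn m (allCircuits s K) (λ y → spread π (override es y v)) (check (Vec.map (probe π) es))) f
      ≤ t * (β + offset sound v) + t * δ + N * P
    each v = ℚₚ.≤-trans
      (rejectProb-learn δ≥0 δ≤1 (check (Vec.map (probe π) es)) {t * (β + offset sound v)} {t} (0≤* t≥0 (0≤+ β≥0 (offset≥0 sound v))) t≥0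
        (λ c → ℚₚ.≤-trans (check-complete f (exacts sound) (eval c) (2 ℕ.* h) (4 ℕ.* E))
          (ℚₚ.≤-trans (*-monoˡ t t≥0 (verify-error≤ sound v c))
            (ℚₚ.≤-reflexive (solve 4 (λ t b o e → t :* (b :+ (o :+ e)) := t :* (b :+ o) :+ t :* e) refl t β (offset sound v) (err c)))))
        m (restriction-learnable π es v m₀≤s C f≡))
      (ℚₚ.+-monoʳ-≤ (t * (β + offset sound v) + t * δ) (*-monoʳ P (^-nonneg (0≤- δ≤1) m)
        (ℚₚ.≤-trans (#poor≤length δ≥0 δ≤1 (allCircuits s K)) (ι-mono few))))
      where
      open Learning {s = s} f (λ y → spread π (override es y v))
      few : length (allCircuits s K) ℕ.≤ 2 ℕ.^ (suc s ℕ.* (p ℕ.+ s ℕ.+ 4))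
      few = ℕₚ.≤-trans (length-allCircuits s K) (ℕₚ.^-monoʳ-≤ 2 (ℕₚ.*-monoʳ-≤ (suc s) (ℕₚ.+-monoˡ-≤ 4 (ℕₚ.+-monoˡ-≤ s K≤p))))

count-mono : ∀ {n} (V V′ : Vec Bool n) → (∀ i → i ∈ᵐ V′ → i ∈ᵐ V) → count V′ ℕ.≤ count V
count-mono []          []           sub = ℕ.z≤n
count-mono (true ∷ V)  (true ∷ V′)  sub = ℕ.s≤s (count-mono V V′ (sub ∘ Fin.suc))
count-mono (true ∷ V)  (false ∷ V′) sub = ℕₚ.m≤n⇒m≤1+n (count-mono V V′ (sub ∘ Fin.suc))
count-mono (false ∷ V) (false ∷ V′) sub = count-mono V V′ (sub ∘ Fin.suc)
count-mono (false ∷ V) (true ∷ V′)  sub with () ← sub Fin.zero refl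

count-strict : ∀ {n} (V V′ : Vec Bool n) → (∀ i → i ∈ᵐ V′ → i ∈ᵐ V) → ∀ u → u ∈ᵐ V → lookup V′ u ≡ false → count V′ ℕ.< count V
count-strict (true ∷ V)  (false ∷ V′) sub Fin.zero    u∈ u∉ = ℕ.s≤s (count-mono V V′ (sub ∘ Fin.suc))
count-strict (true ∷ V)  (true ∷ V′)  sub (Fin.suc u) u∈ u∉ = ℕ.s≤s (count-strict V V′ (sub ∘ Fin.suc) u u∈ u∉)
count-strict (true ∷ V)  (false ∷ V′) sub (Fin.suc u) u∈ u∉ = ℕₚ.m≤n⇒m≤1+n (count-strict V V′ (sub ∘ Fin.suc) u u∈ u∉)
count-strict (false ∷ V) (false ∷ V′) sub (Fin.suc u) u∈ u∉ = count-strict V V′ (sub ∘ Fin.suc) u u∈ u∉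
count-strict (false ∷ V) (true ∷ V′)  sub u           u∈ u∉ with () ← sub Fin.zero refl

count-empty : ∀ {n} (V : Vec Bool n) → count V ≡ 0 → ∀ i → lookup V i ≡ false
count-empty (false ∷ V) e Fin.zero    = refl
count-empty (false ∷ V) e (Fin.suc i) = count-empty V e i

≢⇒≡not : ∀ {a b} → a ≢ b → b ≡ not a
≢⇒≡not {true}  {true}  h = ⊥-elim (h refl)
≢⇒≡not {true}  {false} h = refl
≢⇒≡not {false} {true}  h = refl
≢⇒≡not {false} {false} h = ⊥-elim (h refl)

≤ᵇ-step : ∀ {i j} → i ≢ j → (i ℕ.≤ᵇ j) ≡ (suc i ℕ.≤ᵇ j)
≤ᵇ-step {i} {j} i≢j = ⇔⇒≡
  (λ h → to (ℕₚ.≤⇒≤ᵇ (ℕₚ.≤∧≢⇒< (ℕₚ.≤ᵇ⇒≤ i j (from h)) i≢j)))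
  (λ h → to (ℕₚ.≤⇒≤ᵇ (ℕₚ.<⇒≤ (ℕₚ.≤ᵇ⇒≤ (suc i) j (from h)))))
  where
  to : ∀ {b} → IsTrue b → b ≡ true
  to {true} _ = refl
  from : ∀ {b} → b ≡ true → IsTrue b
  from refl = _

-- Completeness of the block search

module _ {n : ℕ} (f : BoolFn n) where

  -- Invariant of the bisection: f has value `a` at the lower end and the opposite value at the
  -- upper end. At width 1 these are neighbours.
  rejectProb-search : ∀ ρ lo h a k {e} → a ≡ f (h lo) → a xor f (h (lo ℕ.+ 2 ℕ.^ ρ)) ≡ true →
    (∀ i → i ℕ.< lo ℕ.+ 2 ℕ.^ ρ → f (h i) xor f (h (suc i)) ≡ true → rejectProb (k i) f ≤ e) →
    rejectProb (search ρ lo h a k) f ≤ e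
  rejectProb-search zero    lo h a k a≡ change g rewrite ℕₚ.+-comm lo 1 = g lo ℕₚ.≤-refl (subst (λ a → a xor f (h (suc lo)) ≡ true) a≡ change)
  rejectProb-search (suc ρ) lo h a k a≡ change g with a xor f (h (lo ℕ.+ 2 ℕ.^ ρ)) in mid
  ... | true  = rejectProb-search ρ lo h a k a≡ mid λ i i< → g i (ℕₚ.<-≤-trans i< (ℕₚ.+-monoʳ-≤ lo (ℕₚ.m≤m+n (2 ℕ.^ ρ) _)))
  ... | false = rejectProb-search ρ (lo ℕ.+ 2 ℕ.^ ρ) h _ k refl
      (subst (λ z → f (h (lo ℕ.+ 2 ℕ.^ ρ)) xor f (h z) ≡ true) split (subst (λ b → b xor f (h (lo ℕ.+ 2 ℕ.^ suc ρ)) ≡ true) (xor≡false a _ mid) change))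
      λ i i< → g i (subst (i ℕ.<_) (sym split) i<)
    where
    split : lo ℕ.+ 2 ℕ.^ suc ρ ≡ lo ℕ.+ 2 ℕ.^ ρ ℕ.+ 2 ℕ.^ ρ
    split = trans (cong (λ z → lo ℕ.+ (2 ℕ.^ ρ ℕ.+ z)) (ℕₚ.+-identityʳ (2 ℕ.^ ρ))) (sym (ℕₚ.+-assoc lo (2 ℕ.^ ρ) (2 ℕ.^ ρ)))

  rejectProb-asBlock : ∀ {R i} k {e} (i<R : i ℕ.< R) → rejectProb (k (Fin.fromℕ< i<R)) f ≤ e → rejectProb (asBlock R i k) f ≤ e
  rejectProb-asBlock {R} {i} k i<R h with i ℕ.<? R
  ... | yes p = subst (λ b → rejectProb (k b) f ≤ _) (Finₚ.fromℕ<-cong i i refl i<R p) h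
  ... | no ≮  = ⊥-elim (≮ i<R)

module _ {n : ℕ} (f : BoolFn n) {k : ℕ} {β : ℚ} (nj : NearJunta f k β) {R : ℕ} (π : Vec (Fin R) n) (separated : InjectiveOn (NearJunta.U nj) π) where
  open NearJunta nj
  open Separated f nj π separated

  -- The termination measure: it starts at no more than the size of `U` and drops with every new
  -- block, so as many stages as relevant variables suffice.
  remaining : ∀ {K} → Vec (Entry R) K → Vec Bool n
  remaining es = tabulate λ i → lookup U i ∧ not (found es (lookup π i))

  lookup-hybrid : ∀ {K} (es : Vec (Entry R) K) w w′ i j →
    lookup (hybrid es w w′ i) j ≡ (if found es j ∨ (i ℕ.≤ᵇ Fin.toℕ j) then lookup w j else lookup w′ j)
  lookup-hybrid es w w′ i j = trans (lookup-mix (keep es i) w w′ j)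
    (cong (λ b → if b then lookup w j else lookup w′ j) (Vecₚ.lookup∘tabulate (λ j → found es j ∨ (i ℕ.≤ᵇ Fin.toℕ j)) j))

  hybrid-found : ∀ {K} (es : Vec (Entry R) K) w w′ i j → found es j ≡ true → lookup (hybrid es w w′ i) j ≡ lookup w j
  hybrid-found es w w′ i j h rewrite lookup-hybrid es w w′ i j | h = refl

  hybrid-start : ∀ {K} (es : Vec (Entry R) K) w w′ → hybrid es w w′ 0 ≡ w
  hybrid-start es w w′ = lookup-ext λ j → trans (lookup-hybrid es w w′ 0 j)
    (cong (λ b → if b then lookup w j else lookup w′ j) (Boolₚ.∨-zeroʳ (found es j)))

  hybrid-step : ∀ {K} (es : Vec (Entry R) K) w w′ i j → i ≢ Fin.toℕ j → lookup (hybrid es w w′ i) j ≡ lookup (hybrid es w w′ (suc i)) j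
  hybrid-step es w w′ i j i≢j = trans (lookup-hybrid es w w′ i j)
    (trans (cong (λ b → if found es j ∨ b then lookup w j else lookup w′ j) (≤ᵇ-step i≢j)) (sym (lookup-hybrid es w w′ (suc i) j)))

  residue-empty : ∀ {K} (es : Vec (Entry R) K) → count (remaining es) ≡ 0 → residue es ≡ 0ℚ
  residue-empty es none = trans (M-cong R λ w → trans (M-cong R λ w′ → zero′ w w′) (M-const R 0ℚ)) (M-const R 0ℚ)
    where
    all-found : ∀ i → i ∈ᵐ U → found es (lookup π i) ≡ true
    all-found i i∈ with found es (lookup π i) in eq
    ... | true  = refl
    ... | false with () ← trans (sym (trans (Vecₚ.lookup∘tabulate _ i) (cong₂ (λ a b → a ∧ not b) i∈ eq))) (count-empty (remaining es) none i)
    zero′ : ∀ w w′ → ⟦ core (spread π w) xor core (spread π (hybrid es w w′ R)) ⟧ ≡ 0ℚ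
    zero′ w w′ = cong ⟦_⟧ (trans (cong (core (spread π w) xor_) (core-dep _ (spread π w) λ i i∈ →
        trans (lookup-spread π (hybrid es w w′ R) i) (trans (hybrid-found es w w′ R (lookup π i) (all-found i i∈)) (sym (lookup-spread π w i)))))
      (Boolₚ.xor-same (core (spread π w))))

  -- The exposed block contains a single relevant variable by separation, so fixing the other
  -- blocks turns f into that variable or its negation.
  new-block : ∀ {K} {es : Vec (Entry R) K} {us} → Sound es us → ∀ w w′ (b : Fin R) → let h = λ i → spread π (hybrid es w w′ i) in
    bad (h (Fin.toℕ b)) ≡ false → bad (h (suc (Fin.toℕ b))) ≡ false →
    f (h (Fin.toℕ b)) xor f (h (suc (Fin.toℕ b))) ≡ true →
    let es′ = (b , hybrid es w w′ (Fin.toℕ b)) ∷ es in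
    Σ (Fin n) λ u → Sound es′ (u ∷ us) × count (remaining es′) ℕ.< count (remaining es)
  new-block {es = es} {us} sound w w′ b good₁ good₂ change = result (Finₚ.any? λ u → (lookup U u Boolₚ.≟ true) ×-dec (lookup π u Fin.≟ b))
    where
    i = Fin.toℕ b
    h₁ = hybrid es w w′ i
    h₂ = hybrid es w w′ (suc i)
    elsewhere : ∀ j → j ≢ b → lookup h₁ j ≡ lookup h₂ j
    elsewhere j j≢b = hybrid-step es w w′ i j (λ eq → j≢b (sym (Finₚ.toℕ-injective eq)))
    spread-agree : (∀ l → l ∈ᵐ U → lookup h₁ (lookup π l) ≡ lookup h₂ (lookup π l)) → ⊥
    spread-agree ag with () ← trans (sym change) (trans (cong (_xor f (spread π h₂))
      (stable good₁ λ l l∈ → trans (lookup-spread π h₁ l) (trans (ag l l∈) (sym (lookup-spread π h₂ l))))) (Boolₚ.xor-same (f (spread π h₂))))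
    result : Dec (Σ (Fin n) λ u → u ∈ᵐ U × lookup π u ≡ b) → _
    result (no none) = ⊥-elim (spread-agree λ l l∈ → elsewhere (lookup π l) (λ eq → none (l , l∈ , eq)))
    result (yes (u , u∈ , πu≡b)) = u , new u∈ πu≡b fresh exact sound , smaller
      where
      differ : lookup h₁ b ≢ lookup h₂ b
      differ eq = spread-agree λ l l∈ → lem l (lookup π l Fin.≟ b)
        where
        lem : ∀ l → Dec (lookup π l ≡ b) → lookup h₁ (lookup π l) ≡ lookup h₂ (lookup π l)
        lem l (yes refl) = eq
        lem l (no ≢b)    = elsewhere (lookup π l) ≢b
      fresh : found es b ≡ false
      fresh with found es b in eq
      ... | false = refl
      ... | true  = ⊥-elim (differ (trans (hybrid-found es w w′ i b eq) (sym (hybrid-found es w w′ (suc i) b eq))))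
      P = probe π (b , h₁)
      lookup-P : ∀ x l → lookup (P x) l ≡ (if does (lookup π l Fin.≟ b) then lookup x l else lookup h₁ (lookup π l))
      lookup-P x l = Vecₚ.lookup∘tabulate _ l
      P-agree : ∀ x g → lookup x u ≡ lookup g b → (∀ j → j ≢ b → lookup h₁ j ≡ lookup g j) → Agree U (spread π g) (P x)
      P-agree x g eq other l l∈ = trans (lookup-spread π g l) (trans (lem (lookup π l Fin.≟ b)) (sym (lookup-P x l)))
        where
        lem : (d : Dec (lookup π l ≡ b)) → lookup g (lookup π l) ≡ (if does d then lookup x l else lookup h₁ (lookup π l))
        lem (yes eq′) = trans (cong (lookup g) eq′) (trans (sym eq) (cong (lookup x) (separated u l u∈ l∈ (trans πu≡b (sym eq′)))))
        lem (no ≢b)   = sym (other (lookup π l) ≢b)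
      exact : Exact f P u
      -- Depending on the bit of `x` at `u`, the probe agrees on `U` with `h₁` or with `h₂`, and f
      -- takes opposite values there. The constant is read off at `h₁`.
      exact = lookup h₁ b xor f (spread π h₁) , λ x → value x (lookup x u Boolₚ.≟ lookup h₁ b)
        where
        canc : ∀ a c → a xor (a xor c) ≡ c
        canc a c = trans (sym (Boolₚ.xor-assoc a a c)) (cong (_xor c) (Boolₚ.xor-same a))
        value : ∀ x → Dec (lookup x u ≡ lookup h₁ b) → f (P x) ≡ lookup x u xor (lookup h₁ b xor f (spread π h₁))
        value x (yes eq) = trans (sym (stable good₁ (P-agree x h₁ eq λ _ _ → refl)))
          (trans (sym (canc (lookup h₁ b) (f (spread π h₁)))) (cong (_xor (lookup h₁ b xor f (spread π h₁))) (sym eq)))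
        value x (no x≢) = trans (sym (stable good₂ (P-agree x h₂ x₂ elsewhere))) (trans f₂
          (trans (cong not (sym (canc (lookup h₁ b) (f (spread π h₁))))) (trans (Boolₚ.not-distribˡ-xor (lookup h₁ b) _) (cong (_xor (lookup h₁ b xor f (spread π h₁))) (sym x₁)))))
          where
          x₁ : lookup x u ≡ not (lookup h₁ b)
          x₁ = ≢⇒≡not (x≢ ∘ sym)
          x₂ : lookup x u ≡ lookup h₂ b
          x₂ = trans x₁ (sym (≢⇒≡not differ))
          f₂ : f (spread π h₂) ≡ not (f (spread π h₁))
          f₂ = ≢⇒≡not λ eq → true≢false (trans (sym change) (trans (cong (f (spread π h₁) xor_) (sym eq)) (Boolₚ.xor-same (f (spread π h₁)))))
            where
            true≢false : true ≢ false
            true≢false ()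
      smaller : count (remaining ((b , h₁) ∷ es)) ℕ.< count (remaining es)
      smaller = count-strict (remaining es) (remaining ((b , h₁) ∷ es)) sub u in-old out-new
        where
        sub : ∀ l → l ∈ᵐ remaining ((b , h₁) ∷ es) → l ∈ᵐ remaining es
        sub l l∈ = trans (Vecₚ.lookup∘tabulate _ l) (lem (lookup U l) (does (b Fin.≟ lookup π l)) (found es (lookup π l)) (trans (sym (Vecₚ.lookup∘tabulate _ l)) l∈))
          where
          lem : ∀ a c d → a ∧ not (c ∨ d) ≡ true → a ∧ not d ≡ true
          lem true false d h = h
        in-old : u ∈ᵐ remaining es
        in-old = trans (Vecₚ.lookup∘tabulate _ u) (cong₂ (λ a c → a ∧ not c) u∈ (trans (cong (found es) πu≡b) fresh))
        out-new : lookup (remaining ((b , h₁) ∷ es)) u ≡ false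
        out-new = trans (Vecₚ.lookup∘tabulate _ u) (trans (cong (λ c → lookup U u ∧ not c) (trans (cong (found ((b , h₁) ∷ es)) πu≡b) (found-true {es = es} {b} {h₁}))) (Boolₚ.∧-zeroʳ (lookup U u)))

  anyBad : ∀ {K} → Vec (Entry R) K → (w w′ : Vec Bool R) → ℕ → Bool
  anyBad es w w′ zero    = bad (spread π (hybrid es w w′ zero))
  anyBad es w w′ (suc i) = bad (spread π (hybrid es w w′ (suc i))) ∨ anyBad es w w′ i

  -- Which hybrids the search visits depends on f and on `w`, `w′`, so badness is excluded at all
  -- steps from 0 to `i` at once. Taken at `R`, this union bound is why 2^-W has to beat 2^ρ.
  M-anyBad : ∀ {K} (es : Vec (Entry R) K) i → M R (λ w → M R λ w′ → ⟦ anyBad es w w′ i ⟧) ≤ ι (suc i) * β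
  M-anyBad es zero    = ℚₚ.≤-trans (M-bad-hybrid es zero) (ℚₚ.≤-reflexive (sym (ℚₚ.*-identityˡ β)))
  M-anyBad es (suc i) = begin
    M R (λ w → M R λ w′ → ⟦ anyBad es w w′ (suc i) ⟧)
      ≤⟨ M-≤-+ R (λ w → M-≤-+ R λ w′ → ⟦∨⟧ (bad (spread π (hybrid es w w′ (suc i)))) (anyBad es w w′ i)) ⟩
    M R (λ w → M R λ w′ → ⟦ bad (spread π (hybrid es w w′ (suc i))) ⟧) + M R (λ w → M R λ w′ → ⟦ anyBad es w w′ i ⟧)
      ≤⟨ ℚₚ.+-mono-≤ (M-bad-hybrid es (suc i)) (M-anyBad es i) ⟩
    β + ι (suc i) * β             ≡⟨ solve 2 (λ b m → b :+ m :* b := (con 1ℚ :+ m) :* b) refl β (ι (suc i)) ⟩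
    (1ℚ + ι (suc i)) * β          ≡⟨ cong (_* β) (sym (ι-suc (suc i))) ⟩
    ι (suc (suc i)) * β           ∎
    where
    open ℚₚ.≤-Reasoning

  anyBad-false : ∀ {K} (es : Vec (Entry R) K) w w′ m → anyBad es w w′ m ≡ false → ∀ i → i ℕ.≤ m → bad (spread π (hybrid es w w′ i)) ≡ false
  anyBad-false es w w′ zero    h zero    _  = h
  anyBad-false es w w′ (suc m) h i       le with ℕₚ.m≤n⇒m<n∨m≡n le
  ... | inj₁ (ℕ.s≤s i≤m) = anyBad-false es w w′ m (proj₂ (∨-false h)) i i≤m
  ... | inj₂ refl        = proj₁ (∨-false h)

module _ {n : ℕ} (f : BoolFn n) {k : ℕ} {β : ℚ} (nj : NearJunta f k β) {ρ : ℕ} (π : Vec (Fin (2 ℕ.^ ρ)) n)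
         (separated : InjectiveOn (NearJunta.U nj) π) (q : ℕ) .{{_ : ℕ.NonZero q}} where
  open NearJunta nj
  open Separated f nj π separated
  open Find ρ π q

  private
    R : ℕ
    R = 2 ℕ.^ ρ

    γ : ℚ
    γ = ι (suc R) * β

  module _ (cont : ∀ K → Vec (Entry R) K → Alg n) where

    -- Off the bad event the two end values of f differ exactly when those of `core` do, so the
    -- outcome is the mixture of `S` and `F` with weight `residue es`. On the bad event the
    -- rejection probability is at most 1, which `γ` pays for.
    round : ∀ {K} {es : Vec (Entry R) K} {us} → Sound es us → ∀ p j {S F} → 0ℚ ≤ S → 0ℚ ≤ F →
      (∀ {e u} → Sound (e ∷ es) (u ∷ us) → count (remaining f nj π separated (e ∷ es)) ℕ.< count (remaining f nj π separated es) →
        rejectProb (find p q (e ∷ es) cont) f ≤ S) →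
      rejectProb (find (suc p) j es cont) f ≤ F →
      rejectProb (find (suc p) (suc j) es cont) f ≤ γ + (F + residue es * (S - F))
    round {es = es} {us} sound p j {S} {F} S≥0 F≥0 success failure = begin
      rejectProb (find (suc p) (suc j) es cont) f
        ≡⟨ trans (rejectProb-draw f R _) (M-cong R λ w → rejectProb-draw f R _) ⟩
      M R (λ w → M R λ w′ → outcome w w′ (f (h w w′ 0) xor f (h w w′ R)))
        ≤⟨ M-≤-+ R (λ w → M-≤-+ R λ w′ → ptw w w′ (anyBad f nj π separated es w w′ R) (differs w w′) refl refl) ⟩
      M R (λ w → M R λ w′ → ⟦ anyBad f nj π separated es w w′ R ⟧) + M R (λ w → M R λ w′ → F + ⟦ differs w w′ ⟧ * (S - F))
        ≤⟨ ℚₚ.+-mono-≤ (M-anyBad f nj π separated es R) (ℚₚ.≤-reflexive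
             (trans (M-cong R λ w → trans (M-+ˡ R F (λ w′ → ⟦ differs w w′ ⟧ * (S - F))) (cong (F +_) (M-*ʳ R (λ w′ → ⟦ differs w w′ ⟧) (S - F))))
               (trans (M-+ˡ R F (λ w → M R (λ w′ → ⟦ differs w w′ ⟧) * (S - F))) (cong (F +_) (M-*ʳ R (λ w → M R (λ w′ → ⟦ differs w w′ ⟧)) (S - F)))))) ⟩
      γ + (F + residue es * (S - F)) ∎
      where
      open ℚₚ.≤-Reasoning
      h : Vec Bool R → Vec Bool R → ℕ → Input n
      h w w′ i = spread π (hybrid es w w′ i)
      differs : Vec Bool R → Vec Bool R → Bool
      differs w w′ = core (spread π w) xor core (h w w′ R)
      outcome : Vec Bool R → Vec Bool R → Bool → ℚ
      outcome w w′ c = rejectProb (if c then newBlock es w w′ (f (h w w′ 0)) (λ e → find p q (e ∷ es) cont) else find (suc p) j es cont) f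
      outcome≤1 : ∀ w w′ c → outcome w w′ c ≤ 1ℚ
      outcome≤1 w w′ c = rejectProb≤1 f (if c then newBlock es w w′ (f (h w w′ 0)) (λ e → find p q (e ∷ es) cont) else find (suc p) j es cont)
      interpolate : Bool → ℚ
      interpolate d = F + ⟦ d ⟧ * (S - F)
      interpolate-true : S ≡ interpolate true
      interpolate-true = solve 2 (λ s f → s := f :+ con 1ℚ :* (s :- f)) refl S F
      interpolate-false : F ≡ interpolate false
      interpolate-false = solve 2 (λ s f → f := f :+ con 0ℚ :* (s :- f)) refl S F
      interpolate≥0 : ∀ d → 0ℚ ≤ interpolate d
      interpolate≥0 true  = ℚₚ.≤-trans S≥0 (ℚₚ.≤-reflexive interpolate-true)
      interpolate≥0 false = ℚₚ.≤-trans F≥0 (ℚₚ.≤-reflexive interpolate-false)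
      good-outcome : ∀ w w′ → anyBad f nj π separated es w w′ R ≡ false → ∀ d → f (h w w′ 0) xor f (h w w′ R) ≡ d →
        outcome w w′ d ≤ interpolate d
      good-outcome w w′ good false _      = ℚₚ.≤-trans failure (ℚₚ.≤-reflexive interpolate-false)
      good-outcome w w′ good true  change = ℚₚ.≤-trans
        (rejectProb-search f ρ 0 (h w w′) (f (h w w′ 0)) _ refl change λ i i<R step →
          rejectProb-asBlock f _ i<R (at i (Fin.fromℕ< i<R) (Finₚ.toℕ-fromℕ< i<R) i<R step))
        (ℚₚ.≤-reflexive interpolate-true)
        where
        at : ∀ i b → Fin.toℕ b ≡ i → i ℕ.< R → f (h w w′ i) xor f (h w w′ (suc i)) ≡ true →
          rejectProb (find p q ((b , hybrid es w w′ i) ∷ es) cont) f ≤ S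
        at i b refl i<R step =
          let u , sound′ , fewer = new-block f nj π separated sound w w′ b
                (anyBad-false f nj π separated es w w′ R good i (ℕₚ.<⇒≤ i<R))
                (anyBad-false f nj π separated es w w′ R good (suc i) i<R) step
          in success sound′ fewer
      ptw : ∀ w w′ a d → anyBad f nj π separated es w w′ R ≡ a → differs w w′ ≡ d →
        outcome w w′ (f (h w w′ 0) xor f (h w w′ R)) ≤ ⟦ a ⟧ + interpolate d
      ptw w w′ true  d _    _   = ℚₚ.≤-trans (outcome≤1 w w′ (f (h w w′ 0) xor f (h w w′ R))) (≤+ʳ (interpolate≥0 d))
      ptw w w′ false d good dif = ℚₚ.≤-trans (ℚₚ.≤-reflexive (cong (outcome w w′) same))
          (ℚₚ.≤-trans (good-outcome w w′ good d same) (≤+ˡ ℚₚ.≤-refl))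
        where
        same : f (h w w′ 0) xor f (h w w′ R) ≡ d
        same = trans (cong₂ _xor_
          (trans (f-core (h w w′ 0) (anyBad-false f nj π separated es w w′ R good 0 ℕ.z≤n)) (cong (core ∘ spread π) (hybrid-start f nj π separated es w w′)))
          (f-core (h w w′ R) (anyBad-false f nj π separated es w w′ R good R ℕₚ.≤-refl))) dif

    module _ {p₀ : ℕ} {A t : ℚ} (A≥0 : 0ℚ ≤ A) (t≥0 : 0ℚ ≤ t) (β≥0 : 0ℚ ≤ β)
      (cont≤ : ∀ {K} {es : Vec (Entry R) K} {us} → Sound es us → K ℕ.≤ p₀ → rejectProb (cont K es) f ≤ A + t * residue es) where

      -- The term `r * (1ℚ - r) ^ j` is the loss when the remaining attempts of this stage all fail,
      -- `ι p * inv q` allows 1/q for each later stage, and the last term charges `γ` to every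
      -- possible attempt.
      find-bound : ℚ → ℕ → ℕ → ℚ
      find-bound r p j = A + t * (r * (1ℚ - r) ^ j + ι p * inv q) + ι (j ℕ.+ p ℕ.* q) * γ

      private
        γ≥0 : 0ℚ ≤ γ
        γ≥0 = 0≤* (ι≥0 (suc R)) β≥0

        cγ≥0 : ∀ c → 0ℚ ≤ ι c * γ
        cγ≥0 c = 0≤* (ι≥0 c) γ≥0

        tail≥0 : ∀ {K} (es : Vec (Entry R) K) p j → 0ℚ ≤ residue es * (1ℚ - residue es) ^ j + ι p * inv q
        tail≥0 es p j = 0≤+ (0≤* (residue≥0 es) (^-nonneg (0≤- (residue≤1 es)) j)) (0≤* (ι≥0 p) (inv≥0 q))

        find-bound≥0 : ∀ {K} (es : Vec (Entry R) K) p j → 0ℚ ≤ find-bound (residue es) p j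
        find-bound≥0 es p j = 0≤+ (0≤+ A≥0 (0≤* t≥0 (tail≥0 es p j))) (cγ≥0 (j ℕ.+ p ℕ.* q))

      -- After a success the new residue, whatever it is, costs at most 1/q by `r*pow≤inv`; this is
      -- absorbed in the (p+1)/q of `S`. The mixture then equals S + (1 - r)(F - S), which turns
      -- `(1ℚ - r) ^ j` into the next power.
      find-complete : ∀ p j {K} {es : Vec (Entry R) K} {us} → Sound es us → count (remaining f nj π separated es) ℕ.≤ p → p ℕ.+ K ℕ.≤ p₀ →
        rejectProb (find p j es cont) f ≤ find-bound (residue es) p j
      find-complete zero j {es = es} sound none K≤ = begin
        rejectProb (cont _ es) f      ≤⟨ cont≤ sound K≤ ⟩
        A + t * residue es            ≤⟨ ℚₚ.+-monoʳ-≤ A (*-monoˡ t t≥0 (ℚₚ.≤-trans (ℚₚ.≤-reflexive (residue-empty f nj π separated es (ℕₚ.n≤0⇒n≡0 none))) (tail≥0 es 0 j))) ⟩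
        A + t * (residue es * (1ℚ - residue es) ^ j + ι 0 * inv q)   ≤⟨ ≤+ʳ (cγ≥0 (j ℕ.+ 0)) ⟩
        find-bound (residue es) 0 j        ∎
        where open ℚₚ.≤-Reasoning
      find-complete (suc p) zero {K} {es} sound few K≤ = begin
        rejectProb (cont _ es) f      ≤⟨ cont≤ sound (ℕₚ.≤-trans (ℕₚ.m≤n+m K (suc p)) K≤) ⟩
        A + t * residue es            ≡⟨ cong (λ e → A + t * e) (sym (ℚₚ.*-identityʳ (residue es))) ⟩
        A + t * (residue es * 1ℚ)     ≤⟨ ℚₚ.+-monoʳ-≤ A (*-monoˡ t t≥0 (≤+ʳ (0≤* (ι≥0 (suc p)) (inv≥0 q)))) ⟩
        A + t * (residue es * 1ℚ + ι (suc p) * inv q)   ≤⟨ ≤+ʳ (cγ≥0 (suc p ℕ.* q)) ⟩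
        find-bound (residue es) (suc p) zero ∎
        where open ℚₚ.≤-Reasoning
      find-complete (suc p) (suc j) {K} {es} sound few K≤ = ℚₚ.≤-trans
        (round sound p j S≥0 (find-bound≥0 es (suc p) j)
          (λ {e} sound′ fewer → ℚₚ.≤-trans (find-complete p q sound′ (ℕₚ.≤-pred (ℕₚ.≤-trans fewer few)) (subst (ℕ._≤ p₀) (sym (ℕₚ.+-suc p K)) K≤)) (find-bound≤S (e ∷ es)))
          (find-complete (suc p) j sound few K≤))
        (ℚₚ.≤-reflexive (trans
          (solve 7 (λ g a t r P i c → g :+ ((a :+ t :* (r :* P :+ i) :+ c :* g) :+ r :* ((a :+ t :* i :+ c :* g) :- (a :+ t :* (r :* P :+ i) :+ c :* g)))
             := a :+ t :* (r :* ((con 1ℚ :- r) :* P) :+ i) :+ (con 1ℚ :+ c) :* g) refl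
             γ A t r ((1ℚ - r) ^ j) (ι (suc p) * inv q) (ι c))
          (cong (λ z → A + t * (r * (1ℚ - r) ^ suc j + ι (suc p) * inv q) + z * γ) (sym (ι-suc c)))))
        where
        r = residue es
        c = j ℕ.+ suc p ℕ.* q
        S : ℚ
        S = A + t * (ι (suc p) * inv q) + ι c * γ
        S≥0 : 0ℚ ≤ S
        S≥0 = 0≤+ (0≤+ A≥0 (0≤* t≥0 (0≤* (ι≥0 (suc p)) (inv≥0 q)))) (cγ≥0 c)
        find-bound≤S : ∀ {K} (es : Vec (Entry R) K) → find-bound (residue es) p q ≤ S
        find-bound≤S es = ℚₚ.+-mono-≤
          (ℚₚ.+-monoʳ-≤ A (*-monoˡ t t≥0 (ℚₚ.≤-trans
            (ℚₚ.+-monoˡ-≤ (ι p * inv q) (r*pow≤inv (residue≥0 es) (residue≤1 es) q))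
            (ℚₚ.≤-reflexive (trans (solve 2 (λ i m → i :+ m :* i := (con 1ℚ :+ m) :* i) refl (inv q) (ι p)) (cong (_* inv q) (sym (ι-suc p))))))))
          (*-monoʳ γ γ≥0 (ι-mono (ℕₚ.m≤n+m (q ℕ.+ p ℕ.* q) j)))

-- Random blocks

M-index : ∀ ρ (i : Fin (2 ℕ.^ ρ)) → M ρ (λ b → ⟦ does (i Fin.≟ index b) ⟧) ≤ ½ ^ ρ
M-index zero    i = ⟦⟧≤1 (does (i Fin.≟ index []))
M-index (suc ρ) i with Finₚ.combine-surjective {2} {2 ℕ.^ ρ} i
... | x , y , refl = ℚₚ.≤-trans (½-mono (half x false) (half x true))
    (ℚₚ.≤-trans (ℚₚ.≤-reflexive (sym (cong (½ *_) (ℚₚ.*-distribʳ-+ (½ ^ ρ) ⟦ does (x Fin.≟ bit false) ⟧ ⟦ does (x Fin.≟ bit true) ⟧)))) (one x))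
  where
  half : ∀ x c → M ρ (λ b → ⟦ does (Fin.combine x y Fin.≟ Fin.combine (bit c) (index b)) ⟧) ≤ ⟦ does (x Fin.≟ bit c) ⟧ * ½ ^ ρ
  half x c with x Fin.≟ bit c
  ... | yes _ = ℚₚ.≤-trans (M-mono ρ λ b → ptw b (Fin.combine x y Fin.≟ Fin.combine (bit c) (index b)) (y Fin.≟ index b))
                  (ℚₚ.≤-trans (M-index ρ y) (ℚₚ.≤-reflexive (sym (ℚₚ.*-identityˡ (½ ^ ρ)))))
    where
    ptw : ∀ b (d : Dec (Fin.combine x y ≡ Fin.combine (bit c) (index b))) (e : Dec (y ≡ index b)) → ⟦ does d ⟧ ≤ ⟦ does e ⟧
    ptw b (yes p) (yes _) = ℚₚ.≤-refl
    ptw b (yes p) (no ≢y) = ⊥-elim (≢y (Finₚ.combine-injectiveʳ x y (bit c) (index b) p))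
    ptw b (no _)  e       = ⟦⟧≥0 (does e)
  ... | no x≢ = ℚₚ.≤-trans (M-≤ ρ λ b → ptw b (Fin.combine x y Fin.≟ Fin.combine (bit c) (index b))) (ℚₚ.≤-reflexive (sym (ℚₚ.*-zeroˡ (½ ^ ρ))))
    where
    ptw : ∀ b (d : Dec (Fin.combine x y ≡ Fin.combine (bit c) (index b))) → ⟦ does d ⟧ ≤ 0ℚ
    ptw b (yes p) = ⊥-elim (x≢ (Finₚ.combine-injectiveˡ x y (bit c) (index b) p))
    ptw b (no _)  = ℚₚ.≤-refl
  one : ∀ (x : Fin 2) → ½ * ((⟦ does (x Fin.≟ bit false) ⟧ + ⟦ does (x Fin.≟ bit true) ⟧) * ½ ^ ρ) ≤ ½ * ½ ^ ρ
  one Fin.zero           = ℚₚ.≤-reflexive (cong (½ *_) (ℚₚ.*-identityˡ (½ ^ ρ)))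
  one (Fin.suc Fin.zero) = ℚₚ.≤-reflexive (cong (½ *_) (ℚₚ.*-identityˡ (½ ^ ρ)))

module _ (ρ : ℕ) where

  private
    R : ℕ
    R = 2 ℕ.^ ρ

  hits : ∀ {m} → Fin R → Vec Bool m → Vec (Fin R) m → ℚ
  hits i []          []      = 0ℚ
  hits i (false ∷ U) (j ∷ π) = hits i U π
  hits i (true ∷ U)  (j ∷ π) = ⟦ does (i Fin.≟ j) ⟧ + hits i U π

  collisions : ∀ {m} → Vec Bool m → Vec (Fin R) m → ℚ
  collisions []          []      = 0ℚ
  collisions (false ∷ U) (i ∷ π) = collisions U π
  collisions (true ∷ U)  (i ∷ π) = hits i U π + collisions U π

  hits≥0 : ∀ {m} i (U : Vec Bool m) π → 0ℚ ≤ hits i U π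
  hits≥0 i []          []      = ℚₚ.≤-refl
  hits≥0 i (false ∷ U) (j ∷ π) = hits≥0 i U π
  hits≥0 i (true ∷ U)  (j ∷ π) = 0≤+ (⟦⟧≥0 (does (i Fin.≟ j))) (hits≥0 i U π)

  collisions≥0 : ∀ {m} (U : Vec Bool m) π → 0ℚ ≤ collisions U π
  collisions≥0 []          []      = ℚₚ.≤-refl
  collisions≥0 (false ∷ U) (j ∷ π) = collisions≥0 U π
  collisions≥0 (true ∷ U)  (j ∷ π) = 0≤+ (hits≥0 j U π) (collisions≥0 U π)

  missed-or-hit : ∀ {m} i (U : Vec Bool m) π → (∀ l → l ∈ᵐ U → i ≢ lookup π l) ⊎ 1ℚ ≤ hits i U π
  missed-or-hit i []          []      = inj₁ λ ()
  missed-or-hit i (false ∷ U) (j ∷ π) with missed-or-hit i U π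
  ... | inj₁ miss = inj₁ λ { (Fin.suc l) l∈ → miss l l∈ }
  ... | inj₂ hit  = inj₂ hit
  missed-or-hit i (true ∷ U)  (j ∷ π) with i Fin.≟ j | missed-or-hit i U π
  ... | yes _  | _         = inj₂ (≤+ʳ (hits≥0 i U π))
  ... | no i≢j | inj₁ miss = inj₁ λ { Fin.zero _ → i≢j ; (Fin.suc l) l∈ → miss l l∈ }
  ... | no _   | inj₂ hit  = inj₂ (ℚₚ.≤-trans hit (≤+ˡ ℚₚ.≤-refl))

  separated-or-collision : ∀ {m} (U : Vec Bool m) π → InjectiveOn U π ⊎ 1ℚ ≤ collisions U π
  separated-or-collision []          []      = inj₁ λ ()
  separated-or-collision (false ∷ U) (i ∷ π) with separated-or-collision U π
  ... | inj₁ sep = inj₁ λ { (Fin.suc a) (Fin.suc b) a∈ b∈ eq → cong Fin.suc (sep a b a∈ b∈ eq) }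
  ... | inj₂ col = inj₂ col
  separated-or-collision (true ∷ U)  (i ∷ π) with missed-or-hit i U π | separated-or-collision U π
  ... | inj₂ hit  | _        = inj₂ (ℚₚ.≤-trans hit (≤+ʳ (collisions≥0 U π)))
  ... | inj₁ _    | inj₂ col = inj₂ (ℚₚ.≤-trans col (≤+ˡ (hits≥0 i U π)))
  ... | inj₁ miss | inj₁ sep = inj₁ λ where
      Fin.zero    Fin.zero    _  _  _  → refl
      Fin.zero    (Fin.suc b) _  b∈ eq → ⊥-elim (miss b b∈ eq)
      (Fin.suc a) Fin.zero    a∈ _  eq → ⊥-elim (miss a a∈ (sym eq))
      (Fin.suc a) (Fin.suc b) a∈ b∈ eq → cong Fin.suc (sep a b a∈ b∈ eq)

  meanBlocks : ∀ m → (Vec (Fin R) m → ℚ) → ℚ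
  meanBlocks zero    X = X []
  meanBlocks (suc m) X = M ρ λ b → meanBlocks m λ π → X (index b ∷ π)

  meanBlocks-mono : ∀ m {X Y} → (∀ π → X π ≤ Y π) → meanBlocks m X ≤ meanBlocks m Y
  meanBlocks-mono zero    h = h []
  meanBlocks-mono (suc m) h = M-mono ρ λ b → meanBlocks-mono m λ π → h _

  meanBlocks-+ : ∀ m X Y → meanBlocks m (λ π → X π + Y π) ≡ meanBlocks m X + meanBlocks m Y
  meanBlocks-+ zero    X Y = refl
  meanBlocks-+ (suc m) X Y = trans (M-cong ρ λ b → meanBlocks-+ m (λ π → X (index b ∷ π)) (λ π → Y (index b ∷ π)))
    (M-+ ρ (λ b → meanBlocks m (λ π → X (index b ∷ π))) (λ b → meanBlocks m (λ π → Y (index b ∷ π))))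

  meanBlocks-const : ∀ m c → meanBlocks m (λ _ → c) ≡ c
  meanBlocks-const zero    c = refl
  meanBlocks-const (suc m) c = trans (M-cong ρ λ b → meanBlocks-const m c) (M-const ρ c)

  mean-hits : ∀ {m} i (U : Vec Bool m) → meanBlocks m (hits i U) ≤ ι (count U) * ½ ^ ρ
  mean-hits i []          = ℚₚ.≤-reflexive (sym (ℚₚ.*-zeroˡ (½ ^ ρ)))
  mean-hits i (false ∷ U) = M-≤ ρ λ b → mean-hits i U
  mean-hits {suc m} i (true ∷ U) = begin
    M ρ (λ b → meanBlocks m λ π → ⟦ does (i Fin.≟ index b) ⟧ + hits i U π)
      ≡⟨ M-cong ρ (λ b → trans (meanBlocks-+ m (λ _ → ⟦ does (i Fin.≟ index b) ⟧) (hits i U))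
           (cong (_+ meanBlocks m (hits i U)) (meanBlocks-const m ⟦ does (i Fin.≟ index b) ⟧))) ⟩
    M ρ (λ b → ⟦ does (i Fin.≟ index b) ⟧ + meanBlocks m (hits i U))
      ≡⟨ M-+ʳ ρ (λ b → ⟦ does (i Fin.≟ index b) ⟧) (meanBlocks m (hits i U)) ⟩
    M ρ (λ b → ⟦ does (i Fin.≟ index b) ⟧) + meanBlocks m (hits i U)
      ≤⟨ ℚₚ.+-mono-≤ (M-index ρ i) (mean-hits i U) ⟩
    ½ ^ ρ + ι (count U) * ½ ^ ρ     ≡⟨ solve 2 (λ p c → p :+ c :* p := (con 1ℚ :+ c) :* p) refl (½ ^ ρ) (ι (count U)) ⟩
    (1ℚ + ι (count U)) * ½ ^ ρ      ≡⟨ cong (_* ½ ^ ρ) (sym (ι-suc (count U))) ⟩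
    ι (suc (count U)) * ½ ^ ρ       ∎
    where open ℚₚ.≤-Reasoning

  -- Birthday bound: the block of each variable of `U` meets that of any later one with probability
  -- at most 2^-ρ, and c + c² ≤ (c+1)².
  mean-collisions : ∀ {m} (U : Vec Bool m) → meanBlocks m (collisions U) ≤ ι (count U ℕ.* count U) * ½ ^ ρ
  mean-collisions []          = ℚₚ.≤-reflexive (sym (ℚₚ.*-zeroˡ (½ ^ ρ)))
  mean-collisions (false ∷ U) = M-≤ ρ λ b → mean-collisions U
  mean-collisions {suc m} (true ∷ U) = M-≤ ρ λ b → begin
    meanBlocks m (λ π → hits (index b) U π + collisions U π)
      ≡⟨ meanBlocks-+ m (hits (index b) U) (collisions U) ⟩
    meanBlocks m (hits (index b) U) + meanBlocks m (collisions U)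
      ≤⟨ ℚₚ.+-mono-≤ (mean-hits (index b) U) (mean-collisions U) ⟩
    ι c * ½ ^ ρ + ι (c ℕ.* c) * ½ ^ ρ     ≡⟨ sym (trans (cong (_* ½ ^ ρ) (ι-+ c (c ℕ.* c))) (ℚₚ.*-distribʳ-+ (½ ^ ρ) (ι c) (ι (c ℕ.* c)))) ⟩
    ι (c ℕ.+ c ℕ.* c) * ½ ^ ρ             ≤⟨ *-monoʳ (½ ^ ρ) (^-nonneg 0≤½ ρ) (ι-mono (ℕₚ.*-monoʳ-≤ (suc c) (ℕₚ.n≤1+n c))) ⟩
    ι (suc c ℕ.* suc c) * ½ ^ ρ           ∎
    where
    open ℚₚ.≤-Reasoning
    c = count U

  rejectProb-drawBlocks : ∀ {n} (f : BoolFn n) m (k : Vec (Fin R) m → Alg n) →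
    rejectProb (drawBlocks ρ m k) f ≡ meanBlocks m (λ π → rejectProb (k π) f)
  rejectProb-drawBlocks f zero    k = refl
  rejectProb-drawBlocks f (suc m) k = trans (rejectProb-draw f ρ _) (M-cong ρ λ b → rejectProb-drawBlocks f m (λ π → k (index b ∷ π)))

  -- Markov's inequality in pointwise form: without separation the number of collisions is at least
  -- 1, hence at least the rejection probability.
  drawBlocks-complete : ∀ {n} (f : BoolFn n) {m} (U : Vec Bool m) (k : Vec (Fin R) m → Alg n) {B} → 0ℚ ≤ B →
    (∀ π → InjectiveOn U π → rejectProb (k π) f ≤ B) →
    rejectProb (drawBlocks ρ m k) f ≤ B + ι (count U ℕ.* count U) * ½ ^ ρ
  drawBlocks-complete f {m} U k {B} B≥0 h = begin
    rejectProb (drawBlocks ρ m k) f                       ≡⟨ rejectProb-drawBlocks f m k ⟩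
    meanBlocks m (λ π → rejectProb (k π) f)               ≤⟨ meanBlocks-mono m ptw ⟩
    meanBlocks m (λ π → B + collisions U π)               ≡⟨ trans (meanBlocks-+ m (λ _ → B) (collisions U)) (cong (_+ meanBlocks m (collisions U)) (meanBlocks-const m B)) ⟩
    B + meanBlocks m (collisions U)                       ≤⟨ ℚₚ.+-monoʳ-≤ B (mean-collisions U) ⟩
    B + ι (count U ℕ.* count U) * ½ ^ ρ                   ∎
    where
    open ℚₚ.≤-Reasoning
    ptw : ∀ π → rejectProb (k π) f ≤ B + collisions U π
    ptw π with separated-or-collision U π
    ... | inj₁ sep = ℚₚ.≤-trans (h π sep) (≤+ʳ (collisions≥0 U π))
    ... | inj₂ col = ℚₚ.≤-trans (rejectProb≤1 f (k π)) (ℚₚ.≤-trans col (≤+ˡ B≥0))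

-- Total rejection probability

module _ {n s : ℕ} (ρ p q m h E : ℕ) .{{_ : ℕ.NonZero q}} where

  -- The six summands are, in order: bad inputs in verification and learning, inaccuracy δ of the
  -- hypothesis, survival of a poor candidate, blocks left unfound, bad hybrids during the search,
  -- and two relevant variables in one block.
  tester-complete : ∀ W {δ} → 1 ℕ.≤ W → p ≡ suc (s ℕ.* W) → 0ℚ ≤ δ → δ ≤ 1ℚ → ∀ (f : BoolFn n) → InSizeCircuit s f →
    let t = ι (4 ℕ.* E); β = ι s * ½ ^ W in
    rejectProb (Tester.tester n s ρ p q m h E (allCircuits s)) f
      ≤ ((t * (β + β) + t * δ + ι (2 ℕ.^ (suc s ℕ.* (p ℕ.+ s ℕ.+ 4))) * (1ℚ - δ) ^ m)
          + t * (ι (suc p) * inv q) + ι (q ℕ.+ p ℕ.* q) * (ι (suc (2 ℕ.^ ρ)) * β))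
        + ι (p ℕ.* p) * ½ ^ ρ
  tester-complete W {δ} 1≤W refl δ≥0 δ≤1 f (m₀ , m₀≤s , C , f≡) = ℚₚ.≤-trans
    (drawBlocks-complete ρ f U (λ π → Find.find ρ π q p q [] (learnAndCheck π)) total≥0 each)
    (ℚₚ.+-monoʳ-≤ total (*-monoʳ (½ ^ ρ) (^-nonneg 0≤½ ρ) (ι-mono (ℕₚ.*-mono-≤ size size))))
    where
    open ℚₚ.≤-Reasoning
    nj = circuit-nearJunta W 1≤W m₀≤s C f≡
    open NearJunta nj
    open Tester n s ρ p q m h E (allCircuits s)
    t = ι (4 ℕ.* E)
    β = ι s * ½ ^ W
    N = ι (2 ℕ.^ (suc s ℕ.* (p ℕ.+ s ℕ.+ 4)))
    A = t * (β + β) + t * δ + N * (1ℚ - δ) ^ m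
    t≥0 : 0ℚ ≤ t
    t≥0 = ι≥0 (4 ℕ.* E)
    β≥0 : 0ℚ ≤ β
    β≥0 = 0≤* (ι≥0 s) (^-nonneg 0≤½ W)
    A≥0 : 0ℚ ≤ A
    A≥0 = 0≤+ (0≤+ (0≤* t≥0 (0≤+ β≥0 β≥0)) (0≤* t≥0 δ≥0))
      (0≤* (ι≥0 (2 ℕ.^ (suc s ℕ.* (p ℕ.+ s ℕ.+ 4)))) (^-nonneg (0≤- δ≤1) m))
    γ = ι (suc (2 ℕ.^ ρ)) * β
    total = A + t * (ι (suc p) * inv q) + ι (q ℕ.+ p ℕ.* q) * γ
    γ≥0 : 0ℚ ≤ γ
    γ≥0 = 0≤* (ι≥0 (suc (2 ℕ.^ ρ))) β≥0
    total≥0 : 0ℚ ≤ total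
    total≥0 = 0≤+ (0≤+ A≥0 (0≤* t≥0 (0≤* (ι≥0 (suc p)) (inv≥0 q)))) (0≤* (ι≥0 (q ℕ.+ p ℕ.* q)) γ≥0)
    each : ∀ π → InjectiveOn U π → rejectProb (Find.find ρ π q p q [] (learnAndCheck π)) f ≤ total
    each π sep = begin
      rejectProb (Find.find ρ π q p q [] (learnAndCheck π)) f
        ≤⟨ find-complete f nj {ρ = ρ} π sep q (learnAndCheck π) A≥0 t≥0 β≥0
             (λ sound K≤p → learnAndCheck-complete f nj {ρ = ρ} π sep p q m h E δ≥0 δ≤1 β≥0 m₀≤s C f≡ sound K≤p)
             p q [] few (ℕₚ.≤-reflexive (ℕₚ.+-identityʳ p)) ⟩
      A + t * (r * (1ℚ - r) ^ q + ι p * inv q) + ι (q ℕ.+ p ℕ.* q) * γ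
        ≤⟨ ℚₚ.+-monoˡ-≤ (ι (q ℕ.+ p ℕ.* q) * γ) (ℚₚ.+-monoʳ-≤ A (*-monoˡ t t≥0
             (ℚₚ.+-monoˡ-≤ (ι p * inv q) (r*pow≤inv (residue≥0 []) (residue≤1 []) q)))) ⟩
      A + t * (inv q + ι p * inv q) + ι (q ℕ.+ p ℕ.* q) * γ
        ≡⟨ cong (λ e → A + t * e + ι (q ℕ.+ p ℕ.* q) * γ)
             (trans (solve 2 (λ i c → i :+ c :* i := (con 1ℚ :+ c) :* i) refl (inv q) (ι p)) (cong (_* inv q) (sym (ι-suc p)))) ⟩
      total ∎
      where
      open Separated f nj π sep
      r = residue []
      few : count (remaining f nj π sep []) ℕ.≤ p
      few = ℕₚ.≤-trans (count-mono U (remaining f nj π sep []) (λ i i∈ →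
        ∧-left (lookup U i) (trans (sym (Vecₚ.lookup∘tabulate (λ i → lookup U i ∧ true) i)) i∈))) size
        where
        ∧-left : ∀ a {b} → a ∧ b ≡ true → a ≡ true
        ∧-left true _ = refl

-- Parameters

n≤2^⌈log₂n⌉ : ∀ n → n ℕ.≤ 2 ℕ.^ ⌈log₂ n ⌉
n≤2^⌈log₂n⌉ n = go ⌈log₂ n ⌉ n ℕₚ.≤-refl
  where
  go : ∀ L n → ⌈log₂ n ⌉ ℕ.≤ L → n ℕ.≤ 2 ℕ.^ L
  go zero n le with n ℕ.≤? 1
  ... | yes n≤1 = n≤1
  ... | no n≰1 with () ← ℕₚ.≤-trans (ℕₚ.≤-trans (ℕₚ.≤-reflexive (sym (⌈log₂2^n⌉≡n 1))) (⌈log₂⌉-mono-≤ (ℕₚ.≰⇒> n≰1))) le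
  go (suc L) n le = begin
    n                               ≡⟨ sym (ℕₚ.⌊n/2⌋+⌈n/2⌉≡n n) ⟩
    ℕ.⌊ n /2⌋ ℕ.+ ℕ.⌈ n /2⌉         ≤⟨ ℕₚ.+-mono-≤ (ℕₚ.≤-trans (ℕₚ.⌊n/2⌋≤⌈n/2⌉ n) half) (ℕₚ.≤-trans half (ℕₚ.m≤m+n (2 ℕ.^ L) 0)) ⟩
    2 ℕ.^ L ℕ.+ (2 ℕ.^ L ℕ.+ 0)     ∎
    where
    open ℕₚ.≤-Reasoning
    half : ℕ.⌈ n /2⌉ ℕ.≤ 2 ℕ.^ L
    half = go L ℕ.⌈ n /2⌉ (ℕₚ.≤-trans (ℕₚ.≤-reflexive (⌈log₂⌈n/2⌉⌉≡⌈log₂n⌉∸1 n)) (ℕₚ.∸-monoˡ-≤ 1 le))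

floor≤ : ∀ q → ℚ.floor q ℤ.* ↧ q ℤ.≤ ↥ q
floor≤ q@(mkℚ _ _ _) = ℤ/.[n/d]*d≤n (↥ q) (↧ q)

≤ceilℕ : ∀ q → q ≤ ι (ceilℕ q)
≤ceilℕ q@(mkℚ n d c) = ℚₚ.toℚᵘ-cancel-≤ (ℚᵘₚ.≤-respʳ-≃ (ℚᵘₚ.≃-sym (toℚᵘ-ι (ceilℕ q))) (ℚᵘ.*≤* (begin
  n ℤ.* pos 1                        ≡⟨ ℤₚ.*-identityʳ n ⟩
  n                                  ≡⟨ sym (trans (cong ℤ.-_ (ℚₚ.↥-neg q)) (ℤₚ.neg-involutive n)) ⟩
  ℤ.- (↥ (- q))                      ≤⟨ ℤₚ.neg-mono-≤ (floor≤ (- q)) ⟩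
  ℤ.- (z ℤ.* ↧ (- q))                ≡⟨ ℤₚ.neg-distribˡ-* z (↧ (- q)) ⟩
  ℤ.- z ℤ.* ↧ (- q)                  ≡⟨ cong (ℤ.- z ℤ.*_) (ℚₚ.↧-neg q) ⟩
  ℤ.- z ℤ.* pos (suc d)              ≤⟨ ℤₚ.*-monoʳ-≤-nonNeg (pos (suc d)) (i≤∣i∣ (ℤ.- z)) ⟩
  pos (ceilℕ q) ℤ.* pos (suc d)      ∎)))
  where
  open ℤₚ.≤-Reasoning
  z = ℚ.floor (- q)
  i≤∣i∣ : ∀ i → i ℤ.≤ pos ℤ.∣ i ∣
  i≤∣i∣ (pos k)      = ℤₚ.≤-refl
  i≤∣i∣ ℤ.-[1+ k ]   = ℤ.-≤+

-- Applied to 1/ε it gives the integer `E`. The lower bound of `above-spec` yields 1/E ≤ ε for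
-- soundness, the upper one E ≤ 2/ε for the query count.
above : ℚ → ℕ
above q = suc (ℤ.∣ ↥ q ∣ ℕ./ ℚ.↧ₙ q)

above-spec : ∀ q → 0ℚ ≤ q → q ≤ ι (above q) × ι (above q) ≤ 1ℚ + q
above-spec q@(mkℚ (pos n) d c) _ = lower , ℚₚ.≤-trans (ℚₚ.≤-reflexive (ι-suc (n ℕ./ suc d))) (ℚₚ.+-monoʳ-≤ 1ℚ upper)
  where
  n≤ : n ℕ.≤ above q ℕ.* suc d
  n≤ = ℕₚ.≤-trans (ℕₚ.≤-reflexive (ℕ/.m≡m%n+[m/n]*n n (suc d))) (ℕₚ.+-monoˡ-≤ (n ℕ./ suc d ℕ.* suc d) (ℕ/.m%n≤n n (suc d)))
  lower : q ≤ ι (above q)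
  lower = ℚₚ.toℚᵘ-cancel-≤ (ℚᵘₚ.≤-respʳ-≃ (ℚᵘₚ.≃-sym (toℚᵘ-ι (above q))) (ℚᵘ.*≤*
    (ℤₚ.≤-trans (ℤₚ.≤-reflexive (ℤₚ.*-identityʳ (pos n))) (ℤₚ.≤-trans (ℤ.+≤+ n≤)
      (ℤₚ.≤-reflexive (ℤₚ.pos-* (above q) (suc d)))))))
  upper : ι (n ℕ./ suc d) ≤ q
  upper = ℚₚ.toℚᵘ-cancel-≤ (ℚᵘₚ.≤-respˡ-≃ (ℚᵘₚ.≃-sym (toℚᵘ-ι (n ℕ./ suc d))) (ℚᵘ.*≤*
    (ℤₚ.≤-trans (ℤₚ.≤-reflexive (sym (ℤₚ.pos-* (n ℕ./ suc d) (suc d)))) (ℤₚ.≤-trans (ℤ.+≤+ (ℕ/.m/n*n≤m n (suc d)))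
      (ℤₚ.≤-reflexive (sym (ℤₚ.*-identityʳ (pos n))))))))
above-spec q@(mkℚ ℤ.-[1+ n ] d c) (ℚ.*≤* ())

-- A record, so that the large numerals a are never multiplied out against open terms.
record AtMost (a u x : ℕ) : Set where
  constructor at-most
  field bounded : x ℕ.≤ a ℕ.* u
open AtMost

*-bound : ∀ {a b u v x y} → AtMost a u x → AtMost b v y → AtMost (a ℕ.* b) (u ℕ.* v) (x ℕ.* y)
*-bound {a} {b} {u} {v} (at-most h) (at-most k) = at-most (ℕₚ.≤-trans (ℕₚ.*-mono-≤ h k) (ℕₚ.≤-reflexive (ℕₚ.[m*n]*[o*p]≡[m*o]*[n*p] a u b v)))

+-bound : ∀ {a b u x y} → AtMost a u x → AtMost b u y → AtMost (a ℕ.+ b) u (x ℕ.+ y)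
+-bound {a} {b} {u} (at-most h) (at-most k) = at-most (ℕₚ.≤-trans (ℕₚ.+-mono-≤ h k) (ℕₚ.≤-reflexive (sym (ℕₚ.*-distribʳ-+ u a b))))

≤-*ʳ : ∀ a {u} → 1 ℕ.≤ u → a ℕ.≤ a ℕ.* u
≤-*ʳ a 1≤u = ℕₚ.≤-trans (ℕₚ.≤-reflexive (sym (ℕₚ.*-identityʳ a))) (ℕₚ.*-monoʳ-≤ a 1≤u)

const-bound : ∀ a {u} → 1 ℕ.≤ u → AtMost a u a
const-bound a 1≤u = at-most (≤-*ʳ a 1≤u)

id-bound : ∀ {u x} → x ℕ.≤ u → AtMost 1 u x
id-bound {u} h = at-most (ℕₚ.≤-trans h (ℕₚ.≤-reflexive (sym (ℕₚ.*-identityˡ u))))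

shrink : ∀ {a u x y} → y ℕ.≤ x → AtMost a u x → AtMost a u y
shrink le (at-most h) = at-most (ℕₚ.≤-trans le h)

widen : ∀ {a u v x} → u ℕ.≤ v → AtMost a u x → AtMost a v x
widen {a} u≤v (at-most h) = at-most (ℕₚ.≤-trans h (ℕₚ.*-monoʳ-≤ a u≤v))

-- ℓ is the logarithmic factor of the query bound; every parameter below is at most 2^(cℓ) for a
-- small constant c, and W and ρ are chosen so that 2^-W and 2^-ρ beat all of them.
module Sizes (s e ℓ : ℕ) where

  E W p ρ q d L m h u X : ℕ
  E = suc e
  W = 64 ℕ.* ℓ
  p = suc (s ℕ.* W)
  ρ = 23 ℕ.* ℓ
  q = E ℕ.* suc p ℕ.* 72
  d = E ℕ.* 72
  L = suc s ℕ.* (p ℕ.+ s ℕ.+ 4)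
  m = (L ℕ.+ 5) ℕ.* d
  h = p ℕ.* 96
  u = s ℕ.* ℓ
  X = E ℕ.* (u ℕ.* u) ℕ.* ℓ

module Parameters (s e ℓ : ℕ) (1≤s : 1 ℕ.≤ s) (1≤ℓ : 1 ℕ.≤ ℓ) (s≤ : s ℕ.≤ 2 ℕ.^ ℓ) (E≤ : suc e ℕ.≤ 2 ℕ.^ ℓ) where
  open Sizes s e ℓ

  infix 4 _≲_
  -- Only exponents are tracked. Products add them, so each condition on the parameters becomes a
  -- comparison of small numerals.
  _≲_ : ℕ → ℕ → Set
  x ≲ a = x ℕ.≤ 2 ℕ.^ (a ℕ.* ℓ)

  ≲-* : ∀ {x y} a b → x ≲ a → y ≲ b → x ℕ.* y ≲ a ℕ.+ b
  ≲-* a b h k = ℕₚ.≤-trans (ℕₚ.*-mono-≤ h k) (ℕₚ.≤-reflexive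
    (trans (sym (ℕₚ.^-distribˡ-+-* 2 (a ℕ.* ℓ) (b ℕ.* ℓ))) (cong (2 ℕ.^_) (sym (ℕₚ.*-distribʳ-+ ℓ a b)))))

  ≲-const : ∀ {c} a → c ℕ.≤ 2 ℕ.^ a → c ≲ a
  ≲-const a h = ℕₚ.≤-trans h (ℕₚ.^-monoʳ-≤ 2 (≤-*ʳ a 1≤ℓ))

  ≲-mono : ∀ {x a b} → a ℕ.≤ b → x ≲ a → x ≲ b
  ≲-mono a≤b h = ℕₚ.≤-trans h (ℕₚ.^-monoʳ-≤ 2 (ℕₚ.*-monoˡ-≤ ℓ a≤b))

  ≲-suc : ∀ {x} a → x ≲ a → suc x ≲ suc a
  ≲-suc {x} a h = ℕₚ.≤-trans (ℕₚ.+-mono-≤ (ℕₚ.m^n>0 2 (a ℕ.* ℓ)) h)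
    (ℕₚ.≤-trans (ℕₚ.≤-reflexive (cong (2 ℕ.^ (a ℕ.* ℓ) ℕ.+_) (sym (ℕₚ.+-identityʳ (2 ℕ.^ (a ℕ.* ℓ))))))
      (ℕₚ.^-monoʳ-≤ 2 (ℕₚ.+-monoˡ-≤ (a ℕ.* ℓ) 1≤ℓ)))

  ℓ≲ : ℓ ≲ 1
  ℓ≲ = ℕₚ.≤-trans (n≤2^n ℓ) (ℕₚ.^-monoʳ-≤ 2 (ℕₚ.≤-reflexive (sym (ℕₚ.*-identityˡ ℓ))))

  s≲ : s ≲ 1
  s≲ = ℕₚ.≤-trans s≤ (ℕₚ.^-monoʳ-≤ 2 (ℕₚ.≤-reflexive (sym (ℕₚ.*-identityˡ ℓ))))

  E≲ : E ≲ 1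
  E≲ = ℕₚ.≤-trans E≤ (ℕₚ.^-monoʳ-≤ 2 (ℕₚ.≤-reflexive (sym (ℕₚ.*-identityˡ ℓ))))

  p≲ : p ≲ 9
  p≲ = ≲-suc 8 (≲-* 1 7 s≲ (≲-* 6 1 (≲-const 6 ℕₚ.≤-refl) ℓ≲))

  18≲ : 18 ≲ 5
  18≲ = ≲-const 5 (ℕₚ.≤ᵇ⇒≤ 18 32 _)

  -- The exponents are 9 + 9 for the two factors `p` and 5 for 18; their sum 23 is the constant in
  -- `ρ`.
  collisions-bound : p ℕ.* p ℕ.* 18 ℕ.≤ 2 ℕ.^ ρ
  collisions-bound = ≲-* 18 5 (≲-* 9 9 p≲ p≲) 18≲

  q≲ : q ≲ 18
  q≲ = ≲-* 11 7 (≲-* 1 10 E≲ (≲-suc 9 p≲)) (≲-const 7 (ℕₚ.≤ᵇ⇒≤ 72 128 _))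

  bad-bound₁ : 4 ℕ.* E ℕ.* (s ℕ.+ s) ℕ.* 18 ℕ.≤ 2 ℕ.^ W
  bad-bound₁ = ≲-mono {b = 64} (ℕₚ.≤ᵇ⇒≤ 10 64 _) (≲-* 5 5 (≲-* 3 2 (≲-* 2 1 (≲-const 2 ℕₚ.≤-refl) E≲)
    (subst (_≲ 2) (cong (s ℕ.+_) (ℕₚ.+-identityʳ s)) (≲-* 1 1 (≲-const 1 ℕₚ.≤-refl) s≲))) 18≲)

  -- The more demanding condition on `W`: 10 for p + 1, 18 for `q`, 24 for R + 1, 1 for `s` and 5
  -- for 18 add up to 58. The constant 64 is the next power of two, and as 2^6 it enters the bound
  -- on `p`.
  bad-bound₂ : (q ℕ.+ p ℕ.* q) ℕ.* suc (2 ℕ.^ ρ) ℕ.* s ℕ.* 18 ℕ.≤ 2 ℕ.^ W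
  bad-bound₂ = ≲-mono {b = 64} (ℕₚ.≤ᵇ⇒≤ 58 64 _) (≲-* 53 5 (≲-* 52 1 (≲-* 28 24 (≲-* 10 18 (≲-suc 9 p≲) q≲) (≲-suc 23 ℕₚ.≤-refl)) s≲) 18≲)

  1≤u : 1 ℕ.≤ u
  1≤u = ℕₚ.*-mono-≤ 1≤s 1≤ℓ

  -- The summands are search, learning, dictator tests and verification. Up to constants they are E
  -- u² ℓ, E u², u² and E u with u = sℓ, so the last logarithm is due to the binary search alone.
  queries-bound : AtMost 11103324 X ((q ℕ.+ p ℕ.* q) ℕ.* (2 ℕ.+ ρ) ℕ.+ (m ℕ.+ (p ℕ.* (2 ℕ.* h ℕ.* 4 ℕ.+ 104) ℕ.+ 4 ℕ.* E ℕ.* suc (p ℕ.* 2))))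
  queries-bound = +-bound {7840800} {3262524} first (+-bound {10440} {3252084} second (+-bound {3251560} {524} third fourth))
    where
    const₁ : ∀ a → AtMost a 1 a
    const₁ a = const-bound a ℕₚ.≤-refl
    u≤uu : u ℕ.≤ u ℕ.* u
    u≤uu = ≤-*ʳ u 1≤u
    s≤u : s ℕ.≤ u
    s≤u = ≤-*ʳ s 1≤ℓ
    p≤ : AtMost 65 u p
    p≤ = +-bound {1} {64} (const-bound 1 1≤u) (*-bound {1} {64} {s} {ℓ} (id-bound ℕₚ.≤-refl) (at-most ℕₚ.≤-refl))
    sp≤ : AtMost 66 u (suc p)
    sp≤ = +-bound {1} {65} (const-bound 1 1≤u) p≤
    ρ≤ : AtMost 25 ℓ (2 ℕ.+ ρ)
    ρ≤ = +-bound {2} {23} (const-bound 2 1≤ℓ) (at-most ℕₚ.≤-refl)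
    E≤X : E ℕ.* (u ℕ.* u) ℕ.≤ X
    E≤X = ≤-*ʳ (E ℕ.* (u ℕ.* u)) 1≤ℓ
    uu≤X : u ℕ.* u ℕ.≤ X
    uu≤X = ℕₚ.≤-trans (ℕₚ.m≤m+n (u ℕ.* u) (e ℕ.* (u ℕ.* u))) E≤X
    E₁ : AtMost 1 E E
    E₁ = id-bound ℕₚ.≤-refl
    q≤ : AtMost 4752 (E ℕ.* u ℕ.* 1) q
    q≤ = *-bound {66} {72} (*-bound {1} {66} E₁ sp≤) (const₁ 72)
    first : AtMost 7840800 X ((q ℕ.+ p ℕ.* q) ℕ.* (2 ℕ.+ ρ))
    first = widen (ℕₚ.≤-reflexive (cong (ℕ._* ℓ) (trans (cong (u ℕ.*_) (ℕₚ.*-identityʳ (E ℕ.* u)))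
        (trans (sym (ℕₚ.*-assoc u E u)) (trans (cong (ℕ._* u) (ℕₚ.*-comm u E)) (ℕₚ.*-assoc E u u))))))
      (*-bound {313632} {25} (*-bound {66} {4752} sp≤ q≤) ρ≤)
    second : AtMost 10440 X m
    second = widen (ℕₚ.≤-trans (ℕₚ.≤-reflexive (trans (cong (u ℕ.* u ℕ.*_) (ℕₚ.*-identityʳ E)) (ℕₚ.*-comm (u ℕ.* u) E))) E≤X)
        (*-bound {145} {72} (+-bound {140} {5}
          (*-bound {2} {70} (+-bound {1} {1} (const-bound 1 1≤u) (id-bound s≤u)) (+-bound {66} {4} (+-bound {65} {1} p≤ (id-bound s≤u)) (const-bound 4 1≤u)))
          (const-bound 5 (ℕₚ.≤-trans 1≤u u≤uu)))
        (*-bound {1} {72} E₁ (const₁ 72)))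
    third : AtMost 3251560 X (p ℕ.* (2 ℕ.* h ℕ.* 4 ℕ.+ 104))
    third = widen uu≤X (*-bound {65} {50024} p≤ (+-bound {49920} {104}
      (widen (ℕₚ.≤-reflexive (trans (ℕₚ.*-identityʳ (1 ℕ.* (u ℕ.* 1))) (trans (ℕₚ.*-identityˡ (u ℕ.* 1)) (ℕₚ.*-identityʳ u))))
        (*-bound {12480} {4} (*-bound {2} {6240} (const₁ 2) (*-bound {65} {96} p≤ (const₁ 96))) (const₁ 4)))
      (const-bound 104 1≤u)))
    fourth : AtMost 524 X (4 ℕ.* E ℕ.* suc (p ℕ.* 2))
    fourth = widen (ℕₚ.≤-trans (ℕₚ.≤-reflexive (cong (ℕ._* u) (ℕₚ.*-identityˡ E))) (ℕₚ.≤-trans (ℕₚ.*-monoʳ-≤ E u≤uu) E≤X))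
      (*-bound {4} {131} (*-bound {4} {1} (const₁ 4) E₁) (+-bound {1} {130} (const-bound 1 1≤u) (widen {130} (ℕₚ.≤-reflexive (ℕₚ.*-identityʳ u)) (*-bound {65} {2} p≤ (const₁ 2)))))

-- The six failure probabilities at the chosen parameters

½^≡inv′ : ∀ k → ½ ^ k ≡ inv (2 ℕ.^ k) {{ℕₚ.m^n≢0 2 k}}
½^≡inv′ k = ½^≡inv k {{ℕₚ.m^n≢0 2 k}}

pow-halved : ∀ d .{{_ : ℕ.NonZero d}} → (1ℚ - inv d) ^ d ≤ ½
pow-halved d = pow≤inv (inv≥0 d) (inv≤1 d) d 2 (ℚₚ.≤-reflexive (cong (1ℚ +_) (sym (ι-inv d))))

½^5≤ : ½ ^ 5 ≤ inv 18
½^5≤ = ℚₚ.≤ᵇ⇒≤ {½ ^ 5} {inv 18} _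

ι*½^ : ∀ L → ι (2 ℕ.^ L) * ½ ^ L ≡ 1ℚ
ι*½^ L = trans (cong (ι (2 ℕ.^ L) *_) (½^≡inv′ L)) (ι-inv (2 ℕ.^ L) {{ℕₚ.m^n≢0 2 L}})

pow-bound : ∀ L d .{{_ : ℕ.NonZero d}} → (1ℚ - inv d) ^ (L ℕ.* d) ≤ ½ ^ L
pow-bound L d = ℚₚ.≤-trans (ℚₚ.≤-reflexive (^-* (1ℚ - inv d) d L)) (^-mono (^-nonneg (0≤- (inv≤1 d)) d) (pow-halved d) L)

scale : ∀ L {k c} → c ≤ k → ι (2 ℕ.^ L) * (½ ^ L * c) ≤ k
scale L {k} {c} h = ℚₚ.≤-trans (ℚₚ.≤-reflexive (trans (sym (ℚₚ.*-assoc (ι (2 ℕ.^ L)) (½ ^ L) c))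
  (trans (cong (_* c) (ι*½^ L)) (ℚₚ.*-identityˡ c)))) h

-- Each run of `d` samples halves the expected number of poor candidates: `L` runs cancel the 2^L
-- candidates and five more leave 1/32.
learning-failure : ∀ L d .{{_ : ℕ.NonZero d}} → ι (2 ℕ.^ L) * (1ℚ - inv d) ^ ((L ℕ.+ 5) ℕ.* d) ≤ inv 18
learning-failure L d = ℚₚ.≤-trans
  (*-monoˡ (ι (2 ℕ.^ L)) (ι≥0 (2 ℕ.^ L)) (ℚₚ.≤-trans (pow-bound (L ℕ.+ 5) d) (ℚₚ.≤-reflexive (^-+ ½ L 5))))
  (scale L {inv 18} {½ ^ 5} ½^5≤)

-- Opaque, so that the parameters are never computed when algorithms are compared.
opaque
  circuitTester : (n s e ℓ : ℕ) → Alg n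
  circuitTester n s e ℓ = Tester.tester n s ρ p q m h E (allCircuits s)
    where open Sizes s e ℓ

  cost : (s e ℓ : ℕ) → ℕ
  cost s e ℓ = Sizes.X s e ℓ

  queryConstant : ℕ
  queryConstant = 11103324

  cost≡ : ∀ s e ℓ → cost s e ℓ ≡ suc e ℕ.* (s ℕ.* s) ℕ.* ℓ ℕ.^ 3
  cost≡ s e ℓ = ℕsolve.solve 3 (λ e s l → e ℕsolve.:* ((s ℕsolve.:* l) ℕsolve.:* (s ℕsolve.:* l)) ℕsolve.:* l
    ℕsolve.:= e ℕsolve.:* (s ℕsolve.:* s) ℕsolve.:* (l ℕsolve.:* (l ℕsolve.:* (l ℕsolve.:* ℕsolve.con 1)))) refl (suc e) s ℓ

module _ (n s e ℓ : ℕ) (1≤s : 1 ℕ.≤ s) (1≤ℓ : 1 ℕ.≤ ℓ) (s≤ : s ℕ.≤ 2 ℕ.^ ℓ) (E≤ : suc e ℕ.≤ 2 ℕ.^ ℓ) where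
  open Sizes s e ℓ
  open Parameters s e ℓ 1≤s 1≤ℓ s≤ E≤

  private
    T₀ : Alg n
    T₀ = circuitTester n s e ℓ

    t β : ℚ
    t = ι (4 ℕ.* E)
    β = ι s * ½ ^ W

    ½^≤ : ∀ a k → a ℕ.* 18 ℕ.≤ 2 ℕ.^ k → ι a * ½ ^ k ≤ inv 18
    ½^≤ a k h = ℚₚ.≤-trans (ℚₚ.≤-reflexive (cong (ι a *_) (½^≡inv′ k))) (ι*inv≤inv a 18 (2 ℕ.^ k) {{_}} {{ℕₚ.m^n≢0 2 k}} h)

    bad-samples≤ : t * (β + β) ≤ inv 18
    bad-samples≤ = ℚₚ.≤-trans (ℚₚ.≤-reflexive (begin
      t * (ι s * P + ι s * P)           ≡⟨ solve 3 (λ t s p → t :* (s :* p :+ s :* p) := t :* (s :+ s) :* p) refl t (ι s) P ⟩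
      t * (ι s + ι s) * P               ≡⟨ cong (λ z → t * z * P) (sym (ι-+ s s)) ⟩
      t * ι (s ℕ.+ s) * P               ≡⟨ cong (_* P) (sym (ι-* (4 ℕ.* E) (s ℕ.+ s))) ⟩
      ι (4 ℕ.* E ℕ.* (s ℕ.+ s)) * P     ∎)) (½^≤ (4 ℕ.* E ℕ.* (s ℕ.+ s)) W bad-bound₁)
      where
      open ≡-Reasoning
      P = ½ ^ W

    -- The 72 in `d` is 4 · 18: accuracy 1/(72E) over 4E samples costs exactly 1/18.
    inaccuracy≤ : t * inv d ≤ inv 18
    inaccuracy≤ = ι*inv≤inv (4 ℕ.* E) 18 d (ℕₚ.≤-reflexive (trans (cong (ℕ._* 18) (ℕₚ.*-comm 4 E)) (ℕₚ.*-assoc E 4 18)))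

    mislearning≤ : ι (2 ℕ.^ L) * (1ℚ - inv d) ^ m ≤ inv 18
    mislearning≤ = learning-failure L d

    -- The same 72 = 4 · 18 in `q`, with p + 1 stages each leaving an expected error of 1/q.
    unfound-blocks≤ : t * (ι (suc p) * inv q) ≤ inv 18
    unfound-blocks≤ = ℚₚ.≤-trans (ℚₚ.≤-reflexive (trans (sym (ℚₚ.*-assoc t (ι (suc p)) (inv q))) (cong (_* inv q) (sym (ι-* (4 ℕ.* E) (suc p))))))
      (ι*inv≤inv (4 ℕ.* E ℕ.* suc p) 18 q (ℕₚ.≤-reflexive (trans (cong (ℕ._* 18) (trans (ℕₚ.*-assoc 4 E (suc p)) (ℕₚ.*-comm 4 (E ℕ.* suc p))))
        (ℕₚ.*-assoc (E ℕ.* suc p) 4 18))))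

    bad-hybrids≤ : ι (q ℕ.+ p ℕ.* q) * (ι (suc (2 ℕ.^ ρ)) * β) ≤ inv 18
    bad-hybrids≤ = ℚₚ.≤-trans (ℚₚ.≤-reflexive (begin
      ι a * (ι b * (ι s * P))           ≡⟨ solve 4 (λ a b s p → a :* (b :* (s :* p)) := a :* b :* s :* p) refl (ι a) (ι b) (ι s) P ⟩
      ι a * ι b * ι s * P               ≡⟨ cong (λ z → z * ι s * P) (sym (ι-* a b)) ⟩
      ι (a ℕ.* b) * ι s * P             ≡⟨ cong (_* P) (sym (ι-* (a ℕ.* b) s)) ⟩
      ι (a ℕ.* b ℕ.* s) * P             ∎)) (½^≤ (a ℕ.* b ℕ.* s) W bad-bound₂)
      where
      open ≡-Reasoning
      P = ½ ^ W
      a = q ℕ.+ p ℕ.* q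
      b = suc (2 ℕ.^ ρ)

    collisions≤ : ι (p ℕ.* p) * ½ ^ ρ ≤ inv 18
    collisions≤ = ½^≤ (p ℕ.* p) ρ collisions-bound

  opaque
    unfolding circuitTester cost queryConstant

    circuitTester-complete : (f : BoolFn n) → InSizeCircuit s f → rejectProb T₀ f ≤ inv 3
    circuitTester-complete f f∈ = ℚₚ.≤-trans
      (tester-complete ρ p q m h E W (ℕₚ.≤-trans 1≤ℓ (ℕₚ.m≤m+n ℓ (63 ℕ.* ℓ))) refl (inv≥0 d) (inv≤1 d) f f∈)
      (ℚₚ.≤-trans (ℚₚ.+-mono-≤ (ℚₚ.+-mono-≤ (ℚₚ.+-mono-≤ (ℚₚ.+-mono-≤ (ℚₚ.+-mono-≤ bad-samples≤ inaccuracy≤) mislearning≤) unfound-blocks≤) bad-hybrids≤) collisions≤)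
        (ℚₚ.≤ᵇ⇒≤ {((((inv 18 + inv 18) + inv 18) + inv 18) + inv 18) + inv 18} {inv 3} _))

    circuitTester-sound : (f : BoolFn n) → (∀ {m} → m ℕ.≤ s → (C : Circuit n m) → inv E ≤ M n (λ x → ⟦ f x xor eval C x ⟧)) →
      acceptProb T₀ f ≤ inv 3
    circuitTester-sound f far = tester-sound f ρ p q m h E (allCircuits s)
      -- The choice h = 96p meets both demands: 96 ≤ h for the thresholds of `dictator`, and 4p ≤ h
      -- for decoding `p` bits at once.
      (ℕₚ.m≤m+n 96 (s ℕ.* W ℕ.* 96)) (ℕₚ.*-monoʳ-≤ p (ℕₚ.≤ᵇ⇒≤ 4 96 _)) far

    queries-circuitTester : queries T₀ ℕ.≤ queryConstant ℕ.* cost s e ℓ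
    queries-circuitTester = AtMost.bounded (shrink (queries-tester≤ {n} s ρ p q m h E (allCircuits s)) queries-bound)

-- From ε to the parameters, and the final bound

recip : (ε : ℚ) → 0ℚ < ε → ℚ
recip ε ε>0 = (1/ ε) {{ℚₚ.pos⇒nonZero ε {{positive ε>0}}}}

logFactor : ℕ → (ε : ℚ) → 0ℚ < ε → ℕ
logFactor s ε ε>0 = 1 ℕ.+ ⌈log₂ ceilℕ (T s ε ε>0) ⌉

-- For ε > 1 no function is ε-far from the class.
algorithmFor : (n s : ℕ) (ε : ℚ) → Dec (0ℚ < ε) → Dec (ε ≤ 1ℚ) → Alg n
-- `above` is a successor, so `pred` followed by `E = suc e` gives it back; `E` is then visibly
-- nonzero.
algorithmFor n s ε (yes ε>0) (yes _) = circuitTester n s (ℕ.pred (above (recip ε ε>0))) (logFactor s ε ε>0)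
algorithmFor n s ε (yes _)   (no _)  = accept
algorithmFor n s ε (no _)    _       = accept

algorithm : (n s : ℕ) → ℚ → Alg n
algorithm n s ε = algorithmFor n s ε (0ℚ ℚₚ.<? ε) (ε ℚₚ.≤? 1ℚ)

far⇒≤M : ∀ {n s ε} (f : BoolFn n) → FarFromSizeCircuit s ε f → ∀ {m} → m ℕ.≤ s → (C : Circuit n m) →
  ε ≤ M n (λ x → ⟦ f x xor eval C x ⟧)
far⇒≤M {n} {s} {ε} f far {m} m≤s C = begin
  ε                                 ≡⟨ sym (ℚₚ.*-identityʳ ε) ⟩
  ε * 1ℚ                            ≡⟨ cong (ε *_) (sym N*I) ⟩
  ε * (N * I)                       ≡⟨ sym (ℚₚ.*-assoc ε N I) ⟩
  ε * N * I                         ≤⟨ *-monoʳ I (inv≥0 (2 ℕ.^ n) {{N≢0}}) (far m m≤s C) ⟩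
  ι (disagree f (eval C)) * I       ≡⟨ cong (_* I) (sym (ι-disagree f (eval C))) ⟩
  N * D * I                         ≡⟨ solve 3 (λ n d i → n :* d :* i := d :* (n :* i)) refl N D I ⟩
  D * (N * I)                       ≡⟨ cong (D *_) N*I ⟩
  D * 1ℚ                            ≡⟨ ℚₚ.*-identityʳ D ⟩
  D                                 ∎
  where
  open ℚₚ.≤-Reasoning
  N≢0 : ℕ.NonZero (2 ℕ.^ n)
  N≢0 = ℕₚ.m^n≢0 2 n
  N = ι (2 ℕ.^ n)
  I = inv (2 ℕ.^ n) {{N≢0}}
  N*I : N * I ≡ 1ℚ
  N*I = ι-inv (2 ℕ.^ n) {{N≢0}}
  D = M n (λ x → ⟦ f x xor eval C x ⟧)

-- With s ≥ 1 and ε ≤ 1, both s and 1/ε are at most s²/ε, so the single logarithm ℓ controls both.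
-- The 1 added in ℓ absorbs the factor 2 of E ≤ 2/ε.
module Rates (s : ℕ) (1≤s : 1 ℕ.≤ s) (ε : ℚ) (ε>0 : 0ℚ < ε) (ε≤1 : ε ≤ 1ℚ) where

  y t : ℚ
  y = recip ε ε>0
  t = T s ε ε>0

  e ℓ : ℕ
  e = ℕ.pred (above y)
  ℓ = logFactor s ε ε>0

  ε≥0 : 0ℚ ≤ ε
  ε≥0 = ℚₚ.<⇒≤ ε>0

  ε*y : ε * y ≡ 1ℚ
  ε*y = ℚₚ.*-inverseʳ ε {{ℚₚ.pos⇒nonZero ε {{positive ε>0}}}}

  y≥0 : 0ℚ ≤ y
  y≥0 = ℚₚ.<⇒≤ (ℚₚ.positive⁻¹ y {{ℚₚ.1/pos⇒pos ε {{positive ε>0}}}})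

  1≤y : 1ℚ ≤ y
  1≤y = ℚₚ.≤-trans (ℚₚ.≤-reflexive (sym ε*y)) (ℚₚ.≤-trans (*-monoʳ y y≥0 ε≤1) (ℚₚ.≤-reflexive (ℚₚ.*-identityˡ y)))

  E≤2y : ι (suc e) ≤ y + y
  E≤2y = ℚₚ.≤-trans (proj₂ (above-spec y y≥0)) (ℚₚ.+-monoˡ-≤ y 1≤y)

  invE≤ε : inv (suc e) ≤ ε
  invE≤ε = begin
    I                 ≡⟨ sym (ℚₚ.*-identityˡ I) ⟩
    1ℚ * I            ≡⟨ cong (_* I) (sym ε*y) ⟩
    ε * y * I         ≤⟨ *-monoʳ I (inv≥0 (suc e)) (*-monoˡ ε ε≥0 (proj₁ (above-spec y y≥0))) ⟩
    ε * ι (suc e) * I ≡⟨ ℚₚ.*-assoc ε (ι (suc e)) I ⟩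
    ε * (ι (suc e) * I) ≡⟨ cong (ε *_) (ι-inv (suc e)) ⟩
    ε * 1ℚ            ≡⟨ ℚₚ.*-identityʳ ε ⟩
    ε                 ∎
    where
    open ℚₚ.≤-Reasoning
    I = inv (suc e)

  s≤ss : s ℕ.≤ s ℕ.* s
  s≤ss = ≤-*ʳ s 1≤s

  y≤t : y ≤ t
  y≤t = ℚₚ.≤-trans (ℚₚ.≤-reflexive (sym (ℚₚ.*-identityˡ y))) (*-monoʳ y y≥0 (ι-mono {1} (ℕₚ.≤-trans 1≤s s≤ss)))

  s≤t : ι s ≤ t
  s≤t = ℚₚ.≤-trans (ι-mono s≤ss) (ℚₚ.≤-trans (ℚₚ.≤-reflexive (sym (ℚₚ.*-identityʳ (ι (s ℕ.* s))))) (*-monoˡ (ι (s ℕ.* s)) (ι≥0 (s ℕ.* s)) 1≤y))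

  c≤ : ceilℕ t ℕ.≤ 2 ℕ.^ ⌈log₂ ceilℕ t ⌉
  c≤ = n≤2^⌈log₂n⌉ (ceilℕ t)

  s≤2^ℓ : s ℕ.≤ 2 ℕ.^ ℓ
  s≤2^ℓ = ℕₚ.≤-trans (ι-cancel (ℚₚ.≤-trans s≤t (≤ceilℕ t))) (ℕₚ.≤-trans c≤ (ℕₚ.m≤m+n (2 ℕ.^ ⌈log₂ ceilℕ t ⌉) _))

  E≤2^ℓ : suc e ℕ.≤ 2 ℕ.^ ℓ
  E≤2^ℓ = ℕₚ.≤-trans (ι-cancel (ℚₚ.≤-trans E≤2y (ℚₚ.≤-trans (ℚₚ.+-mono-≤ y≤c y≤c) (ℚₚ.≤-reflexive (sym (ι-+ (ceilℕ t) (ceilℕ t)))))))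
    (ℕₚ.+-mono-≤ c≤ (ℕₚ.≤-trans c≤ (ℕₚ.m≤m+n (2 ℕ.^ ⌈log₂ ceilℕ t ⌉) 0)))
    where
    y≤c : y ≤ ι (ceilℕ t)
    y≤c = ℚₚ.≤-trans y≤t (≤ceilℕ t)

  -- The constant doubles because of E ≤ 2/ε. The exponent 3 is ℓ² from u² and ℓ from the binary
  -- search.
  soft : ∀ {Q} → Q ℕ.≤ queryConstant ℕ.* cost s e ℓ → ι Q ≤ SoftOBound (queryConstant ℕ.+ queryConstant) 3 t
  soft {Q} bound = begin
    ι Q                                     ≤⟨ ι-mono bound ⟩
    ι (c ℕ.* cost s e ℓ)                    ≡⟨ trans (ι-* c (cost s e ℓ)) (cong (λ z → ι c * ι z) (cost≡ s e ℓ)) ⟩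
    ι c * ι (suc e ℕ.* (s ℕ.* s) ℕ.* ℓ ℕ.^ 3) ≡⟨ cong (ι c *_) (trans (ι-* (suc e ℕ.* (s ℕ.* s)) (ℓ ℕ.^ 3)) (cong (_* ι (ℓ ℕ.^ 3)) (ι-* (suc e) (s ℕ.* s)))) ⟩
    ι c * (ι (suc e) * S * Λ)               ≤⟨ *-monoˡ (ι c) (ι≥0 c) (*-monoʳ Λ (ι≥0 (ℓ ℕ.^ 3)) (*-monoʳ S (ι≥0 (s ℕ.* s)) E≤2y)) ⟩
    ι c * ((y + y) * S * Λ)                 ≡⟨ solve 4 (λ c y s l → c :* ((y :+ y) :* s :* l) := (c :+ c) :* (s :* y) :* l) refl (ι c) y S Λ ⟩
    (ι c + ι c) * (S * y) * Λ               ≡⟨ cong (λ z → z * (S * y) * Λ) (sym (ι-+ c c)) ⟩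
    ι (c ℕ.+ c) * (S * y) * Λ               ∎
    where
    open ℚₚ.≤-Reasoning
    c = queryConstant
    S = ι (s ℕ.* s)
    Λ = ι (ℓ ℕ.^ 3)

soft≥0 : ∀ c k s ε ε>0 → 0ℚ ≤ SoftOBound c k (T s ε ε>0)
soft≥0 c k s ε ε>0 = 0≤* (0≤* (ι≥0 c) (0≤* (ι≥0 (s ℕ.* s)) (ℚₚ.<⇒≤ (ℚₚ.positive⁻¹ (recip ε ε>0) {{ℚₚ.1/pos⇒pos ε {{positive ε>0}}}}))))
  (ι≥0 ((1 ℕ.+ ⌈log₂ ceilℕ (T s ε ε>0) ⌉) ℕ.^ k))

accepts : ∀ {n} (f : BoolFn n) A → rejectProb A f ≤ inv 3 → twoThirds ≤ acceptProb A f
accepts f A r≤ = begin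
  twoThirds                                        ≡⟨⟩
  1ℚ - inv 3                                       ≤⟨ ℚₚ.+-monoʳ-≤ 1ℚ (ℚₚ.neg-antimono-≤ r≤) ⟩
  1ℚ - rejectProb A f                              ≡⟨ cong (_- rejectProb A f) (sym (accept+reject f A)) ⟩
  acceptProb A f + rejectProb A f - rejectProb A f ≡⟨ solve 2 (λ a r → a :+ r :- r := a) refl (acceptProb A f) (rejectProb A f) ⟩
  acceptProb A f                                   ∎
  where open ℚₚ.≤-Reasoning

rejects : ∀ {n} (f : BoolFn n) A → acceptProb A f ≤ inv 3 → twoThirds ≤ rejectProb A f
rejects f A a≤ = begin
  twoThirds                                        ≡⟨⟩
  1ℚ - inv 3                                       ≤⟨ ℚₚ.+-monoʳ-≤ 1ℚ (ℚₚ.neg-antimono-≤ a≤) ⟩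
  1ℚ - acceptProb A f                              ≡⟨ cong (_- acceptProb A f) (sym (accept+reject f A)) ⟩
  acceptProb A f + rejectProb A f - acceptProb A f ≡⟨ solve 2 (λ a r → a :+ r :- a := r) refl (acceptProb A f) (rejectProb A f) ⟩
  rejectProb A f                                   ∎
  where open ℚₚ.≤-Reasoning

algorithmFor-tests : ∀ n s → s ≥ 1 → ∀ ε (ε>0 : 0ℚ < ε) d₁ d₂ →
  ((f : BoolFn n) → InSizeCircuit s f → twoThirds ≤ acceptProb (algorithmFor n s ε d₁ d₂) f)
  × ((f : BoolFn n) → FarFromSizeCircuit s ε f → twoThirds ≤ rejectProb (algorithmFor n s ε d₁ d₂) f)
  × (ι (queries (algorithmFor n s ε d₁ d₂)) ≤ SoftOBound (queryConstant ℕ.+ queryConstant) 3 (T s ε ε>0))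
algorithmFor-tests n s s≥1 ε ε>0 (no ≯0) _ = ⊥-elim (≯0 ε>0)
algorithmFor-tests n s s≥1 ε ε>0 (yes _) (no ε≰1) =
  (λ f _ → accepts f accept (inv≥0 3)) ,
  -- Farness from the gate-free constant circuit already forces ε ≤ 1, since no distance exceeds 1.
  (λ f far → ⊥-elim (ε≰1 (ℚₚ.≤-trans (far⇒≤M f far ℕ.z≤n (circuit [] (inj₂ (inj₁ true)))) (M-≤ n λ x → ⟦⟧≤1 (f x xor true))))) ,
  soft≥0 (queryConstant ℕ.+ queryConstant) 3 s ε ε>0
algorithmFor-tests n s s≥1 ε ε>0 (yes ε>0′) (yes ε≤1) =
  (λ f f∈ → accepts f A (circuitTester-complete n s e ℓ s≥1 1≤ℓ s≤2^ℓ E≤2^ℓ f f∈)) ,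
  (λ f far → rejects f A (circuitTester-sound n s e ℓ s≥1 1≤ℓ s≤2^ℓ E≤2^ℓ f λ m≤s C → ℚₚ.≤-trans invE≤ε (far⇒≤M f far m≤s C))) ,
  soft (queries-circuitTester n s e ℓ s≥1 1≤ℓ s≤2^ℓ E≤2^ℓ)
  where
  open Rates s s≥1 ε ε>0′ ε≤1
  A = circuitTester n s e ℓ
  1≤ℓ : 1 ℕ.≤ ℓ
  1≤ℓ = ℕ.s≤s ℕ.z≤n

open import Data.Integer using (+_)

theorem19 : Σ ℕ λ c → Σ ℕ λ k →
    Σ ((n s : ℕ) → ℚ → Alg n) λ A →
    (n s : ℕ) → s ≥ 1 → (ε : ℚ) → (ε>0 : 0ℚ < ε) →
    ((f : BoolFn n) → InSizeCircuit s f → twoThirds ≤ acceptProb (A n s ε) f)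
    × ((f : BoolFn n) → FarFromSizeCircuit s ε f → twoThirds ≤ rejectProb (A n s ε) f)
    × ((+ queries (A n s ε) / 1) ≤ SoftOBound c k (T s ε ε>0))
theorem19 = queryConstant ℕ.+ queryConstant , 3 , algorithm ,
  λ n s s≥1 ε ε>0 → algorithmFor-tests n s s≥1 ε ε>0 (0ℚ ℚₚ.<? ε) (ε ℚₚ.≤? 1ℚ)
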